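{- Let $q$ be a prime power, $\Delta$ an $n\times n$ diagonal matrix over $\mathbb{F}_q$ with distinct diagonal entries, and $\mu=(\mu_1,\dots,\mu_k)$ a partition with positive parts. The number of subspaces of $\mathbb{F}_q^n$ with partial $\Delta$-profile $\mu$ is $$\pi_n(\mu)=(q-1)^{\sum_{j\ge2}\mu_j}q^{\sum_{j\ge2}\binom{\mu_j}{2}}\sum_{T}c_q(T)\,q^{\gamma_n(T)},$$ the sum over all multilinear tableaux $T$ of shape $\mu'$ (the conjugate of $\mu$) whose support is contained in $[n]$.
   Context: $W$ has partial $\Delta$-profile $\mu$ if $\dim(W+\Delta W+\dots+\Delta^{j-1}W)=\mu_1+\dots+\mu_j$ for $1\le j\le k$. A multilinear tableau of shape $\lambda=(\lambda_1,\dots,\lambda_r)$ is an array $(T_{ij})$ of distinct positive integers with rows increasing left to right and columns increasing top to bottom; its support $\mathrm{supp}(T)$ is its set of entries. For $2\le j\le\lambda_i$, $c_{ij}(T)=\#\{i'\ge i:\text{cell }(i',j-1)\text{ exists and }T_{i',j-1}<T_{ij}\}$, $c_q(T)=\prod_i\prod_{j=2}^{\lambda_i}[c_{ij}(T)]_q$ with $[a]_q=1+q+\dots+q^{a-1}$. For sets $C,C'\subset\mathbb{N}$, $\beta(C,C')=\#\{(c,c'):c\in C,c'\in C',c<c'\}$. If $C_{\mathrm{last}}$ is the set of entries of the last column of $T$, then $\gamma_n(T)=\beta(C_{\mathrm{last}},[n]\setminus\mathrm{supp}(T))$. -}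

module Defs where

open import Data.Nat using (ℕ; zero; suc; _+_; _*_; _∸_; _^_; _≤_; _<_; _<ᵇ_; _≡ᵇ_)
open import Data.Nat.Primality using (Prime)
open import Data.Nat.Combinatorics using (_C_)
open import Data.Bool using (Bool; true; false; _∧_; _∨_; not; if_then_else_)
open import Data.Fin as Fin using (Fin)
open import Data.Vec as V using (Vec; lookup; zipWith; replicate)
open import Data.Nat.ListAction using (sum; product)
open import Data.List as L using (List; []; _∷_; length; map; concatMap; filter; upTo; drop; foldr; applyUpTo)
open import Data.Maybe using (Maybe; just; nothing)
open import Data.Product using (Σ; ∃; ∃-syntax; _×_; _,_)
open import Data.Empty using (⊥)
open import Relation.Nullary using (¬_)
open import Data.Unit using (⊤)
open import Data.List.Relation.Unary.All using (All)
open import Data.List.Relation.Unary.Any using (Any)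
open import Data.List.Relation.Unary.AllPairs using (AllPairs)
open import Data.Nat using (_⊔_)
open import Relation.Binary.PropositionalEquality using (_≡_; _≢_)
open import Algebra.Structures using (IsCommutativeRing)

IsPrimePower : ℕ → Set
IsPrimePower q = ∃[ p ] ∃[ e ] (Prime p × 1 ≤ e × q ≡ p ^ e)

-- A field structure on the q-element set Fin q (every finite field of
-- order q is isomorphic to one of these).
record FieldOn (q : ℕ) : Set where
  infixl 6 _+F_
  infixl 7 _*F_
  field
    _+F_ _*F_ : Fin q → Fin q → Fin q
    -F_       : Fin q → Fin q
    0F 1F     : Fin q
    isCommutativeRing : IsCommutativeRing _≡_ _+F_ _*F_ -F_ 0F 1F
    0≢1       : 0F ≢ 1F
    inverse   : ∀ x → x ≢ 0F → ∃[ y ] (x *F y ≡ 1F)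

module LinAlg {q : ℕ} (𝔽 : FieldOn q) (n : ℕ) where
  open FieldOn 𝔽

  Vect : Set
  Vect = Vec (Fin q) n

  zeroV : Vect
  zeroV = replicate n 0F

  _+V_ : Vect → Vect → Vect
  _+V_ = zipWith _+F_

  _·V_ : Fin q → Vect → Vect
  a ·V v = V.map (a *F_) v

  diagApply : Vec (Fin q) n → Vect → Vect
  diagApply d v = zipWith _*F_ d v

  diagPow : Vec (Fin q) n → ℕ → Vect → Vect
  diagPow d zero    v = v
  diagPow d (suc i) v = diagApply d (diagPow d i v)

  sumV : ∀ {m} → Vec Vect m → Vect
  sumV = V.foldr _ _+V_ zeroV

  linComb : ∀ {m} → Vec (Fin q) m → Vec Vect m → Vect
  linComb c b = sumV (zipWith _·V_ c b)

  LinIndep : ∀ {m} → Vec Vect m → Set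
  LinIndep {m} b = ∀ (c : Vec (Fin q) m) → linComb c b ≡ zeroV → c ≡ replicate m 0F

  HasDim : (Vect → Set) → ℕ → Set
  HasDim U m = ∃[ b ] ((∀ i → U (lookup {n = m} b i)) × LinIndep b
                       × (∀ u → U u → ∃[ c ] (u ≡ linComb c b)))

  Mem : (Vect → Bool) → Vect → Set
  Mem W v = W v ≡ true

  IsSubspace : (Vect → Bool) → Set
  IsSubspace W = Mem W zeroV
               × (∀ u v → Mem W u → Mem W v → Mem W (u +V v))
               × (∀ a v → Mem W v → Mem W (a ·V v))

  KrylovSum : Vec (Fin q) n → (Vect → Bool) → ℕ → Vect → Set
  KrylovSum d W j v = ∃[ ws ] ((∀ i → Mem W (lookup ws i))
                        × v ≡ sumV (V.map (λ i → diagPow d (Fin.toℕ i) (lookup ws i)) (V.allFin j)))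

  HasPartialProfile : Vec (Fin q) n → (Vect → Bool) → List ℕ → Set
  HasPartialProfile d W μ = ∀ j → 1 ≤ j → j ≤ length μ →
                            HasDim (KrylovSum d W j) (sum (L.take j μ))

  CountIs : ((Vect → Bool) → Set) → ℕ → Set
  CountIs P N = ∃[ Ws ] (All P Ws
                        × (∀ W → P W → Any (λ W' → ∀ v → W v ≡ W' v) Ws)
                        × AllPairs (λ W W' → ¬ (∀ v → W v ≡ W' v)) Ws
                        × length Ws ≡ N)

Decreasing : List ℕ → Set
Decreasing []           = ⊤
Decreasing (x ∷ [])     = ⊤
Decreasing (x ∷ y ∷ xs) = (y ≤ x) × Decreasing (y ∷ xs)

IsPartition : List ℕ → Set
IsPartition μ = All (λ m → 1 ≤ m) μ × Decreasing μ

count : {A : Set} → (A → Bool) → List A → ℕ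
count p []       = 0
count p (x ∷ xs) = (if p x then 1 else 0) + count p xs

filterB : {A : Set} → (A → Bool) → List A → List A
filterB p []       = []
filterB p (x ∷ xs) = if p x then x ∷ filterB p xs else filterB p xs

conjugate : List ℕ → List ℕ
conjugate μ = applyUpTo (λ j → count (λ m → j <ᵇ m) μ) (foldr _⊔_ 0 μ)

-- Multilinear tableaux, represented as lists of rows (0-indexed cells)

Tableau : Set
Tableau = List (List ℕ)

range1 : ℕ → List ℕ
range1 n = applyUpTo suc n

words : ℕ → ℕ → List (List ℕ)
words n zero    = [] ∷ []
words n (suc l) = concatMap (λ a → map (a ∷_) (words n l)) (range1 n)

fillings : ℕ → List ℕ → List Tableau
fillings n []       = [] ∷ []
fillings n (l ∷ ls) = concatMap (λ r → map (r ∷_) (fillings n ls)) (words n l)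

rowInc : List ℕ → Bool
rowInc (a ∷ b ∷ r) = (a <ᵇ b) ∧ rowInc (b ∷ r)
rowInc _           = true

belowLarger : List ℕ → List ℕ → Bool
belowLarger r        []       = true
belowLarger []       (_ ∷ _)  = false
belowLarger (a ∷ r)  (b ∷ s)  = (a <ᵇ b) ∧ belowLarger r s

colsInc : Tableau → Bool
colsInc (r ∷ s ∷ rs) = belowLarger r s ∧ colsInc (s ∷ rs)
colsInc _            = true

elemB : ℕ → List ℕ → Bool
elemB x []       = false
elemB x (y ∷ ys) = (x ≡ᵇ y) ∨ elemB x ys

distinctB : List ℕ → Bool
distinctB []       = true
distinctB (x ∷ xs) = not (elemB x xs) ∧ distinctB xs

supp : Tableau → List ℕ
supp = L.concat

IsMultilinear : Tableau → Bool
IsMultilinear T = L.foldr (λ r b → rowInc r ∧ b) true T ∧ colsInc T ∧ distinctB (supp T)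

multilinearTableaux : ℕ → List ℕ → List Tableau
multilinearTableaux n λ′ = filterB IsMultilinear (fillings n λ′)

lookupM : {A : Set} → List A → ℕ → Maybe A
lookupM []       _       = nothing
lookupM (x ∷ xs) zero    = just x
lookupM (x ∷ xs) (suc i) = lookupM xs i

entry : Tableau → ℕ → ℕ → Maybe ℕ
entry T i j with lookupM T i
... | nothing = nothing
... | just r  = lookupM r j

qInt : ℕ → ℕ → ℕ
qInt q a = sum (applyUpTo (q ^_) a)

-- c_{ij}(T) for the 0-indexed cell (i , suc j) with entry x:
-- #{i' ≥ i : cell (i', j) exists and T_{i'j} < x}
cEntry : Tableau → ℕ → ℕ → ℕ → ℕ
cEntry T i j x = count (λ i′ → below (entry T i′ j)) (L.applyUpTo (i +_) (length T ∸ i))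
  where
  below : Maybe ℕ → Bool
  below nothing  = false
  below (just a) = a <ᵇ x

cq : ℕ → Tableau → ℕ
cq q T = product (L.applyUpTo rowFactor (length T))
  where
  cellFactors : ℕ → ℕ → List ℕ → List ℕ
  cellFactors i j []      = []
  cellFactors i j (x ∷ r) = qInt q (cEntry T i j x) ∷ cellFactors i (suc j) r
  rowFactor : ℕ → ℕ
  rowFactor i with lookupM T i
  ... | nothing         = 1
  ... | just []         = 1
  ... | just (_ ∷ r)    = product (cellFactors i 0 r)

β : List ℕ → List ℕ → ℕ
β C C′ = sum (map (λ c → count (λ c′ → c <ᵇ c′) C′) C)

lastColumn : Tableau → List ℕ
lastColumn []       = []
lastColumn (r ∷ rs) = collect (r ∷ rs)
  where
  lastIdx : ℕ
  lastIdx = length r ∸ 1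
  collect : Tableau → List ℕ
  collect []       = []
  collect (s ∷ ss) with lookupM s lastIdx
  ... | nothing = collect ss
  ... | just a  = a ∷ collect ss

γ : ℕ → Tableau → ℕ
γ n T = β (lastColumn T) (filterB (λ c → not (elemB c (supp T))) (range1 n))

piFormula : ℕ → ℕ → List ℕ → ℕ
piFormula q n μ =
  (q ∸ 1) ^ sum (drop 1 μ) * q ^ sum (map (_C 2) (drop 1 μ))
  * sum (map (λ T → cq q T * q ^ γ n T) (multilinearTableaux n (conjugate μ)))

{-# OPTIONS --safe #-}
module Submission where

open import Defs
open import Algebra.Bundles using (CommutativeRing)
import Algebra.Properties.Ring
import Algebra.Properties.Semiring.Sum
import Algebra.Solver.Ring.NaturalCoefficients.Default
open import Data.Bool as Bool using (Bool; true; false; if_then_else_; _∧_; _∨_; not)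
import Data.Bool.Properties as Bool
open import Data.Empty using (⊥; ⊥-elim)
open import Data.Fin as Fin using (Fin; zero; suc; toℕ)
import Data.Fin.Properties as Fin
open import Data.List as List using (List; []; _∷_; length; map; concatMap; filter; _++_;
  applyUpTo; drop; take)
open import Data.List.Membership.Propositional using (_∈_; find; lose)
open import Data.List.Membership.Propositional.Properties using (∈-map⁺; ∈-map⁻; ∈-concatMap⁺;
  ∈-concatMap⁻; ∈-filter⁺; ∈-filter⁻; ∈-applyUpTo⁺; ∈-applyUpTo⁻; ∈-allFin)
open import Data.List.Membership.Propositional.Properties.WithK using (unique∧set⇒bag)
open import Data.List.Properties using (length-map; length-++; length-tabulate;
  length-applyUpTo; map-++; map-∘; ++-identityʳ) renaming (∷-injective to List-∷-injective)
open import Data.List.Relation.Binary.BagAndSetEquality using (∼bag⇒↭)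
open import Data.List.Relation.Binary.Permutation.Propositional using (_↭_; ↭-refl; ↭-trans;
  ↭-sym; prep; ↭⇒↭ₛ)
open import Data.List.Relation.Binary.Permutation.Propositional.Properties using (↭-length;
  ∈-resp-↭; All-resp-↭; shifts; ++⁺ˡ) renaming (map⁺ to ↭-map⁺)
import Data.List.Relation.Binary.Permutation.Setoid.Properties as PermS
open import Data.List.Relation.Unary.All as All using (All; []; _∷_)
open import Data.List.Relation.Unary.All.Properties using () renaming (++⁺ to All-++⁺; ++⁻ˡ to
  All-++⁻ˡ; ++⁻ʳ to All-++⁻ʳ)
open import Data.List.Relation.Unary.AllPairs as AllPairs using (AllPairs; []; _∷_)
open import Data.List.Relation.Unary.Any as Any using (Any; here; there)
open import Data.List.Relation.Unary.Linked using (Linked; []; [-]; _∷_)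
open import Data.List.Relation.Unary.Linked.Properties using (Linked⇒AllPairs; AllPairs⇒Linked)
open import Data.List.Relation.Unary.Unique.Propositional using (Unique)
import Data.List.Relation.Unary.Unique.Propositional.Properties as Unique
open import Data.Maybe using (Maybe; just; nothing)
open import Data.Nat as ℕ using (ℕ; zero; suc; _+_; _*_; _∸_; _^_; _≤_; _<_; _<ᵇ_; _≡ᵇ_; _⊔_;
  z≤n; s≤s)
open import Data.Nat.Combinatorics using (nC1≡n; nCk+nC[k+1]≡[n+1]C[k+1]) renaming (_C_ to _choose_)
open import Data.Nat.ListAction using (sum; product)
open import Data.Nat.ListAction.Properties using (sum-++; sum-↭)
open import Data.Nat.Properties as ℕ hiding (_≟_)
open import Data.Nat.Solver using (module +-*-Solver)
open import Data.Product using (∃-syntax; _×_; _,_; proj₁; proj₂)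
open import Data.Sum using (_⊎_; inj₁; inj₂)
open import Data.Unit using (⊤; tt)
open import Data.Vec as Vec using (Vec; []; _∷_; lookup; zipWith; tabulate; replicate; _[_]≔_)
open import Data.Vec.Properties using (lookup-zipWith; lookup∘tabulate; lookup-replicate;
  lookup-map; lookup∘updateAt; lookup∘updateAt′; ∷-injective; tabulate-∘; zipWith-assoc;
  zipWith-comm; zipWith-identityˡ; zipWith-identityʳ; ≡-dec)
open import Function using (_∘_; id; case_of_)
open import Function.Bundles using (mk⇔)
open import Level using (0ℓ)
open import Relation.Binary.Definitions using (tri<; tri≈; tri>)
open import Relation.Binary.PropositionalEquality
open import Relation.Nullary using (¬_; Dec; yes; no; does)
open import Relation.Nullary.Decidable using (_×-dec_; _→-dec_; map′; ¬?; dec-true)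
open import Relation.Unary using (Decidable)
open ≡-Reasoning

-- Order the coordinates and put W in reduced echelon form: W has the basis
-- e_c + A_c for c in its pivot set C, where A_c is supported on the
-- non-pivots to the right of c.  Modulo W, the vector Δ(e_c + A_c) is the
-- vector B_c with entries (d_j - d_c) A_cj, and since the d_j are distinct B
-- determines A.  Hence W + ΔW = W ⊕ U with U the row space of B, which lies in
-- the coordinate space of the non-pivots, and Krylov sums satisfy
-- K_{j+1}(W) = W ⊕ K_j(U): the space W has profile |C| ∷ μ exactly when U has
-- profile μ.  For U with pivot set D, the matrices B with row space U
-- correspond to the C × D matrices of rank |D| supported on the entries c < d,
-- and choosing the columns from left to right there are
-- ∏_i (q^{a_i} - q^{i-1}) of them, a_i being the number of elements of C below
-- the i-th element of D.  This product vanishes unless C and D are adjacent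
-- columns of a tableau, and is otherwise the contribution of the column D to
-- the formula; the last pivot set C contributes the free entries of A.

-- Enumerations of finite sets

-- The recursion closes because Δ is diagonal: it maps the coordinate space of the non-pivots into
-- itself, so every K_j(U) stays there and meets W in zero only. The factors of the rank count turn
-- into those of the formula by q^{a_i} - q^{i-1} = (q-1) q^{i-1} [a_i - (i-1)]_q. Once the first
-- i-1 elements of C lie below the i-th element of D, a_i - (i-1) counts the elements of C from row
-- i on that lie below it, which is the c of that cell; the exponents 0 + 1 + ... + (m-1) add up to
-- the binomial coefficient. At the first row where C and D fail to fit, a_i = i-1 and the product
-- is zero. Two choices shape the formal side. `HasDim` asks for a basis, but over a finite field
-- dimension m means q^m elements, so profiles are compared by counting (`dim⇒card`, `card⇒dim`).
-- And subspaces are Boolean functions, compared only pointwise, so what is enumerated are pairs of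
-- a pivot set and an echelon matrix.

record IsEnum {A : Set} (P : A → Set) (xs : List A) : Set where
  field
    sound    : ∀ {x} → x ∈ xs → P x
    complete : ∀ {x} → P x → x ∈ xs
    unique   : Unique xs

open IsEnum public

Card : {A : Set} → (A → Set) → ℕ → Set
Card P N = ∃[ xs ] (IsEnum P xs × length xs ≡ N)

-- Duplicate-free lists with the same members are equal as bags. Hence counts and sums depend on the
-- predicate alone, and enumerations built in different ways can be compared.
enum-↭ : ∀ {A : Set} {P : A → Set} {xs ys} → IsEnum P xs → IsEnum P ys → xs ↭ ys
enum-↭ e e′ = ∼bag⇒↭ (unique∧set⇒bag (unique e) (unique e′)
  (mk⇔ (λ m → complete e′ (sound e m)) (λ m → complete e (sound e′ m))))

enum-sum : ∀ {A : Set} {P : A → Set} {xs ys} → IsEnum P xs → IsEnum P ys →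
           (f : A → ℕ) → sum (map f xs) ≡ sum (map f ys)
enum-sum e e′ f = sum-↭ (↭-map⁺ f (enum-↭ e e′))

card-unique : ∀ {A : Set} {P : A → Set} {M N} → Card P M → Card P N → M ≡ N
card-unique (xs , e , refl) (ys , e′ , refl) = ↭-length (enum-↭ e e′)

enum-⇔ : ∀ {A : Set} {P Q : A → Set} {xs} → (∀ {x} → P x → Q x) → (∀ {x} → Q x → P x) →
         IsEnum P xs → IsEnum Q xs
enum-⇔ to from e = record
  { sound = to ∘ sound e ; complete = complete e ∘ from ; unique = unique e }

card-⇔ : ∀ {A : Set} {P Q : A → Set} {N} → (∀ {x} → P x → Q x) → (∀ {x} → Q x → P x) →
         Card P N → Card Q N
card-⇔ to from (xs , e , eq) = xs , enum-⇔ to from e , eq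

map-unique : ∀ {A B : Set} {f : A → B} {xs} →
             (∀ {x y} → x ∈ xs → y ∈ xs → f x ≡ f y → x ≡ y) → Unique xs → Unique (map f xs)
map-unique inj [] = []
map-unique {f = f} {xs = x ∷ xs} inj (x∉ ∷ u) =
  All.tabulate (λ y∈ fx≡y → let z , z∈ , y≡ = ∈-map⁻ f y∈ in
    All.lookup x∉ z∈ (inj (here refl) (there z∈) (trans fx≡y y≡)))
  ∷ map-unique (λ a b → inj (there a) (there b)) u

enum-map : ∀ {A B : Set} {P : A → Set} {Q : B → Set} {xs} (f : A → B) →
           (∀ {x} → P x → Q (f x)) → (∀ {y} → Q y → ∃[ x ] (P x × y ≡ f x)) →
           (∀ {x y} → P x → P y → f x ≡ f y → x ≡ y) →
           IsEnum P xs → IsEnum Q (map f xs)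
enum-map {Q = Q} f into onto inj e = record
  { sound    = λ m → let x , x∈ , eq = ∈-map⁻ f m in subst Q (sym eq) (into (sound e x∈))
  ; complete = λ q → let x , p , eq = onto q in subst (_∈ _) (sym eq) (∈-map⁺ f (complete e p))
  ; unique   = map-unique (λ a b → inj (sound e a) (sound e b)) (unique e)
  }

card-map : ∀ {A B : Set} {P : A → Set} {Q : B → Set} {N} (f : A → B) →
           (∀ {x} → P x → Q (f x)) → (∀ {y} → Q y → ∃[ x ] (P x × y ≡ f x)) →
           (∀ {x y} → P x → P y → f x ≡ f y → x ≡ y) →
           Card P N → Card Q N
card-map f into onto inj (xs , e , eq) =
  map f xs , enum-map f into onto inj e , trans (length-map f xs) eq

concatMap-unique : ∀ {I A : Set} (f : I → List A) is → Unique is →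
                   (∀ {i} → i ∈ is → Unique (f i)) →
                   (∀ {i j a} → i ∈ is → j ∈ is → a ∈ f i → a ∈ f j → i ≡ j) →
                   Unique (concatMap f is)
concatMap-unique f [] u ui dis = []
concatMap-unique f (i ∷ is) (i∉ ∷ u) ui dis =
  Unique.++⁺ (ui (here refl)) (concatMap-unique f is u (ui ∘ there) (λ a b → dis (there a) (there b)))
    (λ { (a∈ , a∈′) → let j∈ = ∈-concatMap⁻ f a∈′ in
      disjoint j∈ a∈ })
  where
  disjoint : ∀ {a} → Any (λ j → a ∈ f j) is → ¬ (a ∈ f i)
  disjoint j∈ a∈ = let j , j∈is , a∈j = find j∈ in All.lookup i∉ j∈is (dis (here refl) (there j∈is) a∈ a∈j)

enum-concatMap : ∀ {I A : Set} {P : I → Set} {Q : I → A → Set} {is} (f : I → List A) →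
                 IsEnum P is → (∀ {i} → P i → IsEnum (Q i) (f i)) →
                 (∀ {i j a} → P i → P j → Q i a → Q j a → i ≡ j) →
                 IsEnum (λ a → ∃[ i ] (P i × Q i a)) (concatMap f is)
enum-concatMap {is = is} f e eQ dis = record
  { sound    = λ m → let i , i∈ , a∈ = find (∈-concatMap⁻ f m) in
                     i , sound e i∈ , sound (eQ (sound e i∈)) a∈
  ; complete = λ { (i , p , q) → ∈-concatMap⁺ f (lose (complete e p) (complete (eQ p) q)) }
  ; unique   = concatMap-unique f is (unique e) (λ i∈ → unique (eQ (sound e i∈)))
                 (λ i∈ j∈ a b → dis (sound e i∈) (sound e j∈)
                   (sound (eQ (sound e i∈)) a) (sound (eQ (sound e j∈)) b))
  }

card-Σ : ∀ {I A : Set} {P : I → Set} {Q : I → A → Set} {is} (g : I → ℕ) →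
         IsEnum P is → (∀ i → P i → Card (Q i) (g i)) → Decidable P →
         (∀ {i j a} → P i → P j → Q i a → Q j a → i ≡ j) →
         Card (λ a → ∃[ i ] (P i × Q i a)) (sum (map g is))
card-Σ {I} {A} {P} {Q} {is} g e c P? dis =
  concatMap f is , enum-concatMap f e fEnum dis , length-f is (λ i∈ → sound e i∈)
  where
  -- `concatMap` wants a list at every index, while the counts are given only where `P` holds;
  -- elsewhere the list is empty.
  f′ : ∀ i → Dec (P i) → List A
  f′ i (yes p) = proj₁ (c i p)
  f′ i (no _)  = []
  f : I → List A
  f i = f′ i (P? i)
  fEnum : ∀ {i} → P i → IsEnum (Q i) (f i)
  fEnum {i} p with P? i
  ... | yes p′ = proj₁ (proj₂ (c i p′))
  ... | no ¬p  = ⊥-elim (¬p p)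
  f-len : ∀ {i} → P i → length (f i) ≡ g i
  f-len {i} p with P? i
  ... | yes p′ = proj₂ (proj₂ (c i p′))
  ... | no ¬p  = ⊥-elim (¬p p)
  length-f : ∀ js → (∀ {j} → j ∈ js → P j) → length (concatMap f js) ≡ sum (map g js)
  length-f [] h = refl
  length-f (j ∷ js) h = trans (length-++ (f j)) (cong₂ _+_ (f-len (h (here refl))) (length-f js (h ∘ there)))

sum-const : ∀ {I : Set} (is : List I) k → sum (map (λ _ → k) is) ≡ length is * k
sum-const [] k = refl
sum-const (i ∷ is) k = cong (k +_) (sum-const is k)

card-× : ∀ {I A : Set} {P : I → Set} {Q : I → A → Set} {M N} →
         Card P M → (∀ i → P i → Card (Q i) N) → Decidable P →
         (∀ {i j a} → P i → P j → Q i a → Q j a → i ≡ j) →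
         Card (λ a → ∃[ i ] (P i × Q i a)) (M * N)
card-× {N = N} (is , e , refl) c P? dis =
  subst (Card _) (sum-const is N) (card-Σ (λ _ → N) e c P? dis)

enum-filter : ∀ {A : Set} {P Q : A → Set} {xs} (Q? : Decidable Q) →
              IsEnum P xs → IsEnum (λ x → P x × Q x) (filter Q? xs)
enum-filter Q? e = record
  { sound    = λ m → let x∈ , q = ∈-filter⁻ Q? m in sound e x∈ , q
  ; complete = λ { (p , q) → ∈-filter⁺ Q? (complete e p) q }
  ; unique   = Unique.filter⁺ Q? (unique e)
  }

-- Deciding `Q` splits the enumeration of `P` in two; as `Q` implies `P`, one half enumerates all of
-- `Q`, so the truncated subtraction is exact.
card-∖ : ∀ {A : Set} {P Q : A → Set} {M N} → Decidable Q → (∀ {x} → Q x → P x) →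
         Card P M → Card Q N → Card (λ x → P x × ¬ Q x) (M ∸ N)
card-∖ {Q = Q} {N = N} Q? Q⊆P (xs , e , refl) cQ =
  filter ¬Q? xs , enum-filter ¬Q? e , sym (trans (cong (_∸ N) (split xs)) (trans (cong (λ k → k + length (filter ¬Q? xs) ∸ N) N≡) (m+n∸m≡n N _)))
  where
  ¬Q? : Decidable (λ x → ¬ Q x)
  ¬Q? x with Q? x
  ... | yes q = no (λ ¬q → ¬q q)
  ... | no ¬q = yes ¬q
  split : ∀ ys → length ys ≡ length (filter Q? ys) + length (filter ¬Q? ys)
  split [] = refl
  split (y ∷ ys) with Q? y
  ... | yes _ = cong suc (split ys)
  ... | no _  = trans (cong suc (split ys)) (sym (+-suc _ _))
  N≡ : length (filter Q? xs) ≡ N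
  N≡ = card-unique (_ , enum-⇔ proj₂ (λ q → Q⊆P q , q) (enum-filter Q? e) , refl) cQ

card-dec : ∀ {A : Set} {P : A → Set} {N} → (∀ (x y : A) → Dec (x ≡ y)) → Card P N → Decidable P
card-dec _≟_ (xs , e , _) x with Any.any? (x ≟_) xs
... | yes m = yes (sound e m)
... | no ¬m = no (¬m ∘ complete e)

∏ : ∀ n → (Fin n → ℕ) → ℕ
∏ zero f = 1
∏ (suc n) f = f zero * ∏ n (f ∘ suc)

∏-cong : ∀ n {f g : Fin n → ℕ} → (∀ i → f i ≡ g i) → ∏ n f ≡ ∏ n g
∏-cong zero h = refl
∏-cong (suc n) h = cong₂ _*_ (h zero) (∏-cong n (h ∘ suc))

card-Vec : ∀ {X : Set} n {Y : Fin n → X → Set} {N : Fin n → ℕ} →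
           (∀ i → Decidable (Y i)) → (∀ i → Card (Y i) (N i)) →
           Card {Vec X n} (λ v → ∀ i → Y i (lookup v i)) (∏ n N)
card-Vec zero Y? c = ([] ∷ []) , record
  { sound = λ _ () ; complete = λ { {[]} _ → here refl } ; unique = [] ∷ [] } , refl
card-Vec (suc n) {Y} Y? c = card-⇔
  (λ { (x , p , w , ps , refl) zero → p ; (x , p , w , ps , refl) (suc i) → ps i })
  (λ { {x ∷ w} ps → x , ps zero , w , ps ∘ suc , refl })
  (card-× {Q = λ x v → ∃[ w ] ((∀ i → Y (suc i) (lookup w i)) × v ≡ x ∷ w)} (c zero)
    (λ x _ → card-map (x ∷_) (λ {w} ps → w , ps , refl) (λ { (w , ps , eq) → w , ps , eq })
      (λ { _ _ refl → refl }) (card-Vec n (Y? ∘ suc) (c ∘ suc)))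
    (Y? zero)
    (λ { _ _ (_ , _ , refl) (_ , _ , refl) → refl }))

allFin-enum : ∀ n → IsEnum {Fin n} (λ _ → ⊤) (List.allFin n)
allFin-enum n = record
  { sound = λ _ → tt ; complete = λ {i} _ → ∈-allFin i ; unique = Unique.allFin⁺ n }

card-Fin : ∀ n → Card {Fin n} (λ _ → ⊤) n
card-Fin n = List.allFin n , allFin-enum n , length-tabulate id

card-singleton : ∀ {A : Set} (a : A) → Card (_≡ a) 1
card-singleton a = (a ∷ []) , record
  { sound = λ { (here refl) → refl } ; complete = λ { refl → here refl } ; unique = [] ∷ [] } , refl

-- Subsets of the coordinates

infix 4 _∈ₛ_ _⊆_
infixl 6 _─_

_∈ₛ_ : ∀ {n} → Fin n → Vec Bool n → Set
i ∈ₛ C = lookup C i ≡ true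

_⊆_ : ∀ {n} → Vec Bool n → Vec Bool n → Set
C ⊆ S = ∀ i → i ∈ₛ C → i ∈ₛ S

_─_ : ∀ {n} → Vec Bool n → Vec Bool n → Vec Bool n
S ─ C = zipWith (λ s c → s ∧ not c) S C

full : ∀ n → Vec Bool n
full n = replicate n true

_∈ₛ?_ : ∀ {n} (i : Fin n) (C : Vec Bool n) → Dec (i ∈ₛ C)
i ∈ₛ? C = lookup C i Bool.≟ true

∉⇒false : ∀ {b} → ¬ (b ≡ true) → b ≡ false
∉⇒false {false} _ = refl
∉⇒false {true} h = ⊥-elim (h refl)

false⇒∉ : ∀ {b} → b ≡ false → ¬ (b ≡ true)
false⇒∉ refl ()

∧-true : ∀ {a b} → a ∧ b ≡ true → a ≡ true × b ≡ true
∧-true {true} h = refl , h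

∧-intro : ∀ {a b} → a ≡ true → b ≡ true → a ∧ b ≡ true
∧-intro refl refl = refl

not-true : ∀ {a} → not a ≡ true → ¬ (a ≡ true)
not-true {false} _ ()

not-intro : ∀ {a} → ¬ (a ≡ true) → not a ≡ true
not-intro {false} _ = refl
not-intro {true} h = ⊥-elim (h refl)

bool-ext : ∀ {a b} → (a ≡ true → b ≡ true) → (b ≡ true → a ≡ true) → a ≡ b
bool-ext {false} {false} f g = refl
bool-ext {false} {true} f g = g refl
bool-ext {true} {b} f g = sym (f refl)

∈-─⁺ : ∀ {n} (S C : Vec Bool n) i → i ∈ₛ S → ¬ (i ∈ₛ C) → i ∈ₛ S ─ C
∈-─⁺ S C i i∈S i∉C = trans (lookup-zipWith _ i S C) (∧-intro i∈S (not-intro i∉C))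

∈-─⁻ : ∀ {n} (S C : Vec Bool n) i → i ∈ₛ S ─ C → i ∈ₛ S × ¬ (i ∈ₛ C)
∈-─⁻ S C i h = let a , b = ∧-true (trans (sym (lookup-zipWith _ i S C)) h) in a , not-true b

vec-ext : ∀ {A : Set} {n} {u v : Vec A n} → (∀ i → lookup u i ≡ lookup v i) → u ≡ v
vec-ext {u = []} {[]} h = refl
vec-ext {u = x ∷ u} {y ∷ v} h = cong₂ _∷_ (h zero) (vec-ext (h ∘ suc))

⊆-antisym : ∀ {n} {C D : Vec Bool n} → C ⊆ D → D ⊆ C → C ≡ D
⊆-antisym C⊆D D⊆C = vec-ext (λ i → bool-ext (C⊆D i) (D⊆C i))

size : ∀ {n} → Vec Bool n → ℕ
size [] = 0
size (b ∷ C) = (if b then 1 else 0) + size C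

-- Coordinates are numbered from 0 and tableau entries from 1, whence `suc k`; the offset `k` is the
-- position of the head. The list is increasing, so a subset can be read as a column.
elemsFrom : ∀ {n} → ℕ → Vec Bool n → List ℕ
elemsFrom k []          = []
elemsFrom k (true ∷ C)  = suc k ∷ elemsFrom (suc k) C
elemsFrom k (false ∷ C) = elemsFrom (suc k) C

elems : ∀ {n} → Vec Bool n → List ℕ
elems = elemsFrom 0

length-elemsFrom : ∀ {n} k (C : Vec Bool n) → length (elemsFrom k C) ≡ size C
length-elemsFrom k [] = refl
length-elemsFrom k (true ∷ C) = cong suc (length-elemsFrom (suc k) C)
length-elemsFrom k (false ∷ C) = length-elemsFrom (suc k) C

∈-elemsFrom⁺ : ∀ {n} k (C : Vec Bool n) i → i ∈ₛ C → suc (k + toℕ i) ∈ elemsFrom k C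
∈-elemsFrom⁺ k (true ∷ C) zero h = here (cong suc (+-identityʳ k))
∈-elemsFrom⁺ k (true ∷ C) (suc i) h =
  there (subst (_∈ elemsFrom (suc k) C) (sym (cong suc (+-suc k (toℕ i)))) (∈-elemsFrom⁺ (suc k) C i h))
∈-elemsFrom⁺ k (false ∷ C) (suc i) h =
  subst (_∈ elemsFrom (suc k) C) (sym (cong suc (+-suc k (toℕ i)))) (∈-elemsFrom⁺ (suc k) C i h)

∈-elemsFrom⁻ : ∀ {n} k (C : Vec Bool n) {x} → x ∈ elemsFrom k C → ∃[ i ] (i ∈ₛ C × x ≡ suc (k + toℕ i))
∈-elemsFrom⁻ k (true ∷ C) (here refl) = zero , refl , cong suc (sym (+-identityʳ k))
∈-elemsFrom⁻ k (true ∷ C) (there m) = let i , i∈ , eq = ∈-elemsFrom⁻ (suc k) C m in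
  suc i , i∈ , trans eq (sym (cong suc (+-suc k (toℕ i))))
∈-elemsFrom⁻ k (false ∷ C) m = let i , i∈ , eq = ∈-elemsFrom⁻ (suc k) C m in
  suc i , i∈ , trans eq (sym (cong suc (+-suc k (toℕ i))))

∈-elems⁺ : ∀ {n} (C : Vec Bool n) i → i ∈ₛ C → suc (toℕ i) ∈ elems C
∈-elems⁺ = ∈-elemsFrom⁺ 0

∈-elems⁻ : ∀ {n} (C : Vec Bool n) {x} → x ∈ elems C → ∃[ i ] (i ∈ₛ C × x ≡ suc (toℕ i))
∈-elems⁻ = ∈-elemsFrom⁻ 0

∈-elems⁻′ : ∀ {n} (C : Vec Bool n) i → suc (toℕ i) ∈ elems C → i ∈ₛ C
∈-elems⁻′ C i m = let j , j∈ , eq = ∈-elems⁻ C m in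
  subst (_∈ₛ C) (sym (Fin.toℕ-injective (suc-injective eq))) j∈

Sorted : List ℕ → Set
Sorted = AllPairs _<_

elemsFrom-> : ∀ {n} k (C : Vec Bool n) → All (k <_) (elemsFrom k C)
elemsFrom-> k C = All.tabulate (λ m → let i , _ , eq = ∈-elemsFrom⁻ k C m in subst (k <_) (sym eq) (s≤s (m≤m+n k _)))

elemsFrom-sorted : ∀ {n} k (C : Vec Bool n) → Sorted (elemsFrom k C)
elemsFrom-sorted k [] = []
elemsFrom-sorted k (true ∷ C) = elemsFrom-> (suc k) C ∷ elemsFrom-sorted (suc k) C
elemsFrom-sorted k (false ∷ C) = elemsFrom-sorted (suc k) C

elems-sorted : ∀ {n} (C : Vec Bool n) → Sorted (elems C)
elems-sorted = elemsFrom-sorted 0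

-- Each head is the least element of its list, so the heads agree; strictness keeps them out of the
-- tails, and the induction goes on.
sorted-ext : ∀ {xs ys} → Sorted xs → Sorted ys →
             (∀ {z} → z ∈ xs → z ∈ ys) → (∀ {z} → z ∈ ys → z ∈ xs) → xs ≡ ys
sorted-ext {[]} {[]} sx sy f g = refl
sorted-ext {[]} {y ∷ ys} sx sy f g with () ← g (here refl)
sorted-ext {x ∷ xs} {[]} sx sy f g with () ← f (here refl)
sorted-ext {x ∷ xs} {y ∷ ys} (x< ∷ sx) (y< ∷ sy) f g =
  cong₂ _∷_ x≡y (sorted-ext sx sy
    (λ z∈ → case f (there z∈) of λ
      { (here z≡y) → ⊥-elim (<-irrefl (trans x≡y (sym z≡y)) (All.lookup x< z∈)) ; (there m) → m })
    (λ z∈ → case g (there z∈) of λ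
      { (here z≡x) → ⊥-elim (<-irrefl (trans (sym x≡y) (sym z≡x)) (All.lookup y< z∈)) ; (there m) → m }))
  where
  x≡y : x ≡ y
  x≡y with f (here refl) | g (here refl)
  ... | here eq | _ = eq
  ... | there _ | here eq = sym eq
  ... | there x∈ | there y∈ = ⊥-elim (<-asym (All.lookup x< y∈) (All.lookup y< x∈))

elems-injective : ∀ {n} {C D : Vec Bool n} → elems C ≡ elems D → C ≡ D
elems-injective {C = C} {D} eq = ⊆-antisym
  (λ i i∈ → ∈-elems⁻′ D i (subst (_ ∈_) eq (∈-elems⁺ C i i∈)))
  (λ i i∈ → ∈-elems⁻′ C i (subst (_ ∈_) (sym eq) (∈-elems⁺ D i i∈)))

range1-sorted : ∀ n → Sorted (range1 n)
range1-sorted n = go (λ h → s≤s h) n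
  where
  go : ∀ {f : ℕ → ℕ} → (∀ {i j} → i < j → f i < f j) → ∀ n → Sorted (applyUpTo f n)
  go h zero = []
  go {f} h (suc n) = All.tabulate (λ m → let i , _ , eq = ∈-applyUpTo⁻ (f ∘ suc) m in
    subst (f 0 <_) (sym eq) (h (s≤s z≤n))) ∷ go (λ lt → h (s≤s lt)) n

elems-full : ∀ n → elems (full n) ≡ range1 n
elems-full n = sorted-ext (elems-sorted (full n)) (range1-sorted n)
  (λ z∈ → let i , _ , eq = ∈-elems⁻ (full n) z∈ in
    subst (_∈ range1 n) (sym eq) (∈-applyUpTo⁺ suc (Fin.toℕ<n i)))
  (λ z∈ → let i , i<n , eq = ∈-applyUpTo⁻ suc z∈ in
    subst (_∈ elems (full n)) (sym (trans eq (cong suc (sym (Fin.toℕ-fromℕ< i<n)))))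
      (∈-elems⁺ (full n) (Fin.fromℕ< i<n) (lookup-replicate (Fin.fromℕ< i<n) true)))

-- Boolean tests and the propositions they decide

≡ᵇ-refl : ∀ m → (m ≡ᵇ m) ≡ true
≡ᵇ-refl zero = refl
≡ᵇ-refl (suc m) = ≡ᵇ-refl m

≡ᵇ-sound : ∀ m n → (m ≡ᵇ n) ≡ true → m ≡ n
≡ᵇ-sound m n h = ≡ᵇ⇒≡ m n (subst Bool.T (sym h) tt)

<ᵇ-sound : ∀ m n → (m <ᵇ n) ≡ true → m < n
<ᵇ-sound m n h = <ᵇ⇒< m n (subst Bool.T (sym h) tt)

<ᵇ-complete : ∀ {m n} → m < n → (m <ᵇ n) ≡ true
<ᵇ-complete {m} {n} h with m <ᵇ n in eq
... | true = refl
... | false = ⊥-elim (subst Bool.T eq (<⇒<ᵇ h))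

elemB-sound : ∀ x ys → elemB x ys ≡ true → x ∈ ys
elemB-sound x (y ∷ ys) h with x ≡ᵇ y in eq
... | true = here (≡ᵇ-sound x y eq)
... | false = there (elemB-sound x ys h)

elemB-complete : ∀ {x ys} → x ∈ ys → elemB x ys ≡ true
elemB-complete {x} (here refl) rewrite ≡ᵇ-refl x = refl
elemB-complete {x} {y ∷ ys} (there m) rewrite elemB-complete m = Bool.∨-zeroʳ (x ≡ᵇ y)

∈-filterB⁺ : ∀ {A : Set} (p : A → Bool) {x xs} → x ∈ xs → p x ≡ true → x ∈ filterB p xs
∈-filterB⁺ p {x} (here refl) h rewrite h = here refl
∈-filterB⁺ p {x} {y ∷ xs} (there m) h with p y
... | true = there (∈-filterB⁺ p m h)
... | false = ∈-filterB⁺ p m h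

∈-filterB⁻ : ∀ {A : Set} (p : A → Bool) {x} xs → x ∈ filterB p xs → x ∈ xs × p x ≡ true
∈-filterB⁻ p (y ∷ xs) m with p y in eq
∈-filterB⁻ p (y ∷ xs) (here refl) | true = here refl , eq
∈-filterB⁻ p (y ∷ xs) (there m) | true = let a , b = ∈-filterB⁻ p xs m in there a , b
... | false = let a , b = ∈-filterB⁻ p xs m in there a , b

filterB-AllPairs : ∀ {A : Set} {R : A → A → Set} (p : A → Bool) {xs} → AllPairs R xs → AllPairs R (filterB p xs)
filterB-AllPairs p [] = []
filterB-AllPairs p {x ∷ xs} (x~ ∷ u) with p x
... | true = All.tabulate (λ m → All.lookup x~ (proj₁ (∈-filterB⁻ p xs m))) ∷ filterB-AllPairs p u
... | false = filterB-AllPairs p u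

filterB-cong : ∀ {A : Set} {p p′ : A → Bool} → (∀ x → p x ≡ p′ x) → ∀ xs → filterB p xs ≡ filterB p′ xs
filterB-cong h [] = refl
filterB-cong {p = p} h (x ∷ xs) rewrite sym (h x) with p x
... | true = cong (x ∷_) (filterB-cong h xs)
... | false = filterB-cong h xs

filterB-∧ : ∀ {A : Set} (p p′ : A → Bool) xs → filterB p′ (filterB p xs) ≡ filterB (λ x → p x ∧ p′ x) xs
filterB-∧ p p′ [] = refl
filterB-∧ p p′ (x ∷ xs) with p x
... | false = filterB-∧ p p′ xs
... | true with p′ x
...   | true = cong (x ∷_) (filterB-∧ p p′ xs)
...   | false = filterB-∧ p p′ xs

elems-─ : ∀ {n} (S C : Vec Bool n) → elems (S ─ C) ≡ filterB (λ c → not (elemB c (elems C))) (elems S)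
elems-─ S C = sorted-ext (elems-sorted (S ─ C)) (filterB-AllPairs _ (elems-sorted S))
  (λ z∈ → let i , i∈ , eq = ∈-elems⁻ (S ─ C) z∈
              i∈S , i∉C = ∈-─⁻ S C i i∈ in
    subst (_∈ _) (sym eq) (∈-filterB⁺ _ (∈-elems⁺ S i i∈S)
      (not-intro (λ h → i∉C (∈-elems⁻′ C i (elemB-sound _ _ h))))))
  (λ z∈ → let z∈S , h = ∈-filterB⁻ _ (elems S) z∈
              i , i∈ , eq = ∈-elems⁻ S z∈S in
    subst (_∈ _) (sym eq) (∈-elems⁺ (S ─ C) i (∈-─⁺ S C i i∈
      (λ i∈C → not-true h (elemB-complete (subst (_∈ elems C) (sym eq) (∈-elems⁺ C i i∈C)))))))

sorted⇒elems : ∀ {n} (S : Vec Bool n) {xs} → Sorted xs → All (_∈ elems S) xs →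
               ∃[ C ] (C ⊆ S × elems C ≡ xs)
sorted⇒elems S {xs} sx xs∈ = C , C⊆S , sorted-ext (elems-sorted C) sx to from
  where
  C = tabulate (λ i → elemB (suc (toℕ i)) xs)
  ∈C : ∀ {i} → i ∈ₛ C → suc (toℕ i) ∈ xs
  ∈C {i} h = elemB-sound _ _ (trans (sym (lookup∘tabulate _ i)) h)
  C⊆S : C ⊆ S
  C⊆S i h = ∈-elems⁻′ S i (All.lookup xs∈ (∈C h))
  to : ∀ {z} → z ∈ elems C → z ∈ xs
  to z∈ = let i , i∈ , eq = ∈-elems⁻ C z∈ in subst (_∈ xs) (sym eq) (∈C i∈)
  from : ∀ {z} → z ∈ xs → z ∈ elems C
  from z∈ = let i , _ , eq = ∈-elems⁻ S (All.lookup xs∈ z∈) in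
    subst (_∈ elems C) (sym eq) (∈-elems⁺ C i (trans (lookup∘tabulate _ i) (elemB-complete (subst (_∈ xs) eq z∈))))


-- Enumerating the subsets of a given size

allSubsets : ∀ n → List (Vec Bool n)
allSubsets zero = [] ∷ []
allSubsets (suc n) = concatMap (λ b → map (b ∷_) (allSubsets n)) (true ∷ false ∷ [])

allSubsets-enum : ∀ n → IsEnum {Vec Bool n} (λ _ → ⊤) (allSubsets n)
allSubsets-enum zero = record { sound = λ _ → tt ; complete = λ { {[]} _ → here refl } ; unique = [] ∷ [] }
allSubsets-enum (suc n) = enum-⇔ (λ _ → tt) (λ { {b ∷ C} _ → b , tt , C , tt , refl })
  (enum-concatMap {P = λ _ → ⊤} {Q = λ b v → ∃[ C ] (⊤ × v ≡ b ∷ C)} _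
    (record { sound = λ _ → tt ; complete = λ { {true} _ → here refl ; {false} _ → there (here refl) }
            ; unique = ((λ ()) ∷ []) ∷ ([] ∷ []) })
    (λ {b} _ → enum-map (b ∷_) (λ {C} _ → C , tt , refl) (λ { (C , _ , eq) → C , tt , eq }) (λ { _ _ refl → refl }) (allSubsets-enum n))
    (λ { _ _ (_ , _ , refl) (_ , _ , refl) → refl }))

_⊆?_ : ∀ {n} (C S : Vec Bool n) → Dec (C ⊆ S)
C ⊆? S = Fin.all? (λ i → (i ∈ₛ? C) →-dec (i ∈ₛ? S))

IsSub : ∀ {n} → Vec Bool n → ℕ → Vec Bool n → Set
IsSub S m C = C ⊆ S × size C ≡ m

isSub? : ∀ {n} (S : Vec Bool n) m → Decidable (IsSub S m)
isSub? S m C = (C ⊆? S) ×-dec (size C ℕ.≟ m)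

subs : ∀ {n} → Vec Bool n → ℕ → List (Vec Bool n)
subs {n} S m = filter (isSub? S m) (allSubsets n)

subs-enum : ∀ {n} (S : Vec Bool n) m → IsEnum (IsSub S m) (subs S m)
subs-enum {n} S m = enum-⇔ proj₂ (tt ,_) (enum-filter (isSub? S m) (allSubsets-enum n))

-- Prepending a column to a tableau

-- A global copy of the local function of `lastColumn`, with the column index as an argument.
columnAt : ℕ → Tableau → List ℕ
columnAt k [] = []
columnAt k (s ∷ ss) with lookupM s k
... | nothing = columnAt k ss
... | just a  = a ∷ columnAt k ss

-- The local function of lastColumn cannot be named here, so it is left to
-- unification: abstracting the tail s ∷ ss separates the parameter of the
-- local function from its argument.
mutual
  collect≡ : (r : List ℕ) (rs ss : Tableau) → _ ≡ columnAt (length r ∸ 1) ss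

  lastColumn-∷∷ : ∀ r s ss → lastColumn (r ∷ s ∷ ss) ≡ columnAt (length r ∸ 1) (r ∷ s ∷ ss)
  lastColumn-∷∷ r s ss with lookupM r (length r ∸ 1)
  lastColumn-∷∷ r s ss | nothing with lookupM s (length r ∸ 1)
  lastColumn-∷∷ r s ss | nothing | just b with s ∷ ss
  ... | rs = cong (b ∷_) (collect≡ r rs ss)
  lastColumn-∷∷ r s ss | nothing | nothing with s ∷ ss
  ... | rs = collect≡ r rs ss
  lastColumn-∷∷ r s ss | just a with lookupM s (length r ∸ 1)
  lastColumn-∷∷ r s ss | just a | nothing with s ∷ ss
  ... | rs = cong (a ∷_) (collect≡ r rs ss)
  lastColumn-∷∷ r s ss | just a | just b with s ∷ ss
  ... | rs = cong (λ z → a ∷ b ∷ z) (collect≡ r rs ss)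

  collect≡ r rs [] = refl
  collect≡ r rs (s ∷ ss) with lookupM s (length r ∸ 1)
  ... | nothing = collect≡ r rs ss
  ... | just a = cong (a ∷_) (collect≡ r rs ss)

lastColumn-∷ : ∀ r rs → lastColumn (r ∷ rs) ≡ columnAt (length r ∸ 1) (r ∷ rs)
lastColumn-∷ r (s ∷ ss) = lastColumn-∷∷ r s ss
lastColumn-∷ r [] with lookupM r (length r ∸ 1)
... | nothing = refl
... | just a = refl

-- The weight c_q as a product over rows

lessM : ℕ → Maybe ℕ → Bool
lessM x nothing  = false
lessM x (just a) = a <ᵇ x

-- `T` is the tableau from the current row downwards. Since `cEntry` looks only at rows `i′ ≥ i`,
-- cutting off the rows above lets the count run over all of `T` and removes the row index.
cellList : ℕ → Tableau → ℕ → List ℕ → List ℕ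
cellList q T j []      = []
cellList q T j (x ∷ r) = qInt q (count (λ s → lessM x (lookupM s j)) T) ∷ cellList q T (suc j) r

rowWeight : ℕ → Tableau → ℕ
rowWeight q []            = 1
rowWeight q ([] ∷ T)      = 1
rowWeight q ((a ∷ r) ∷ T) = product (cellList q ((a ∷ r) ∷ T) 0 r)

applyUpTo-cong : ∀ {A : Set} {f g : ℕ → A} → (∀ i → f i ≡ g i) → ∀ n → applyUpTo f n ≡ applyUpTo g n
applyUpTo-cong h zero = refl
applyUpTo-cong h (suc n) = cong₂ _∷_ (h 0) (applyUpTo-cong (λ i → h (suc i)) n)

drop-just : ∀ {A : Set} i (T : List A) {r} → lookupM T i ≡ just r → drop i T ≡ r ∷ drop (suc i) T
drop-just zero (r ∷ T) refl = refl
drop-just (suc i) (_ ∷ T) e = drop-just i T e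

drop-nothing : ∀ {A : Set} i (T : List A) → lookupM T i ≡ nothing → drop i T ≡ []
drop-nothing zero [] e = refl
drop-nothing (suc i) [] e = refl
drop-nothing (suc i) (x ∷ T) e = drop-nothing i T e

count-cong : ∀ {A : Set} {p p′ : A → Bool} → (∀ x → p x ≡ p′ x) → ∀ xs → count p xs ≡ count p′ xs
count-cong h [] = refl
count-cong h (x ∷ xs) = cong₂ (λ b k → (if b then 1 else 0) + k) (h x) (count-cong h xs)

count-applyUpTo : ∀ {A B : Set} {p : A → Bool} {p′ : B → Bool} {f g} → (∀ i → p (f i) ≡ p′ (g i)) →
                  ∀ n → count p (applyUpTo f n) ≡ count p′ (applyUpTo g n)
count-applyUpTo h zero = refl
count-applyUpTo h (suc n) = cong₂ (λ b k → (if b then 1 else 0) + k) (h 0) (count-applyUpTo (λ i → h (suc i)) n)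

count-entry : ∀ (P : Maybe ℕ → Bool) → P nothing ≡ false → ∀ i T j →
              count (λ i′ → P (entry T i′ j)) (applyUpTo (i +_) (length T ∸ i)) ≡ count (λ s → P (lookupM s j)) (drop i T)
count-entry P P0 zero [] j = refl
count-entry P P0 zero (r ∷ T) j = cong ((if P (lookupM r j) then 1 else 0) +_)
  (trans (count-applyUpTo {p = λ i′ → P (entry (r ∷ T) i′ j)} {p′ = λ i′ → P (entry T i′ j)} {f = suc} {g = λ i → i} (λ i → refl) (length T)) (count-entry P P0 zero T j))
count-entry P P0 (suc i) [] j = refl
count-entry P P0 (suc i) (r ∷ T) j =
  trans (count-applyUpTo {p = λ i′ → P (entry (r ∷ T) i′ j)} {p′ = λ i′ → P (entry T i′ j)} {f = λ k → suc (i + k)} {g = i +_} (λ _ → refl) (length T ∸ i)) (count-entry P P0 i T j)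

mutual
  -- The left-hand side is a function local to `cEntry`; the hole is filled by the use in `cEntry≡`.
  below≡ : ∀ (T : Tableau) (i j x i′ : ℕ) → _ ≡ lessM x (entry T i′ j)

  cEntry≡ : ∀ T i j x → cEntry T i j x ≡ count (λ s → lessM x (lookupM s j)) (drop i T)
  cEntry≡ T i j x = trans (count-cong (below≡ T i j x) (applyUpTo (i +_) (length T ∸ i))) (count-entry (lessM x) refl i T j)

  below≡ T i j x i′ with entry T i′ j
  ... | nothing = refl
  ... | just a = refl

mutual
  cellFactors≡ : ∀ (q : ℕ) (T : Tableau) (i j : ℕ) r → _ ≡ product (cellList q (drop i T) j r)
  rowFactor≡ : ∀ (q : ℕ) (T : Tableau) (i : ℕ) → _ ≡ rowWeight q (drop i T)

  cq-rows : ∀ q T → cq q T ≡ product (applyUpTo (λ i → rowWeight q (drop i T)) (length T))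
  cq-rows q T = cong product (applyUpTo-cong (rowFactor≡ q T) (length T))

  -- Abstracting the column index 0 puts the local function cellFactors in
  -- general position, where unification can find it.
  rowFactor≡ q T i with lookupM T i in eq
  ... | nothing rewrite drop-nothing i T eq = refl
  ... | just [] rewrite drop-just i T eq = refl
  ... | just (a ∷ r) with 0 in z≡
  ...   | z = trans (cellFactors≡ q T i z r)
      (trans (cong (λ j → product (cellList q (drop i T) j r)) (sym z≡))
      (trans (cong (λ U → product (cellList q U 0 r)) (drop-just i T eq)) (cong (rowWeight q) (sym (drop-just i T eq)))))

  cellFactors≡ q T i j [] = refl
  cellFactors≡ q T i j (x ∷ r) = cong₂ _*_ (cong (qInt q) (cEntry≡ T i j x)) (cellFactors≡ q T i (suc j) r)

rowsWeight : ℕ → Tableau → ℕ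
rowsWeight q []      = 1
rowsWeight q (r ∷ T) = rowWeight q (r ∷ T) * rowsWeight q T

cq≡rowsWeight : ∀ q T → cq q T ≡ rowsWeight q T
cq≡rowsWeight q T = trans (cq-rows q T) (go T)
  where
  go : ∀ T → product (applyUpTo (λ i → rowWeight q (drop i T)) (length T)) ≡ rowsWeight q T
  go [] = refl
  go (r ∷ T) = cong (rowWeight q (r ∷ T) *_) (go T)

firstRow : Tableau → List ℕ
firstRow []      = []
firstRow (r ∷ _) = r

-- The number of rows is that of `C`: rows missing from `T` count as empty and surplus rows are
-- lost, hence the recurring hypothesis `length T ≤ length C`.
attach : List ℕ → Tableau → Tableau
attach []      T = []
attach (c ∷ C) T = (c ∷ firstRow T) ∷ attach C (drop 1 T)

length-attach : ∀ C T → length (attach C T) ≡ length C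
length-attach [] T = refl
length-attach (c ∷ C) T = cong suc (length-attach C (drop 1 T))

count-attach-suc : ∀ (P : Maybe ℕ → Bool) → P nothing ≡ false → ∀ j C T → length T ≤ length C →
                   count (λ s → P (lookupM s (suc j))) (attach C T) ≡ count (λ s → P (lookupM s j)) T
count-attach-suc P P0 j [] [] h = refl
count-attach-suc P P0 j (c ∷ C) [] h = trans (cong (λ b → (if b then 1 else 0) + count (λ s → P (lookupM s (suc j))) (attach C [])) P0)
  (count-attach-suc P P0 j C [] z≤n)
count-attach-suc P P0 j (c ∷ C) (r ∷ T) (s≤s h) =
  cong ((if P (lookupM r j) then 1 else 0) +_) (count-attach-suc P P0 j C T h)

count-attach-zero : ∀ (P : Maybe ℕ → Bool) C T → count (λ s → P (lookupM s 0)) (attach C T) ≡ count (P ∘ just) C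
count-attach-zero P [] T = refl
count-attach-zero P (c ∷ C) T = cong ((if P (just c) then 1 else 0) +_) (count-attach-zero P C (drop 1 T))

cellList-attach : ∀ q C T j r → length T ≤ length C →
                  cellList q (attach C T) (suc j) r ≡ cellList q T j r
cellList-attach q C T j [] h = refl
cellList-attach q C T j (x ∷ r) h =
  cong₂ _∷_ (cong (qInt q) (count-attach-suc (lessM x) refl j C T h)) (cellList-attach q C T (suc j) r h)

-- The share of `cq` due to the cells of a column `X` with left neighbour `C`. Shortening both lists
-- together implements the condition `i′ ≥ i`.
columnFactor : ℕ → List ℕ → List ℕ → ℕ
columnFactor q (c ∷ C) (x ∷ X) = qInt q (count (_<ᵇ x) (c ∷ C)) * columnFactor q C X
columnFactor q _       _       = 1

rowsWeight-attach-[] : ∀ q C → rowsWeight q (attach C []) ≡ 1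
rowsWeight-attach-[] q [] = refl
rowsWeight-attach-[] q (c ∷ C) = trans (+-identityʳ _) (rowsWeight-attach-[] q C)

-- A prepended column adds one factor in each row, for the cell that used to be first; every other
-- cell keeps its left neighbour column.
rowsWeight-attach : ∀ q C X T → length X ≤ length C →
                    rowsWeight q (attach C (attach X T)) ≡ columnFactor q C X * rowsWeight q (attach X T)
rowsWeight-attach q [] [] T h = refl
rowsWeight-attach q (c ∷ C) [] T h = trans (+-identityʳ _) (rowsWeight-attach-[] q C)
rowsWeight-attach q (c ∷ C) (x ∷ X) T (s≤s h) = begin
  product (cellList q T₂ 0 (x ∷ firstRow T)) * rowsWeight q (attach C T₁′)
    ≡⟨ cong₂ (λ a b → qInt q a * b * rowsWeight q (attach C T₁′))
        (count-attach-zero (lessM x) (c ∷ C) T₁)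
        (cong product (cellList-attach q (c ∷ C) T₁ 0 (firstRow T)
          (s≤s (≤-trans (≤-reflexive (length-attach X (drop 1 T))) h)))) ⟩
  k * rowWeight q T₁ * rowsWeight q (attach C T₁′)
    ≡⟨ cong (k * rowWeight q T₁ *_) (rowsWeight-attach q C X (drop 1 T) h) ⟩
  k * rowWeight q T₁ * (columnFactor q C X * rowsWeight q T₁′)
    ≡⟨ solve 4 (λ a b c d → a :* b :* (c :* d) := a :* c :* (b :* d)) refl k (rowWeight q T₁) (columnFactor q C X) (rowsWeight q T₁′) ⟩
  k * columnFactor q C X * (rowWeight q T₁ * rowsWeight q T₁′) ∎
  where
  open +-*-Solver
  T₁′ = attach X (drop 1 T)
  T₁ = attach (x ∷ X) T
  T₂ = attach (c ∷ C) T₁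
  k = qInt q (count (_<ᵇ x) (c ∷ C))

columnAt-attach-suc : ∀ k C T → length T ≤ length C → columnAt (suc k) (attach C T) ≡ columnAt k T
columnAt-attach-suc k [] [] h = refl
columnAt-attach-suc k (c ∷ C) [] h = columnAt-attach-suc k C [] z≤n
columnAt-attach-suc k (c ∷ C) (r ∷ T) (s≤s h) with lookupM r k
... | nothing = columnAt-attach-suc k C T h
... | just a  = cong (a ∷_) (columnAt-attach-suc k C T h)

columnAt-attach-zero : ∀ C T → columnAt 0 (attach C T) ≡ C
columnAt-attach-zero [] T = refl
columnAt-attach-zero (c ∷ C) T = cong (c ∷_) (columnAt-attach-zero C (drop 1 T))

lastColumn-attach-[] : ∀ C → lastColumn (attach C []) ≡ C
lastColumn-attach-[] [] = refl
lastColumn-attach-[] (c ∷ C) = trans (lastColumn-∷ (c ∷ []) (attach C [])) (columnAt-attach-zero (c ∷ C) [])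

-- The last column is located by the length of the first row, which grows by one along with the
-- index of every old column. For empty `X` the new column would itself be the last.
lastColumn-attach : ∀ C X T → 1 ≤ length X → length X ≤ length C →
                    lastColumn (attach C (attach X T)) ≡ lastColumn (attach X T)
lastColumn-attach (c ∷ C) (x ∷ X) T _ h =
  trans (lastColumn-∷ (c ∷ x ∷ firstRow T) (attach C (attach X (drop 1 T))))
  (trans (columnAt-attach-suc (length (firstRow T)) (c ∷ C) (attach (x ∷ X) T)
           (≤-trans (≤-reflexive (length-attach (x ∷ X) T)) h))
         (sym (lastColumn-∷ (x ∷ firstRow T) (attach X (drop 1 T)))))

supp-attach : ∀ C T → length T ≤ length C → supp (attach C T) ↭ C ++ supp T
supp-attach [] [] h = ↭-refl
supp-attach (c ∷ C) [] h = prep c (supp-attach C [] z≤n)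
supp-attach (c ∷ C) (r ∷ T) (s≤s h) = prep c
  (↭-trans (++⁺ˡ r (supp-attach C T h)) (shifts r C))

elemB-++ : ∀ x xs ys → elemB x (xs ++ ys) ≡ elemB x xs ∨ elemB x ys
elemB-++ x [] ys = refl
elemB-++ x (y ∷ xs) ys = trans (cong ((x ≡ᵇ y) ∨_) (elemB-++ x xs ys)) (sym (Bool.∨-assoc (x ≡ᵇ y) _ _))

elemB-↭ : ∀ x {xs ys} → xs ↭ ys → elemB x xs ≡ elemB x ys
elemB-↭ x p = bool-ext (λ h → elemB-complete (∈-resp-↭ p (elemB-sound x _ h)))
                       (λ h → elemB-complete (∈-resp-↭ (↭-sym p) (elemB-sound x _ h)))

-- `γ n` is the case `range1 n`. A general ground list is needed because cutting off the first
-- column removes its entries from the ground set as well.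
γ′ : List ℕ → Tableau → ℕ
γ′ S T = β (lastColumn T) (filterB (λ c → not (elemB c (supp T))) S)

free-attach : ∀ {n} (S C : Vec Bool n) T → length T ≤ length (elems C) →
              filterB (λ c → not (elemB c (supp (attach (elems C) T)))) (elems S)
              ≡ filterB (λ c → not (elemB c (supp T))) (elems (S ─ C))
free-attach S C T h = begin
  filterB (λ c → not (elemB c (supp (attach (elems C) T)))) (elems S)
    ≡⟨ filterB-cong (λ c → trans (cong not (trans (elemB-↭ c (supp-attach (elems C) T h)) (elemB-++ c (elems C) (supp T))))
                           (not-∨ (elemB c (elems C)) (elemB c (supp T)))) (elems S) ⟩
  filterB (λ c → not (elemB c (elems C)) ∧ not (elemB c (supp T))) (elems S)
    ≡⟨ filterB-∧ _ _ (elems S) ⟨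
  filterB (λ c → not (elemB c (supp T))) (filterB (λ c → not (elemB c (elems C))) (elems S))
    ≡⟨ cong (filterB _) (elems-─ S C) ⟨
  filterB (λ c → not (elemB c (supp T))) (elems (S ─ C)) ∎
  where
  not-∨ : ∀ a b → not (a ∨ b) ≡ not a ∧ not b
  not-∨ true b = refl
  not-∨ false b = refl

filterB-all : ∀ {A : Set} (xs : List A) → filterB (λ _ → true) xs ≡ xs
filterB-all [] = refl
filterB-all (x ∷ xs) = cong (x ∷_) (filterB-all xs)

γ′-attach-[] : ∀ {n} (S C : Vec Bool n) → γ′ (elems S) (attach (elems C) []) ≡ β (elems C) (elems (S ─ C))
γ′-attach-[] S C = cong₂ β (lastColumn-attach-[] (elems C)) (trans (free-attach S C [] z≤n) (filterB-all (elems (S ─ C))))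

γ′-attach : ∀ {n} (S C : Vec Bool n) X T → 1 ≤ length X → length X ≤ length (elems C) →
            γ′ (elems S) (attach (elems C) (attach X T)) ≡ γ′ (elems (S ─ C)) (attach X T)
γ′-attach S C X T 1≤ h = cong₂ β (lastColumn-attach (elems C) X T 1≤ h)
  (free-attach S C (attach X T) (≤-trans (≤-reflexive (length-attach X T)) h))

-- The sum over tableaux, column by column

-- The sum `i + (i + 1) + ... + (i + m - 1)`, the exponent collected from the powers `q ^ i` in
-- `stairs`.
shift : ℕ → ℕ → ℕ
shift i zero    = 0
shift i (suc m) = i + shift (suc i) m

shift-suc : ∀ i m → shift (suc i) m ≡ m + shift i m
shift-suc i zero = refl
shift-suc i (suc m) = trans (cong (suc i +_) (shift-suc (suc i) m))
  (solve 3 (λ i m s → con 1 :+ i :+ (m :+ s) := con 1 :+ m :+ (i :+ s)) refl i m (shift (suc i) m))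
  where open +-*-Solver

shift-choose : ∀ m → shift 0 m ≡ m choose 2
shift-choose zero = refl
shift-choose (suc m) = begin
  shift 1 m               ≡⟨ shift-suc 0 m ⟩
  m + shift 0 m           ≡⟨ cong₂ _+_ (sym (nC1≡n m)) (shift-choose m) ⟩
  m choose 1 + m choose 2 ≡⟨ nCk+nC[k+1]≡[n+1]C[k+1] m 1 ⟩
  suc m choose 2          ∎

sum-map-* : ∀ {A : Set} k (f : A → ℕ) xs → sum (map (λ x → k * f x) xs) ≡ k * sum (map f xs)
sum-map-* k f [] = sym (*-zeroʳ k)
sum-map-* k f (x ∷ xs) = trans (cong (k * f x +_) (sum-map-* k f xs)) (sym (*-distribˡ-+ k (f x) _))

sum-map-cong : ∀ {A : Set} {f g : A → ℕ} xs → (∀ {x} → x ∈ xs → f x ≡ g x) → sum (map f xs) ≡ sum (map g xs)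
sum-map-cong [] h = refl
sum-map-cong (x ∷ xs) h = cong₂ _+_ (h (here refl)) (sum-map-cong xs (h ∘ there))

sum-concatMap : ∀ {A B : Set} (f : B → ℕ) (g : A → List B) xs →
                sum (map f (concatMap g xs)) ≡ sum (map (λ x → sum (map f (g x))) xs)
sum-concatMap f g [] = refl
sum-concatMap f g (x ∷ xs) = begin
  sum (map f (g x ++ concatMap g xs))               ≡⟨ cong sum (map-++ f (g x) _) ⟩
  sum (map f (g x) ++ map f (concatMap g xs))       ≡⟨ sum-++ (map f (g x)) _ ⟩
  sum (map f (g x)) + sum (map f (concatMap g xs))  ≡⟨ cong (_ +_) (sum-concatMap f g xs) ⟩
  sum (map f (g x)) + sum (map (λ y → sum (map f (g y))) xs) ∎

qInt-suc : ∀ q a → qInt q (suc a) ≡ 1 + q * qInt q a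
qInt-suc q a = cong suc (go (λ i → i) a)
  where
  -- `applyUpTo` composes its function with `suc` at each step, so the exponent must be a general
  -- function.
  go : ∀ f a → sum (applyUpTo (λ i → q ^ suc (f i)) a) ≡ q * sum (applyUpTo (λ i → q ^ f i) a)
  go f zero = sym (*-zeroʳ q)
  go f (suc a) = trans (cong (q ^ suc (f 0) +_) (go (f ∘ suc) a)) (sym (*-distribˡ-+ q (q ^ f 0) _))

geometric : ∀ p a → suc p ^ a ≡ suc (p * qInt (suc p) a)
geometric p zero = cong suc (sym (*-zeroʳ p))
geometric p (suc a) = begin
  suc p * suc p ^ a                     ≡⟨ cong (suc p *_) (geometric p a) ⟩
  suc p * suc (p * Q)                   ≡⟨ solve 2 (λ p Q → (con 1 :+ p) :* (con 1 :+ p :* Q) := con 1 :+ p :* (con 1 :+ (con 1 :+ p) :* Q)) refl p Q ⟩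
  suc (p * (1 + suc p * Q))             ≡⟨ cong (λ z → suc (p * z)) (qInt-suc (suc p) a) ⟨
  suc (p * qInt (suc p) (suc a))        ∎
  where
  open +-*-Solver
  Q = qInt (suc p) a

-- The source of the q-integers: the left side counts the vectors of a space of dimension `i + a`
-- outside a subspace of dimension `i`.
power-difference : ∀ p i a → suc p ^ (i + a) ∸ suc p ^ i ≡ p * suc p ^ i * qInt (suc p) a
power-difference p i a = begin
  q ^ (i + a) ∸ q ^ i               ≡⟨ cong (_∸ q ^ i) (trans (^-distribˡ-+-* q i a) (cong (q ^ i *_) (geometric p a))) ⟩
  q ^ i * suc (p * Q) ∸ q ^ i       ≡⟨ cong (_∸ q ^ i) (*-suc (q ^ i) (p * Q)) ⟩
  q ^ i + q ^ i * (p * Q) ∸ q ^ i   ≡⟨ m+n∸m≡n (q ^ i) _ ⟩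
  q ^ i * (p * Q)                   ≡⟨ solve 3 (λ x p Q → x :* (p :* Q) := p :* x :* Q) refl (q ^ i) p Q ⟩
  p * q ^ i * Q                     ∎
  where
  open +-*-Solver
  q = suc p
  Q = qInt (suc p) a

-- The number of linearly independent sequences whose i-th vector lies in a
-- space of dimension a xᵢ, these spaces being nested.
stairs : ℕ → (ℕ → ℕ) → ℕ → List ℕ → ℕ
stairs q a i []      = 1
stairs q a i (x ∷ X) = (q ^ a x ∸ q ^ i) * stairs q a (suc i) X

count-none : ∀ {x} C → All (x ≤_) C → count (_<ᵇ x) C ≡ 0
count-none [] [] = refl
count-none {x} (c ∷ C) (x≤c ∷ h) with c <ᵇ x in eq
... | true = ⊥-elim (<⇒≱ (<ᵇ-sound c x eq) x≤c)
... | false = count-none C h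

-- `i` counts the elements already removed from the left column; they lie below every remaining `x`,
-- whence `i +` in the hypothesis. If `c` lies below `x`, it lies below the rest of `X` too, and the
-- hypothesis passes to `suc i`. Otherwise nothing in `c ∷ C` is below `x`, the factor is
-- `q ^ i ∸ q ^ i`, and both sides are zero.
stairs-columnFactor : ∀ p a i C X → Sorted C → Sorted X → (∀ {x} → x ∈ X → a x ≡ i + count (_<ᵇ x) C) →
  stairs (suc p) a i X ≡ (if belowLarger C X
                          then p ^ length X * suc p ^ shift i (length X) * columnFactor (suc p) C X
                          else 0)
stairs-columnFactor p a i [] [] sC sX h = refl
stairs-columnFactor p a i (c ∷ C) [] sC sX h = refl
stairs-columnFactor p a i [] (x ∷ X) sC sX h
  rewrite trans (h (here refl)) (+-identityʳ i) | n∸n≡0 (suc p ^ i) = refl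
stairs-columnFactor p a i (c ∷ C) (x ∷ X) (c< ∷ sC) (x< ∷ sX) h with c <ᵇ x in c<x
... | false
  rewrite trans (h (here refl)) (cong (λ b → i + ((if b then 1 else 0) + count (_<ᵇ x) C)) c<x)
        | count-none {x} C (All.map (λ c<d → ≤-trans (≮⇒≥ (λ lt → false⇒∉ c<x (<ᵇ-complete lt))) (<⇒≤ c<d)) c<)
        | +-identityʳ i | n∸n≡0 (suc p ^ i) = refl
... | true = begin
  (q ^ a x ∸ q ^ i) * stairs q a (suc i) X
    ≡⟨ cong₂ _*_ (trans (cong (λ e → q ^ e ∸ q ^ i) (h (here refl))) (power-difference p i k))
                 (stairs-columnFactor p a (suc i) C X sC sX h′) ⟩
  p * q ^ i * qInt q k * (if belowLarger C X then p ^ m * q ^ s * F else 0)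
    ≡⟨ distribute (belowLarger C X) ⟩
  (if belowLarger C X then p * p ^ m * q ^ (i + s) * (qInt q k * F) else 0)
    ≡⟨ cong (λ e → if belowLarger C X then p * p ^ m * q ^ (i + s) * (qInt q e * F) else 0) k≡ ⟩
  (if belowLarger C X then p * p ^ m * q ^ (i + s) * (qInt q (suc (count (_<ᵇ x) C)) * F) else 0) ∎
  where
  open +-*-Solver
  q = suc p
  k = count (_<ᵇ x) (c ∷ C)
  k≡ : k ≡ suc (count (_<ᵇ x) C)
  k≡ = cong (λ b → (if b then 1 else 0) + count (_<ᵇ x) C) c<x
  m = length X
  s = shift (suc i) (length X)
  F = columnFactor q C X
  h′ : ∀ {y} → y ∈ X → a y ≡ suc i + count (_<ᵇ y) C
  h′ {y} y∈ = trans (h (there y∈))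
    (trans (cong (λ b → i + ((if b then 1 else 0) + count (_<ᵇ y) C))
             (<ᵇ-complete (<-trans (<ᵇ-sound c x c<x) (All.lookup x< y∈))))
           (+-suc i _))
  distribute : ∀ b → p * q ^ i * qInt q k * (if b then p ^ m * q ^ s * F else 0)
               ≡ (if b then p * p ^ m * q ^ (i + s) * (qInt q k * F) else 0)
  distribute false = *-zeroʳ (p * q ^ i * qInt q k)
  distribute true = trans
    (solve 6 (λ p qi k pm qs F → p :* qi :* k :* (pm :* qs :* F) := p :* pm :* (qi :* qs) :* (k :* F)) refl
      p (q ^ i) (qInt q k) (p ^ m) (q ^ s) F)
    (cong (λ z → p * p ^ m * z * (qInt q k * F)) (sym (^-distribˡ-+-* q i s)))

-- Runs parallel to `pivotCount`: `S` holds the available entries, `C` is the first column, `D` the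
-- second. Adjacent comparisons suffice: rows increase if neighbours do, `elems` makes columns
-- increase, and `D` inside `S ─ C` keeps entries distinct.
tabs : ∀ {n} → Vec Bool n → Vec Bool n → List ℕ → List Tableau
tabs S C []      = attach (elems C) [] ∷ []
tabs S C (m ∷ μ) = concatMap
  (λ D → if belowLarger (elems C) (elems D) then map (attach (elems C)) (tabs (S ─ C) D μ) else [])
  (subs (S ─ C) m)

tabs-attach : ∀ {n} (S C : Vec Bool n) μ {T} → T ∈ tabs S C μ → ∃[ T′ ] (T ≡ attach (elems C) T′)
tabs-attach S C [] (here refl) = [] , refl
tabs-attach S C (m ∷ μ) {T} T∈ = go (find (∈-concatMap⁻ _ T∈))
  where
  go : ∃[ D ] (D ∈ subs (S ─ C) m × T ∈ (if belowLarger (elems C) (elems D) then map (attach (elems C)) (tabs (S ─ C) D μ) else [])) →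
       ∃[ T′ ] (T ≡ attach (elems C) T′)
  go (D , _ , T∈) with belowLarger (elems C) (elems D)
  ... | true = let T′ , _ , eq = ∈-map⁻ _ T∈ in T′ , eq

belowLarger-length : ∀ C X → belowLarger C X ≡ true → length X ≤ length C
belowLarger-length C [] h = z≤n
belowLarger-length (c ∷ C) (x ∷ X) h = s≤s (belowLarger-length C X (proj₂ (∧-true h)))

-- The number of subspaces of F^S with pivot set C and partial profile size C ∷ μ.
pivotCount : ∀ {n} → ℕ → Vec Bool n → Vec Bool n → List ℕ → ℕ
pivotCount q S C []      = q ^ β (elems C) (elems (S ─ C))
pivotCount q S C (m ∷ μ) =
  sum (map (λ D → stairs q (λ x → count (_<ᵇ x) (elems C)) 0 (elems D) * pivotCount q (S ─ C) D μ) (subs (S ─ C) m))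

weight : ℕ → List ℕ → Tableau → ℕ
weight q S T = cq q T * q ^ γ′ S T

-- Peel off the second column `D`. Its factor `p ^ m * q ^ (m choose 2)` depends only on its size
-- and joins the constant, while `columnFactor` turns the weight of the shorter tableau into that of
-- the longer. If `D` does not fit next to `C`, both sides are zero. Positive parts keep `D`
-- nonempty, so the last column stays the same.
pivotCount-tabs : ∀ {n} p (S C : Vec Bool n) μ → All (1 ≤_) μ →
  pivotCount (suc p) S C μ
  ≡ p ^ sum μ * suc p ^ sum (map (_choose 2) μ) * sum (map (weight (suc p) (elems S)) (tabs S C μ))
pivotCount-tabs p S C [] [] = sym (begin
  1 * 1 * (cq q T * q ^ γ′ (elems S) T + 0)   ≡⟨ trans (*-identityˡ _) (+-identityʳ _) ⟩
  cq q T * q ^ γ′ (elems S) T                 ≡⟨ cong₂ (λ a b → a * q ^ b) (trans (cq≡rowsWeight q T) (rowsWeight-attach-[] q (elems C))) (γ′-attach-[] S C) ⟩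
  1 * q ^ β (elems C) (elems (S ─ C))         ≡⟨ *-identityˡ _ ⟩
  q ^ β (elems C) (elems (S ─ C))             ∎)
  where
  q = suc p
  T = attach (elems C) []
pivotCount-tabs p S C (m ∷ μ) (1≤m ∷ 1≤μ) = begin
  sum (map (λ D → stairs q a 0 (elems D) * pivotCount q (S ─ C) D μ) Ds)
    ≡⟨ sum-map-cong Ds step ⟩
  sum (map (λ D → K * sum (map (weight q (elems S)) (inner D))) Ds)
    ≡⟨ sum-map-* K _ Ds ⟩
  K * sum (map (λ D → sum (map (weight q (elems S)) (inner D))) Ds)
    ≡⟨ cong (K *_) (sum-concatMap (weight q (elems S)) inner Ds) ⟨
  K * sum (map (weight q (elems S)) (tabs S C (m ∷ μ))) ∎
  where
  q = suc p
  a : ℕ → ℕ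
  a x = count (_<ᵇ x) (elems C)
  Ds = subs (S ─ C) m
  inner : Vec Bool _ → List Tableau
  inner D = if belowLarger (elems C) (elems D) then map (attach (elems C)) (tabs (S ─ C) D μ) else []
  K₀ = p ^ sum μ * q ^ sum (map (_choose 2) μ)
  K = p ^ (m + sum μ) * q ^ (m choose 2 + sum (map (_choose 2) μ))
  K-split : K ≡ p ^ m * q ^ (m choose 2) * K₀
  K-split = trans (cong₂ _*_ (^-distribˡ-+-* p m (sum μ)) (^-distribˡ-+-* q (m choose 2) _))
    (solve 4 (λ a b c d → a :* b :* (c :* d) := a :* c :* (b :* d)) refl (p ^ m) (p ^ sum μ) (q ^ (m choose 2)) (q ^ sum (map (_choose 2) μ)))
    where open +-*-Solver
  weight-attach : ∀ D → D ∈ Ds → belowLarger (elems C) (elems D) ≡ true → ∀ {T} → T ∈ tabs (S ─ C) D μ →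
    weight q (elems S) (attach (elems C) T) ≡ columnFactor q (elems C) (elems D) * weight q (elems (S ─ C)) T
  weight-attach D D∈ b T∈ with tabs-attach (S ─ C) D μ T∈
  ... | T′ , refl = trans
    (cong₂ (λ x y → x * q ^ y)
      (trans (cq≡rowsWeight q (attach (elems C) T)) (trans (rowsWeight-attach q (elems C) (elems D) T′ len)
        (cong (columnFactor q (elems C) (elems D) *_) (sym (cq≡rowsWeight q T)))))
      (γ′-attach S C (elems D) T′ 1≤D len))
    (*-assoc (columnFactor q (elems C) (elems D)) (cq q T) _)
    where
    T = attach (elems D) T′
    len = belowLarger-length (elems C) (elems D) b
    1≤D : 1 ≤ length (elems D)
    1≤D = subst (1 ≤_) (sym (trans (length-elemsFrom 0 D) (proj₂ (sound (subs-enum (S ─ C) m) D∈)))) 1≤m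
  step : ∀ {D} → D ∈ Ds → stairs q a 0 (elems D) * pivotCount q (S ─ C) D μ ≡ K * sum (map (weight q (elems S)) (inner D))
  step {D} D∈
    rewrite stairs-columnFactor p a 0 (elems C) (elems D) (elems-sorted C) (elems-sorted D) (λ _ → refl)
    with belowLarger (elems C) (elems D) in b
  ... | false = sym (*-zeroʳ K)
  ... | true = begin
    p ^ length X * q ^ shift 0 (length X) * F * pivotCount q (S ─ C) D μ
      ≡⟨ cong₂ (λ l z → p ^ l * q ^ shift 0 l * F * z) |X| (pivotCount-tabs p (S ─ C) D μ 1≤μ) ⟩
    p ^ m * q ^ shift 0 m * F * (K₀ * Σ′)
      ≡⟨ cong (λ e → p ^ m * q ^ e * F * (K₀ * Σ′)) (shift-choose m) ⟩
    p ^ m * q ^ (m choose 2) * F * (K₀ * Σ′)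
      ≡⟨ solve 4 (λ x f k s → x :* f :* (k :* s) := x :* k :* (f :* s)) refl (p ^ m * q ^ (m choose 2)) F K₀ Σ′ ⟩
    p ^ m * q ^ (m choose 2) * K₀ * (F * Σ′)
      ≡⟨ cong₂ _*_ (sym K-split) (sym (sum-map-* F (weight q (elems (S ─ C))) Ts)) ⟩
    K * sum (map (λ T → F * weight q (elems (S ─ C)) T) Ts)
      ≡⟨ cong (K *_) (sum-map-cong Ts (λ T∈ → sym (weight-attach D D∈ b T∈))) ⟩
    K * sum (map (weight q (elems S) ∘ attach (elems C)) Ts)
      ≡⟨ cong (λ z → K * sum z) (map-∘ Ts) ⟩
    K * sum (map (weight q (elems S)) (map (attach (elems C)) Ts)) ∎
    where
    open +-*-Solver
    X = elems D
    F = columnFactor q (elems C) X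
    Ts = tabs (S ─ C) D μ
    Σ′ = sum (map (weight q (elems (S ─ C))) Ts)
    |X| : length X ≡ m
    |X| = trans (length-elemsFrom 0 D) (proj₂ (sound (subs-enum (S ─ C) m) D∈))

-- Multilinear tableaux as sequences of columns

-- A left inverse of prepending a column, for injectivity. Rows with a single cell disappear instead
-- of becoming empty, because `attach X T` has no rows beyond those of `X`.
detach : Tableau → Tableau
detach []                = []
detach ((c ∷ x ∷ r) ∷ T) = (x ∷ r) ∷ detach T
detach (_ ∷ T)           = detach T

detach-attach-[] : ∀ C → detach (attach C []) ≡ []
detach-attach-[] [] = refl
detach-attach-[] (c ∷ C) = detach-attach-[] C

detach-attach : ∀ C X T → length X ≤ length C → detach (attach C (attach X T)) ≡ attach X T
detach-attach [] [] T h = refl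
detach-attach (c ∷ C) [] T h = detach-attach-[] C
detach-attach (c ∷ C) (x ∷ X) T (s≤s h) = cong ((x ∷ firstRow T) ∷_) (detach-attach C X (drop 1 T) h)

TabP : ∀ {n} → Vec Bool n → Vec Bool n → List ℕ → Tableau → Set
TabP S C []      T = T ≡ attach (elems C) []
TabP S C (m ∷ μ) T = ∃[ D ] (IsSub (S ─ C) m D × belowLarger (elems C) (elems D) ≡ true
                             × ∃[ T′ ] (TabP (S ─ C) D μ T′ × T ≡ attach (elems C) T′))

TabP-attach : ∀ {n} (S C : Vec Bool n) μ {T} → TabP S C μ T → ∃[ T′ ] (T ≡ attach (elems C) T′)
TabP-attach S C [] eq = [] , eq
TabP-attach S C (m ∷ μ) (_ , _ , _ , T′ , _ , eq) = T′ , eq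

TabP-firstColumn : ∀ {n} (S C : Vec Bool n) μ {T} → TabP S C μ T → columnAt 0 T ≡ elems C
TabP-firstColumn S C μ t with T′ , refl ← TabP-attach S C μ t = columnAt-attach-zero (elems C) T′

TabP-unique : ∀ {n} (S S′ C C′ : Vec Bool n) μ {T} → TabP S C μ T → TabP S′ C′ μ T → C ≡ C′
TabP-unique S S′ C C′ μ t t′ =
  elems-injective (trans (sym (TabP-firstColumn S C μ t)) (TabP-firstColumn S′ C′ μ t′))

TabP-detach : ∀ {n} (S C D : Vec Bool n) μ {T} → belowLarger (elems C) (elems D) ≡ true →
              TabP S D μ T → detach (attach (elems C) T) ≡ T
TabP-detach S C D μ b t with T′ , refl ← TabP-attach S D μ t =
  detach-attach (elems C) (elems D) T′ (belowLarger-length (elems C) (elems D) b)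

tabs-enum : ∀ {n} (S C : Vec Bool n) μ → IsEnum (TabP S C μ) (tabs S C μ)
tabs-enum S C [] = record
  { sound = λ { (here refl) → refl } ; complete = λ { refl → here refl } ; unique = [] ∷ [] }
tabs-enum {n} S C (m ∷ μ) = enum-concatMap _ (subs-enum (S ─ C) m) (λ {D} _ → inner D) disjoint
  where
  Q : Vec Bool n → Tableau → Set
  Q D T = belowLarger (elems C) (elems D) ≡ true × ∃[ T′ ] (TabP (S ─ C) D μ T′ × T ≡ attach (elems C) T′)
  inner : ∀ D → IsEnum (Q D) (if belowLarger (elems C) (elems D) then map (attach (elems C)) (tabs (S ─ C) D μ) else [])
  inner D with belowLarger (elems C) (elems D) in b
  ... | false = record { sound = λ () ; complete = λ () ; unique = [] }
  ... | true = enum-map (attach (elems C)) (λ {T} t → refl , T , t , refl)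
    (λ { (_ , q) → q })
    (λ t t′ eq → trans (sym (TabP-detach (S ─ C) C D μ b t)) (trans (cong detach eq) (TabP-detach (S ─ C) C D μ b t′)))
    (tabs-enum (S ─ C) D μ)
  disjoint : ∀ {D D′ T} → IsSub (S ─ C) m D → IsSub (S ─ C) m D′ → Q D T → Q D′ T → D ≡ D′
  disjoint {D} {D′} _ _ (b , T₁ , t₁ , refl) (b′ , T₂ , t₂ , eq) = TabP-unique (S ─ C) (S ─ C) D D′ μ t₁
    (subst (TabP (S ─ C) D′ μ) (trans (sym (TabP-detach (S ─ C) C D′ μ b′ t₂)) (trans (cong detach (sym eq)) (TabP-detach (S ─ C) C D μ b t₁))) t₂)

rowsInc : Tableau → Bool
rowsInc = List.foldr (λ r b → rowInc r ∧ b) true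

rowsInc-attach-[] : ∀ C → rowsInc (attach C []) ≡ true
rowsInc-attach-[] [] = refl
rowsInc-attach-[] (c ∷ C) = rowsInc-attach-[] C

∧-interchange : ∀ a b c d → (a ∧ b) ∧ (c ∧ d) ≡ (a ∧ c) ∧ (b ∧ d)
∧-interchange true true c d = refl
∧-interchange true false c d = sym (Bool.∧-zeroʳ c)
∧-interchange false b c d = refl

rowsInc-attach : ∀ C X T → length X ≤ length C →
                 rowsInc (attach C (attach X T)) ≡ belowLarger C X ∧ rowsInc (attach X T)
rowsInc-attach [] [] T h = refl
rowsInc-attach (c ∷ C) [] T h = rowsInc-attach-[] C
rowsInc-attach (c ∷ C) (x ∷ X) T (s≤s h) = trans
  (cong (((c <ᵇ x) ∧ rowInc (x ∷ firstRow T)) ∧_) (rowsInc-attach C X (drop 1 T) h))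
  (∧-interchange (c <ᵇ x) (rowInc (x ∷ firstRow T)) (belowLarger C X) (rowsInc (attach X (drop 1 T))))

-- Missing rows are read as empty and `belowLarger r []` is true, so `colsInc` unfolds without a
-- distinction by the number of rows.
colsInc-step : ∀ T → belowLarger (firstRow T) (firstRow (drop 1 T)) ∧ colsInc (drop 1 T) ≡ colsInc T
colsInc-step [] = refl
colsInc-step (r ∷ []) = refl
colsInc-step (r ∷ s ∷ T) = refl

-- The comparison of two neighbouring rows splits into that of their first cells, which belongs to
-- `C`, and that of the remaining cells, which belongs to `T`.
colsInc-attach : ∀ C T → length T ≤ length C → colsInc (attach C T) ≡ rowInc C ∧ colsInc T
colsInc-attach [] [] h = refl
colsInc-attach (c ∷ []) [] h = refl
colsInc-attach (c ∷ []) (r ∷ []) h = refl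
colsInc-attach (c ∷ []) (r ∷ s ∷ T) (s≤s ())
colsInc-attach (c ∷ c′ ∷ C) T h = trans
  (cong (((c <ᵇ c′) ∧ belowLarger (firstRow T) (firstRow (drop 1 T))) ∧_)
    (colsInc-attach (c′ ∷ C) (drop 1 T) (drop-length T h)))
  (trans (∧-interchange (c <ᵇ c′) _ (rowInc (c′ ∷ C)) (colsInc (drop 1 T)))
         (cong (rowInc (c ∷ c′ ∷ C) ∧_) (colsInc-step T)))
  where
  drop-length : ∀ (T : Tableau) {k} → length T ≤ suc k → length (drop 1 T) ≤ k
  drop-length [] h = z≤n
  drop-length (r ∷ T) (s≤s h) = h

rowInc⇒Sorted : ∀ r → rowInc r ≡ true → Sorted r
rowInc⇒Sorted r h = Linked⇒AllPairs <-trans (go r h)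
  where
  go : ∀ r → rowInc r ≡ true → Linked _<_ r
  go [] h = []
  go (x ∷ []) h = [-]
  go (x ∷ y ∷ r) h = let a , b = ∧-true h in <ᵇ-sound x y a ∷ go (y ∷ r) b

Sorted⇒rowInc : ∀ r → Sorted r → rowInc r ≡ true
Sorted⇒rowInc r s = go r (AllPairs⇒Linked s)
  where
  go : ∀ r → Linked _<_ r → rowInc r ≡ true
  go [] l = refl
  go (x ∷ []) l = refl
  go (x ∷ y ∷ r) (lt ∷ l) = ∧-intro (<ᵇ-complete lt) (go (y ∷ r) l)

Sorted⇒Unique : ∀ {r} → Sorted r → Unique r
Sorted⇒Unique = AllPairs.map <⇒≢

distinctB⇒Unique : ∀ xs → distinctB xs ≡ true → Unique xs
distinctB⇒Unique [] h = []
distinctB⇒Unique (x ∷ xs) h = let a , b = ∧-true h in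
  All.tabulate (λ { y∈ refl → not-true a (elemB-complete y∈) }) ∷ distinctB⇒Unique xs b

Unique⇒distinctB : ∀ {xs} → Unique xs → distinctB xs ≡ true
Unique⇒distinctB [] = refl
Unique⇒distinctB {x ∷ xs} (x∉ ∷ u) =
  ∧-intro (not-intro (λ h → All.lookup x∉ (elemB-sound x xs h) refl)) (Unique⇒distinctB u)

Unique-↭ : ∀ {xs ys : List ℕ} → xs ↭ ys → Unique xs → Unique ys
Unique-↭ p = PermS.Unique-resp-↭ (setoid ℕ) (↭⇒↭ₛ p)

Unique-++⁻ : ∀ (xs : List ℕ) {ys} → Unique (xs ++ ys) → Unique ys × (∀ {x} → x ∈ xs → x ∈ ys → ⊥)
Unique-++⁻ [] u = u , λ ()
Unique-++⁻ (x ∷ xs) (x∉ ∷ u) = let u′ , d = Unique-++⁻ xs u in u′ , λ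
  { (here refl) m → All.lookup (All-++⁻ʳ xs x∉) m refl ; (there m′) m → d m′ m }

-- Shapes: a new first column and the conjugate partition

attachLen : ℕ → List ℕ → List ℕ
attachLen zero    ls       = []
attachLen (suc k) []       = 1 ∷ attachLen k []
attachLen (suc k) (l ∷ ls) = suc l ∷ attachLen k ls

map-length-attach : ∀ C T → map length (attach C T) ≡ attachLen (length C) (map length T)
map-length-attach [] T = refl
map-length-attach (c ∷ C) [] = cong (1 ∷_) (map-length-attach C [])
map-length-attach (c ∷ C) (r ∷ T) = cong (suc (length r) ∷_) (map-length-attach C T)

attach-surjective : ∀ m ls T → length ls ≤ m → map length T ≡ attachLen m ls →
                    ∃[ C ] ∃[ T′ ] (T ≡ attach C T′ × length C ≡ m × map length T′ ≡ ls)
attach-surjective zero [] [] h eq = [] , [] , refl , refl , refl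
attach-surjective (suc m) [] ((c ∷ []) ∷ T) h eq
  with attach-surjective m [] T z≤n (proj₂ (List-∷-injective eq))
... | C , [] , refl , refl , refl = c ∷ C , [] , refl , refl , refl
attach-surjective (suc m) (l ∷ ls) ((c ∷ r) ∷ T) (s≤s h) eq
  with attach-surjective m ls T h (proj₂ (List-∷-injective eq))
... | C , T′ , refl , refl , refl =
  c ∷ C , r ∷ T′ , refl , refl , cong (_∷ map length T′) (suc-injective (proj₁ (List-∷-injective eq)))

-- Beyond the `M` listed rows `attachLen` puts `1`, which is `suc (f j)` because `f` vanishes there.
attachLen-applyUpTo : ∀ m M f → M ≤ m → (∀ j → M ≤ j → f j ≡ 0) →
                      attachLen m (applyUpTo f M) ≡ applyUpTo (suc ∘ f) m
attachLen-applyUpTo zero zero f h z = refl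
attachLen-applyUpTo (suc m) zero f h z =
  cong₂ _∷_ (cong suc (sym (z 0 z≤n))) (attachLen-applyUpTo m zero (f ∘ suc) z≤n (λ j _ → z (suc j) z≤n))
attachLen-applyUpTo (suc m) (suc M) f (s≤s h) z =
  cong (suc (f 0) ∷_) (attachLen-applyUpTo m M (f ∘ suc) h (λ j M≤j → z (suc j) (s≤s M≤j)))

maximum : List ℕ → ℕ
maximum = List.foldr _⊔_ 0

≤-maximum : ∀ μ → All (_≤ maximum μ) μ
≤-maximum [] = []
≤-maximum (m ∷ μ) = m≤m⊔n m _ ∷ All.map (λ h → ≤-trans h (m≤n⊔m m _)) (≤-maximum μ)

decreasing-maximum : ∀ m μ → Decreasing (m ∷ μ) → maximum μ ≤ m
decreasing-maximum m [] d = z≤n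
decreasing-maximum m (k ∷ μ) (k≤m , d) = ⊔-lub k≤m (≤-trans (decreasing-maximum k μ d) k≤m)

decreasing-tail : ∀ m μ → Decreasing (m ∷ μ) → Decreasing μ
decreasing-tail m [] d = tt
decreasing-tail m (k ∷ μ) (_ , d) = d

count-large : ∀ j μ → All (_≤ j) μ → count (j <ᵇ_) μ ≡ 0
count-large j [] [] = refl
count-large j (m ∷ μ) (m≤j ∷ h) with j <ᵇ m in eq
... | true = ⊥-elim (<⇒≱ (<ᵇ-sound j m eq) m≤j)
... | false = count-large j μ h

applyUpTo-cong-< : ∀ {A : Set} {f g : ℕ → A} n → (∀ {i} → i < n → f i ≡ g i) → applyUpTo f n ≡ applyUpTo g n
applyUpTo-cong-< zero h = refl
applyUpTo-cong-< (suc n) h = cong₂ _∷_ (h (s≤s z≤n)) (applyUpTo-cong-< n (λ lt → h (s≤s lt)))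

-- The head of a decreasing list is its maximum, so there are `m` rows, and the part `m` adds one
-- cell to each of them.
conjugate-∷ : ∀ m μ → Decreasing (m ∷ μ) → conjugate (m ∷ μ) ≡ attachLen m (conjugate μ)
conjugate-∷ m μ d = begin
  applyUpTo (λ j → count (j <ᵇ_) (m ∷ μ)) (m ⊔ maximum μ)
    ≡⟨ cong (applyUpTo _) (m≥n⇒m⊔n≡m (decreasing-maximum m μ d)) ⟩
  applyUpTo (λ j → count (j <ᵇ_) (m ∷ μ)) m
    ≡⟨ applyUpTo-cong-< m (λ {j} lt → cong (λ b → (if b then 1 else 0) + count (j <ᵇ_) μ) (<ᵇ-complete lt)) ⟩
  applyUpTo (λ j → suc (count (j <ᵇ_) μ)) m
    ≡⟨ attachLen-applyUpTo m (maximum μ) _ (decreasing-maximum m μ d)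
         (λ j M≤j → count-large j μ (All.map (λ h → ≤-trans h M≤j) (≤-maximum μ))) ⟨
  attachLen m (conjugate μ) ∎

length-conjugate : ∀ μ → length (conjugate μ) ≡ maximum μ
length-conjugate μ = length-applyUpTo _ (maximum μ)

Filling : List ℕ → List ℕ → Tableau → Set
Filling xs ls T = map length T ≡ ls × All (_∈ xs) (supp T)

Valid : ∀ {n} → Vec Bool n → List ℕ → Tableau → Set
Valid S μ T = Filling (elems S) (conjugate μ) T × IsMultilinear T ≡ true

length-tail : ∀ m μ → Decreasing (m ∷ μ) → ∀ (T : Tableau) → map length T ≡ conjugate μ → length T ≤ m
length-tail m μ d T eq = ≤-trans
  (≤-reflexive (trans (sym (length-map length T)) (trans (cong length eq) (length-conjugate μ))))
  (decreasing-maximum m μ d)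

-- Cut off the first column. It increases, so it is `elems C` for a subset `C`; distinctness puts
-- the other entries into `S ─ C`; and the row condition splits into the comparison of the first two
-- columns and the row condition of the rest.
Valid⇒TabP : ∀ {n} (S : Vec Bool n) m μ → Decreasing (m ∷ μ) → ∀ {T} → Valid S (m ∷ μ) T →
             ∃[ C ] (IsSub S m C × TabP S C μ T)
Valid⇒TabP S m μ d {T} ((shape , entries) , ml)
  with attach-surjective m (conjugate μ) T
         (≤-trans (≤-reflexive (length-conjugate μ)) (decreasing-maximum m μ d))
         (trans shape (conjugate-∷ m μ d))
... | Cl , T′ , refl , refl , shape′
  with sorted⇒elems S (rowInc⇒Sorted Cl (proj₁ (∧-true (trans (sym (colsInc-attach Cl T′ len)) cols)))) entriesC
  where
  len = length-tail m μ d T′ shape′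
  cols = proj₁ (∧-true (proj₂ (∧-true {rowsInc T} ml)))
  entriesC = All-++⁻ˡ Cl (All-resp-↭ (supp-attach Cl T′ len) entries)
... | C , C⊆S , refl = C , (C⊆S , sym (length-elemsFrom 0 C)) , step μ d shape′
  where
  Cl′ = elems C
  step : ∀ μ → Decreasing (m ∷ μ) → map length T′ ≡ conjugate μ → TabP S C μ T
  step [] d s = cong (attach Cl′) (map-length-[] T′ s)
    where
    map-length-[] : ∀ (U : Tableau) → map length U ≡ [] → U ≡ []
    map-length-[] [] _ = refl
  step (k ∷ μ) d s
    with attach-surjective k (conjugate μ) T′
           (≤-trans (≤-reflexive (length-conjugate μ)) (decreasing-maximum k μ (decreasing-tail m (k ∷ μ) d)))
           (trans s (conjugate-∷ k μ (decreasing-tail m (k ∷ μ) d)))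
  ... | X , T″ , T′≡ , |X| , _ = D , isSub , subst (λ Y → belowLarger Cl′ Y ≡ true) (sym D≡X) (proj₁ rows′) , T′ , t , refl
    where
    len = length-tail m (k ∷ μ) d T′ s
    len′ : length X ≤ length Cl′
    len′ = ≤-trans (≤-reflexive (trans (sym (length-attach X T″)) (cong length (sym T′≡)))) len
    rows′ : belowLarger Cl′ X ≡ true × rowsInc T′ ≡ true
    rows′ = ∧-true (trans (cong (λ U → belowLarger Cl′ X ∧ rowsInc U) T′≡) (trans (sym (rowsInc-attach Cl′ X T″ len′))
              (trans (cong (λ U → rowsInc (attach Cl′ U)) (sym T′≡)) (proj₁ (∧-true {rowsInc (attach Cl′ T′)} ml)))))
    ml₂ = ∧-true (proj₂ (∧-true {rowsInc (attach Cl′ T′)} ml))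
    cols′ = proj₂ (∧-true {rowInc Cl′} (trans (sym (colsInc-attach Cl′ T′ len)) (proj₁ ml₂)))
    uniq = Unique-++⁻ Cl′ (Unique-↭ (supp-attach Cl′ T′ len) (distinctB⇒Unique (supp (attach Cl′ T′)) (proj₂ ml₂)))
    entries′ : All (_∈ elems (S ─ C)) (supp T′)
    entries′ = All.tabulate (λ {x} x∈ → subst (x ∈_) (sym (elems-─ S C))
      (∈-filterB⁺ _ (All.lookup (All-++⁻ʳ Cl′ (All-resp-↭ (supp-attach Cl′ T′ len) entries)) x∈)
        (not-intro (λ h → proj₂ uniq (elemB-sound x Cl′ h) x∈))))
    ih = Valid⇒TabP (S ─ C) k μ (decreasing-tail m (k ∷ μ) d)
      ((s , entries′) , ∧-intro (proj₂ rows′) (∧-intro cols′ (Unique⇒distinctB (proj₁ uniq))))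
    D = proj₁ ih
    isSub = proj₁ (proj₂ ih)
    t = proj₂ (proj₂ ih)
    -- The subset from the induction hypothesis and the column from the shape are both the first
    -- column of `T′`.
    D≡X : elems D ≡ X
    D≡X = trans (sym (TabP-firstColumn (S ─ C) D μ t)) (trans (cong (columnAt 0) T′≡) (columnAt-attach-zero X T″))

TabP⇒Valid : ∀ {n} (S : Vec Bool n) m μ → Decreasing (m ∷ μ) → ∀ {T C} → IsSub S m C → TabP S C μ T →
             Valid S (m ∷ μ) T
TabP⇒Valid S m μ d {T} {C} (C⊆S , |C|) t = assemble (go μ d t)
  where
  -- All that is to be known about the remaining columns, phrased so that an empty and a nonempty
  -- rest are assembled in the same way.
  Rest : List ℕ → Tableau → Set
  Rest μ T = ∃[ T′ ] (T ≡ attach (elems C) T′ × map length T′ ≡ conjugate μ × All (_∈ elems S) (supp T′)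
    × rowsInc (attach (elems C) T′) ≡ true × colsInc T′ ≡ true × Unique (elems C ++ supp T′))
  go : ∀ μ → Decreasing (m ∷ μ) → TabP S C μ T → Rest μ T
  go [] d eq = [] , eq , refl , [] , rowsInc-attach-[] (elems C) , refl ,
    subst Unique (sym (++-identityʳ (elems C))) (Sorted⇒Unique (elems-sorted C))
  go (k ∷ μ) d (D , isSub , b , T′ , t , eq)
    with (shape , entries) , ml ← TabP⇒Valid (S ─ C) k μ (decreasing-tail m (k ∷ μ) d) {T′} isSub t
    with X , refl ← TabP-attach (S ─ C) D μ t =
    T′ , eq , shape , All.map (λ x∈ → proj₁ (split x∈)) entries ,
    trans (rowsInc-attach (elems C) (elems D) X (belowLarger-length (elems C) (elems D) b)) (∧-intro b (proj₁ (∧-true {rowsInc T′} ml))) ,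
    proj₁ (∧-true (proj₂ (∧-true {rowsInc T′} ml))) ,
    Unique.++⁺ (Sorted⇒Unique (elems-sorted C))
      (distinctB⇒Unique (supp T′) (proj₂ (∧-true {colsInc T′} (proj₂ (∧-true {rowsInc T′} ml)))))
      (λ { (x∈C , x∈T) → proj₂ (split (All.lookup entries x∈T)) x∈C })
    where
    split : ∀ {x} → x ∈ elems (S ─ C) → x ∈ elems S × ¬ (x ∈ elems C)
    split {x} x∈ = let a , h = ∈-filterB⁻ _ (elems S) (subst (x ∈_) (elems-─ S C) x∈) in
      a , λ m → not-true h (elemB-complete m)
  entriesC : All (_∈ elems S) (elems C)
  entriesC = All.tabulate (λ {x} x∈ → let i , i∈ , eq = ∈-elems⁻ C x∈ in
    subst (_∈ elems S) (sym eq) (∈-elems⁺ S i (C⊆S i i∈)))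
  assemble : Rest μ T → Valid S (m ∷ μ) T
  assemble (T′ , eq , s , entries , r , c , u) = subst (Valid S (m ∷ μ)) (sym eq)
    ((shape , All-resp-↭ (↭-sym p) (All-++⁺ entriesC entries)) ,
     ∧-intro r (∧-intro (trans (colsInc-attach (elems C) T′ len) (∧-intro (Sorted⇒rowInc _ (elems-sorted C)) c))
       (Unique⇒distinctB (Unique-↭ (↭-sym p) u))))
    where
    len : length T′ ≤ length (elems C)
    len = ≤-trans (length-tail m μ d T′ s) (≤-reflexive (sym (trans (length-elemsFrom 0 C) |C|)))
    p = supp-attach (elems C) T′ len
    shape : map length (attach (elems C) T′) ≡ conjugate (m ∷ μ)
    shape = trans (map-length-attach (elems C) T′)
      (trans (cong₂ attachLen (trans (length-elemsFrom 0 C) |C|) s) (sym (conjugate-∷ m μ d)))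

-- The tableaux of the formula, enumerated by their columns

words-enum : ∀ n l → IsEnum (λ w → length w ≡ l × All (_∈ range1 n) w) (words n l)
words-enum n zero = record
  { sound = λ { (here refl) → refl , [] } ; complete = λ { {[]} _ → here refl } ; unique = [] ∷ [] }
words-enum n (suc l) = enum-⇔
  (λ { (a , a∈ , w , (eq , w∈) , refl) → cong suc eq , a∈ ∷ w∈ })
  (λ { {a ∷ w} (eq , a∈ ∷ w∈) → a , a∈ , w , (suc-injective eq , w∈) , refl })
  (enum-concatMap {P = _∈ range1 n} {Q = λ a v → ∃[ w ] ((length w ≡ l × All (_∈ range1 n) w) × v ≡ a ∷ w)} _
    (record { sound = λ m → m ; complete = λ m → m ; unique = Sorted⇒Unique (range1-sorted n) })
    (λ {a} _ → enum-map (a ∷_) (λ {w} h → w , h , refl) (λ q → q) (λ { _ _ refl → refl }) (words-enum n l))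
    (λ { _ _ (_ , _ , refl) (_ , _ , refl) → refl }))

fillings-enum : ∀ n ls → IsEnum (Filling (range1 n) ls) (fillings n ls)
fillings-enum n [] = record
  { sound = λ { (here refl) → refl , [] } ; complete = λ { {[]} _ → here refl } ; unique = [] ∷ [] }
fillings-enum n (l ∷ ls) = enum-⇔
  (λ { (r , (eq , r∈) , T , (eqs , T∈) , refl) → cong₂ _∷_ eq eqs , All-++⁺ r∈ T∈ })
  (λ { {r ∷ T} (eq , h) → r , (proj₁ (List-∷-injective eq) , All-++⁻ˡ r h) , T , (proj₂ (List-∷-injective eq) , All-++⁻ʳ r h) , refl })
  (enum-concatMap {Q = λ r v → ∃[ T ] (Filling (range1 n) ls T × v ≡ r ∷ T)} _
    (words-enum n l)
    (λ {a} _ → enum-map (a ∷_) (λ {w} h → w , h , refl) (λ q → q) (λ { _ _ refl → refl }) (fillings-enum n ls))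
    (λ { _ _ (_ , _ , refl) (_ , _ , refl) → refl }))

enum-filterB : ∀ {A : Set} {P : A → Set} {xs} (p : A → Bool) → IsEnum P xs →
               IsEnum (λ x → P x × p x ≡ true) (filterB p xs)
enum-filterB {xs = xs} p e = record
  { sound    = λ m → let a , b = ∈-filterB⁻ p xs m in sound e a , b
  ; complete = λ { (a , b) → ∈-filterB⁺ p (complete e a) b }
  ; unique   = filterB-AllPairs p (unique e)
  }

multilinearTableaux-enum : ∀ n m μ → Decreasing (m ∷ μ) →
  IsEnum (λ T → ∃[ C ] (IsSub (full n) m C × TabP (full n) C μ T)) (multilinearTableaux n (conjugate (m ∷ μ)))
multilinearTableaux-enum n m μ d = enum-⇔
  (λ { ((shape , entries) , ml) → Valid⇒TabP (full n) m μ d ((shape , subst (λ xs → All (_∈ xs) _) (sym (elems-full n)) entries) , ml) })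
  (λ { (C , isSub , t) → let (shape , entries) , ml = TabP⇒Valid (full n) m μ d isSub t in
       (shape , subst (λ xs → All (_∈ xs) _) (elems-full n) entries) , ml })
  (enum-filterB IsMultilinear (fillings-enum n (conjugate (m ∷ μ))))

-- `multilinearTableaux` filters fillings made row by row, `tabs` adds column after column. Both
-- enumerate the same tableaux, so they differ by a permutation and the sums of weights agree.
sum-pivotCount : ∀ p n m μ → IsPartition (m ∷ μ) →
  sum (map (λ C → pivotCount (suc p) (full n) C μ) (subs (full n) m)) ≡ piFormula (suc p) n (m ∷ μ)
sum-pivotCount p n m μ (1≤m ∷ 1≤μ , d) = begin
  sum (map (λ C → pivotCount q S C μ) (subs S m))
    ≡⟨ sum-map-cong (subs S m) (λ {C} _ → pivotCount-tabs p S C μ 1≤μ) ⟩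
  sum (map (λ C → K * sum (map (weight q (elems S)) (tabs S C μ))) (subs S m))
    ≡⟨ sum-map-* K _ (subs S m) ⟩
  K * sum (map (λ C → sum (map (weight q (elems S)) (tabs S C μ))) (subs S m))
    ≡⟨ cong (K *_) (sum-concatMap (weight q (elems S)) (λ C → tabs S C μ) (subs S m)) ⟨
  K * sum (map (weight q (elems S)) (concatMap (λ C → tabs S C μ) (subs S m)))
    ≡⟨ cong (K *_) (enum-sum
         (enum-concatMap _ (subs-enum S m) (λ {C} _ → tabs-enum S C μ) (λ {C} {D} _ _ → TabP-unique S S C D μ))
         (multilinearTableaux-enum n m μ d) (weight q (elems S))) ⟩
  K * sum (map (weight q (elems S)) (multilinearTableaux n (conjugate (m ∷ μ))))
    ≡⟨ cong (λ xs → K * sum (map (weight q xs) (multilinearTableaux n (conjugate (m ∷ μ))))) (elems-full n) ⟩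
  K * sum (map (weight q (range1 n)) (multilinearTableaux n (conjugate (m ∷ μ)))) ∎
  where
  q = suc p
  S = full n
  K = p ^ sum μ * q ^ sum (map (_choose 2) μ)

-- Reduced echelon forms

module Field {q : ℕ} (𝔽 : FieldOn q) where

  open FieldOn 𝔽 public

  F : Set
  F = Fin q

  ring : CommutativeRing 0ℓ 0ℓ
  ring = record { isCommutativeRing = isCommutativeRing }

  open CommutativeRing ring public
    using (zeroˡ; zeroʳ; distribˡ; distribʳ; -‿inverseˡ; -‿inverseʳ; commutativeSemiring; semiring)
    renaming (+-identityˡ to +F-identityˡ; +-identityʳ to +F-identityʳ; +-comm to +F-comm; +-assoc to +F-assoc;
              *-identityˡ to *F-identityˡ; *-identityʳ to *F-identityʳ; *-comm to *F-comm; *-assoc to *F-assoc)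
  open Algebra.Properties.Ring (CommutativeRing.ring ring) public
    using (-‿distribˡ-*; -0#≈0#; x∙y⁻¹≈ε⇒x≈y) renaming (+-cancelˡ to +F-cancelˡ)
  open Algebra.Properties.Semiring.Sum semiring public
    using (∑-distrib-+; ∑-comm; *-distribˡ-sum; *-distribʳ-sum) renaming (sum to ∑; sum-cong-≗ to ∑-cong)
  open Algebra.Solver.Ring.NaturalCoefficients.Default commutativeSemiring public
    using (solve; _:=_; _:+_; _:*_)

  infixl 6 _-F_
  _-F_ : F → F → F
  x -F y = x +F -F_ y

  Nonzero : F → Set
  Nonzero x = x ≢ 0F

  nonzero? : ∀ x → Dec (Nonzero x)
  nonzero? x = ¬? (x Fin.≟ 0F)

  ¬nonzero : ∀ {x} → ¬ Nonzero x → x ≡ 0F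
  ¬nonzero {x} h with x Fin.≟ 0F
  ... | yes eq = eq
  ... | no ne = ⊥-elim (h ne)

  *-nonzeroˡ : ∀ {x y} → Nonzero (x *F y) → Nonzero x
  *-nonzeroˡ {x} {y} h eq = h (trans (cong (_*F y) eq) (zeroˡ y))

  *-nonzeroʳ : ∀ {x y} → Nonzero (x *F y) → Nonzero y
  *-nonzeroʳ {x} {y} h eq = h (trans (cong (x *F_) eq) (zeroʳ x))

  -- The value at `0F` is a default that makes `inv` total: `uncomm` applies it on the diagonal too,
  -- where the gap is `0F`.
  inv : F → F
  inv x with x Fin.≟ 0F
  ... | yes _ = 0F
  ... | no ne = proj₁ (inverse x ne)

  inv-*ʳ : ∀ {x} → Nonzero x → x *F inv x ≡ 1F
  inv-*ʳ {x} h with x Fin.≟ 0F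
  ... | yes eq = ⊥-elim (h eq)
  ... | no ne = proj₂ (inverse x ne)

  inv-*ˡ : ∀ {x} → Nonzero x → inv x *F x ≡ 1F
  inv-*ˡ h = trans (*F-comm _ _) (inv-*ʳ h)

  x-x≡0 : ∀ x → x -F x ≡ 0F
  x-x≡0 = -‿inverseʳ

  y+[x-y]≡x : ∀ x y → y +F (x -F y) ≡ x
  y+[x-y]≡x x y = begin
    y +F (x +F -F_ y) ≡⟨ cong (y +F_) (+F-comm x (-F_ y)) ⟩
    y +F (-F_ y +F x) ≡⟨ +F-assoc y (-F_ y) x ⟨
    y +F -F_ y +F x   ≡⟨ cong (_+F x) (-‿inverseʳ y) ⟩
    0F +F x           ≡⟨ +F-identityˡ x ⟩
    x                 ∎

  -1F : F
  -1F = -F_ 1F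

  -1*x : ∀ x → -1F *F x ≡ -F_ x
  -1*x x = trans (sym (-‿distribˡ-* 1F x)) (cong -F_ (*F-identityˡ x))

  ∑-zero : ∀ {n} {f : Fin n → F} → (∀ i → f i ≡ 0F) → ∑ f ≡ 0F
  ∑-zero {zero} h = refl
  ∑-zero {suc n} h = trans (cong₂ _+F_ (h zero) (∑-zero (h ∘ suc))) (+F-identityˡ 0F)

  ∑-single : ∀ {n} {f : Fin n → F} i → (∀ k → k ≢ i → f k ≡ 0F) → ∑ f ≡ f i
  ∑-single {suc n} zero h = trans (cong (_ +F_) (∑-zero (λ k → h (suc k) (λ ())))) (+F-identityʳ _)
  ∑-single {suc n} (suc i) h =
    trans (cong₂ _+F_ (h zero (λ ())) (∑-single i (λ k k≢i → h (suc k) (k≢i ∘ Fin.suc-injective)))) (+F-identityˡ _)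

  ∑-nonzero : ∀ {n} {f : Fin n → F} → Nonzero (∑ f) → ∃[ i ] Nonzero (f i)
  ∑-nonzero {f = f} h with Fin.any? (λ i → nonzero? (f i))
  ... | yes w = w
  ... | no ¬w = ⊥-elim (h (∑-zero (λ i → ¬nonzero (λ ne → ¬w (i , ne)))))

  δ : ∀ {n} → Fin n → Fin n → F
  δ i j = if does (i Fin.≟ j) then 1F else 0F

  δ-refl : ∀ {n} (i : Fin n) → δ i i ≡ 1F
  δ-refl i with i Fin.≟ i
  ... | yes _ = refl
  ... | no ne = ⊥-elim (ne refl)

  δ-≢ : ∀ {n} (i j : Fin n) → i ≢ j → δ i j ≡ 0F
  δ-≢ i j ne with i Fin.≟ j
  ... | yes eq = ⊥-elim (ne eq)
  ... | no _ = refl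

  1<q : 1 ℕ.< q
  1<q = go 0F 1F 0≢1
    where
    go : ∀ {m} (x y : Fin m) → x ≢ y → 1 ℕ.< m
    go {suc zero} zero zero h = ⊥-elim (h refl)
    go {suc (suc m)} x y h = s≤s (s≤s z≤n)

  anyVec? : ∀ {n} {P : Vec F n → Set} → Decidable P → Dec (∃[ v ] P v)
  anyVec? {zero} P? = map′ ([] ,_) (λ { ([] , p) → p }) (P? [])
  anyVec? {suc n} P? = map′ (λ { (x , v , p) → x ∷ v , p }) (λ { (x ∷ v , p) → x , v , p })
    (Fin.any? (λ x → anyVec? (λ v → P? (x ∷ v))))

  Mat : ℕ → Set
  Mat n = Vec (Vec F n) n

  ent : ∀ {m n} → Vec (Vec F n) m → Fin m → Fin n → F
  ent A i j = lookup (lookup A i) j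

  mk : ∀ {m n} → (Fin m → Fin n → F) → Vec (Vec F n) m
  mk f = tabulate (λ i → tabulate (f i))

  ent-mk : ∀ {m n} (f : Fin m → Fin n → F) i j → ent (mk f) i j ≡ f i j
  ent-mk f i j = trans (cong (λ r → lookup r j) (lookup∘tabulate _ i)) (lookup∘tabulate _ j)

  mat-ext : ∀ {m n} {A B : Vec (Vec F n) m} → (∀ i j → ent A i j ≡ ent B i j) → A ≡ B
  mat-ext h = vec-ext (λ i → vec-ext (h i))

  infixl 7 _⊙_
  -- Row vector times matrix, kept as a function of the column so that an entry unfolds to its sum
  -- directly.
  _⊙_ : ∀ {m n} → Vec F m → Vec (Vec F n) m → Fin n → F
  (v ⊙ A) j = ∑ (λ i → lookup v i *F ent A i j)

  module _ {n : ℕ} where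
    open LinAlg 𝔽 n public hiding (Mem)

    0V-at : ∀ i → lookup zeroV i ≡ 0F
    0V-at i = lookup-replicate i 0F

    +V-at : ∀ u v i → lookup (u +V v) i ≡ lookup u i +F lookup v i
    +V-at u v i = lookup-zipWith _+F_ i u v

    ·V-at : ∀ a v i → lookup (a ·V v) i ≡ a *F lookup v i
    ·V-at a v i = lookup-map i (a *F_) v

    Sub : (Vec F n → Set) → Set
    Sub X = X zeroV × (∀ u v → X u → X v → X (u +V v)) × (∀ a v → X v → X (a ·V v))

    infixl 6 _-V_
    _-V_ : Vec F n → Vec F n → Vec F n
    u -V v = u +V (-1F ·V v)

    -V-at : ∀ u v i → lookup (u -V v) i ≡ lookup u i -F lookup v i
    -V-at u v i = trans (+V-at u (-1F ·V v) i) (cong (lookup u i +F_) (trans (·V-at -1F v i) (-1*x _)))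

    sub-− : ∀ {X} → Sub X → ∀ {u v} → X u → X v → X (u -V v)
    sub-− (_ , add , scale) xu xv = add _ _ xu (scale _ _ xv)

  module _ {m n : ℕ} (A : Vec (Vec F n) m) where

    0-⊙ : ∀ j → (zeroV ⊙ A) j ≡ 0F
    0-⊙ j = ∑-zero (λ i → trans (cong (_*F ent A i j) (0V-at i)) (zeroˡ _))

    +-⊙ : ∀ u v j → ((u +V v) ⊙ A) j ≡ (u ⊙ A) j +F (v ⊙ A) j
    +-⊙ u v j = trans (∑-cong (λ i → trans (cong (_*F ent A i j) (+V-at u v i)) (distribʳ (ent A i j) (lookup u i) (lookup v i))))
                      (∑-distrib-+ (λ i → lookup u i *F ent A i j) (λ i → lookup v i *F ent A i j))

    ·-⊙ : ∀ a v j → ((a ·V v) ⊙ A) j ≡ a *F (v ⊙ A) j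
    ·-⊙ a v j = trans (∑-cong (λ i → trans (cong (_*F ent A i j) (·V-at a v i)) (*F-assoc a (lookup v i) (ent A i j))))
                      (sym (*-distribˡ-sum a (λ i → lookup v i *F ent A i j)))

    −-⊙ : ∀ u v j → ((u -V v) ⊙ A) j ≡ (u ⊙ A) j -F (v ⊙ A) j
    −-⊙ u v j = trans (+-⊙ u (-1F ·V v) j) (cong ((u ⊙ A) j +F_) (trans (·-⊙ -1F v j) (-1*x _)))

  -- If A is Reduced, this is the space with echelon basis e i + A i for i ∈ C.
  Mem : ∀ {n} → Vec Bool n → Mat n → Vec F n → Set
  Mem C A v = ∀ j → ¬ (j ∈ₛ C) → lookup v j ≡ (v ⊙ A) j

  mem? : ∀ {n} (C : Vec Bool n) A → Decidable (Mem C A)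
  mem? C A v = Fin.all? (λ j → ¬? (j ∈ₛ? C) →-dec (lookup v j Fin.≟ (v ⊙ A) j))

  Reduced : ∀ {n} → Vec Bool n → Mat n → Set
  Reduced C A = ∀ i j → Nonzero (ent A i j) → i ∈ₛ C × ¬ (j ∈ₛ C) × i Fin.< j

  RREF : ∀ {n} → Vec Bool n → Vec Bool n → Mat n → Set
  RREF S C A = ∀ i j → Nonzero (ent A i j) → i ∈ₛ C × j ∈ₛ S ─ C × i Fin.< j

  RREF⇒Reduced : ∀ {n} (S C : Vec Bool n) {A} → RREF S C A → Reduced C A
  RREF⇒Reduced S C r i j ne = let a , b , c = r i j ne in a , proj₂ (∈-─⁻ S C j b) , c

  ⊙-agree : ∀ {n} (C : Vec Bool n) (A : Mat n) → (∀ i j → Nonzero (ent A i j) → i ∈ₛ C) → ∀ u v →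
            (∀ i → i ∈ₛ C → lookup u i ≡ lookup v i) → ∀ j → (u ⊙ A) j ≡ (v ⊙ A) j
  ⊙-agree C A rows u v h j = ∑-cong term
    where
    term : ∀ i → lookup u i *F ent A i j ≡ lookup v i *F ent A i j
    term i with nonzero? (ent A i j)
    ... | yes ne = cong (_*F ent A i j) (h i (rows i j ne))
    ... | no ¬ne rewrite ¬nonzero ¬ne = trans (zeroʳ _) (sym (zeroʳ _))

  mem-sub : ∀ {n} (C : Vec Bool n) (A : Mat n) → Sub (Mem C A)
  mem-sub C A =
    (λ j _ → trans (0V-at j) (sym (0-⊙ A j))) ,
    (λ u v mu mv j j∉ → trans (+V-at u v j) (trans (cong₂ _+F_ (mu j j∉) (mv j j∉)) (sym (+-⊙ A u v j)))) ,
    (λ a v mv j j∉ → trans (·V-at a v j) (trans (cong (a *F_) (mv j j∉)) (sym (·-⊙ A a v j))))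

  mem-determined : ∀ {n} (C : Vec Bool n) (A : Mat n) → Reduced C A → ∀ u v → Mem C A u → Mem C A v →
                   (∀ i → i ∈ₛ C → lookup u i ≡ lookup v i) → u ≡ v
  mem-determined C A r u v mu mv h = vec-ext at
    where
    at : ∀ j → lookup u j ≡ lookup v j
    at j with j ∈ₛ? C
    ... | yes j∈ = h j j∈
    ... | no j∉ = trans (mu j j∉) (trans (⊙-agree C A (λ i j ne → proj₁ (r i j ne)) u v h j) (sym (mv j j∉)))

  -- For reduced `A`, the combination of the echelon basis whose coefficients are the coordinates of
  -- `x` on `C`.
  extend : ∀ {n} → Vec Bool n → Mat n → Vec F n → Vec F n
  extend C A x = tabulate (λ j → if lookup C j then lookup x j else (x ⊙ A) j)

  extend-∈ : ∀ {n} (C : Vec Bool n) (A : Mat n) x j → j ∈ₛ C → lookup (extend C A x) j ≡ lookup x j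
  extend-∈ C A x j j∈ = trans (lookup∘tabulate _ j) (cong (λ b → if b then lookup x j else (x ⊙ A) j) j∈)

  extend-∉ : ∀ {n} (C : Vec Bool n) (A : Mat n) x j → ¬ (j ∈ₛ C) → lookup (extend C A x) j ≡ (x ⊙ A) j
  extend-∉ C A x j j∉ = trans (lookup∘tabulate _ j) (cong (λ b → if b then lookup x j else (x ⊙ A) j) (∉⇒false j∉))

  extend-mem : ∀ {n} (C : Vec Bool n) (A : Mat n) → Reduced C A → ∀ x → Mem C A (extend C A x)
  extend-mem C A r x j j∉ = trans (extend-∉ C A x j j∉)
    (sym (⊙-agree C A (λ i j ne → proj₁ (r i j ne)) (extend C A x) x (λ i → extend-∈ C A x i) j))

  -- Gaussian elimination by induction on the number of coordinates. The vectors of `X` beginning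
  -- with `0F` form the smaller space; the first coordinate is a pivot if some vector of `X` begins
  -- with `1F`, and a finite search decides this.
  rref-exists : ∀ {n} {X : Vec F n → Set} → Decidable X → Sub X →
                ∃[ C ] ∃[ A ] (Reduced C A × (∀ {v} → X v → Mem C A v) × (∀ {v} → Mem C A v → X v))
  rref-exists {zero} X? (x0 , _) = [] , [] , (λ ()) , (λ _ ()) , (λ { {[]} _ → x0 })
  rref-exists {suc n} {X} X? sub@(x0 , add , scale)
    with rref-exists {n} {λ v → X (0F ∷ v)} (λ v → X? (0F ∷ v))
           (x0 , (λ u v xu xv → subst (λ z → X (z ∷ (u +V v))) (+F-identityˡ 0F) (add _ _ xu xv)) ,
            (λ a v xv → subst (λ z → X (z ∷ (a ·V v))) (zeroʳ a) (scale a _ xv)))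
       | anyVec? (λ w → X? (1F ∷ w))
  ... | C₀ , A₀ , red , to , from | no no-pivot = false ∷ C₀ , A , red′ , to′ , from′
    where
    A : Mat (suc n)
    A = zeroV ∷ Vec.map (0F ∷_) A₀
    at-zero : ∀ i → ent A i zero ≡ 0F
    at-zero zero = refl
    at-zero (suc i) = cong (λ r → lookup r zero) (lookup-map i (0F ∷_) A₀)
    at-suc : ∀ i j → ent A (suc i) (suc j) ≡ ent A₀ i j
    at-suc i j = cong (λ r → lookup r (suc j)) (lookup-map i (0F ∷_) A₀)
    ⊙-zero : ∀ v → (v ⊙ A) zero ≡ 0F
    ⊙-zero v = ∑-zero (λ i → trans (cong (lookup v i *F_) (at-zero i)) (zeroʳ _))
    ⊙-suc : ∀ x v j → ((x ∷ v) ⊙ A) (suc j) ≡ (v ⊙ A₀) j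
    ⊙-suc x v j = trans (cong₂ _+F_ (trans (cong (x *F_) (0V-at j)) (zeroʳ x)) (∑-cong (λ i → cong (lookup v i *F_) (at-suc i j))))
      (+F-identityˡ _)
    red′ : Reduced (false ∷ C₀) A
    red′ i zero ne = ⊥-elim (ne (at-zero i))
    red′ zero (suc j) ne = ⊥-elim (ne (0V-at j))
    red′ (suc i) (suc j) ne = let a , b , c = red i j (λ eq → ne (trans (at-suc i j) eq)) in a , b , s≤s c
    head-zero : ∀ x v → X (x ∷ v) → x ≡ 0F
    head-zero x v xv = ¬nonzero (λ ne → no-pivot (inv x ·V v , subst (λ z → X (z ∷ (inv x ·V v))) (inv-*ˡ ne) (scale (inv x) _ xv)))
    to′ : ∀ {v} → X v → Mem (false ∷ C₀) A v
    to′ {x ∷ v} xv zero _ = trans (head-zero x v xv) (sym (⊙-zero (x ∷ v)))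
    to′ {x ∷ v} xv (suc j) j∉ = trans (to (subst (λ z → X (z ∷ v)) (head-zero x v xv) xv) j j∉) (sym (⊙-suc x v j))
    from′ : ∀ {v} → Mem (false ∷ C₀) A v → X v
    from′ {x ∷ v} m = subst (λ z → X (z ∷ v)) (sym (trans (m zero (λ ())) (⊙-zero (x ∷ v))))
      (from (λ j j∉ → trans (m (suc j) j∉) (⊙-suc x v j)))
  ... | C₀ , A₀ , red , to , from | yes (w , xw) = true ∷ C₀ , A , red′ , to′ , from′
    where
    -- The member of the smaller space that agrees with `w` on `C₀`; subtracting it clears the pivot
    -- coordinates, as a reduced form demands, and leaves the leading `1F`.
    e = extend C₀ A₀ w
    w′ = w -V e
    xw′ : X (1F ∷ w′)
    xw′ = subst (λ z → X (z ∷ w′)) (trans (cong (1F +F_) (zeroʳ -1F)) (+F-identityʳ 1F))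
      (sub-− {X = X} sub xw (from (extend-mem C₀ A₀ red w)))
    w′-∈ : ∀ i → i ∈ₛ C₀ → lookup w′ i ≡ 0F
    w′-∈ i i∈ = trans (-V-at w e i) (trans (cong (λ z → lookup w i -F z) (extend-∈ C₀ A₀ w i i∈)) (x-x≡0 _))
    w′⊙ : ∀ j → (w′ ⊙ A₀) j ≡ 0F
    w′⊙ j = trans (⊙-agree C₀ A₀ (λ i j ne → proj₁ (red i j ne)) w′ zeroV (λ i i∈ → trans (w′-∈ i i∈) (sym (0V-at i))) j) (0-⊙ A₀ j)
    A : Mat (suc n)
    A = (0F ∷ w′) ∷ Vec.map (0F ∷_) A₀
    at-zero : ∀ i → ent A i zero ≡ 0F
    at-zero zero = refl
    at-zero (suc i) = cong (λ r → lookup r zero) (lookup-map i (0F ∷_) A₀)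
    at-suc : ∀ i j → ent A (suc i) (suc j) ≡ ent A₀ i j
    at-suc i j = cong (λ r → lookup r (suc j)) (lookup-map i (0F ∷_) A₀)
    ⊙-suc : ∀ x v j → ((x ∷ v) ⊙ A) (suc j) ≡ x *F lookup w′ j +F (v ⊙ A₀) j
    ⊙-suc x v j = cong (x *F lookup w′ j +F_) (∑-cong (λ i → cong (lookup v i *F_) (at-suc i j)))
    red′ : Reduced (true ∷ C₀) A
    red′ i zero ne = ⊥-elim (ne (at-zero i))
    red′ zero (suc j) ne = refl , (λ j∈ → ne (w′-∈ j j∈)) , s≤s z≤n
    red′ (suc i) (suc j) ne = let a , b , c = red i j (λ eq → ne (trans (at-suc i j) eq)) in a , b , s≤s c
    reduce-⊙ : ∀ x v j → ((v -V (x ·V w′)) ⊙ A₀) j ≡ (v ⊙ A₀) j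
    reduce-⊙ x v j = begin
      ((v -V (x ·V w′)) ⊙ A₀) j                ≡⟨ −-⊙ A₀ v (x ·V w′) j ⟩
      (v ⊙ A₀) j -F ((x ·V w′) ⊙ A₀) j         ≡⟨ cong (λ z → (v ⊙ A₀) j -F z) (trans (·-⊙ A₀ x w′ j) (trans (cong (x *F_) (w′⊙ j)) (zeroʳ x))) ⟩
      (v ⊙ A₀) j -F 0F                         ≡⟨ trans (cong ((v ⊙ A₀) j +F_) -0#≈0#) (+F-identityʳ _) ⟩
      (v ⊙ A₀) j                               ∎
    restore : ∀ x v j → x *F lookup w′ j +F lookup (v -V (x ·V w′)) j ≡ lookup v j
    restore x v j = trans (cong (x *F lookup w′ j +F_) (trans (-V-at v (x ·V w′) j) (cong (λ z → lookup v j -F z) (·V-at x w′ j))))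
      (y+[x-y]≡x (lookup v j) (x *F lookup w′ j))
    to′ : ∀ {v} → X v → Mem (true ∷ C₀) A v
    to′ {x ∷ v} xv zero 0∉ = ⊥-elim (0∉ refl)
    to′ {x ∷ v} xv (suc j) j∉ = begin
      lookup v j                                               ≡⟨ restore x v j ⟨
      x *F lookup w′ j +F lookup (v -V (x ·V w′)) j            ≡⟨ cong (x *F lookup w′ j +F_) (to x-xw′ j j∉) ⟩
      x *F lookup w′ j +F ((v -V (x ·V w′)) ⊙ A₀) j            ≡⟨ cong (x *F lookup w′ j +F_) (reduce-⊙ x v j) ⟩
      x *F lookup w′ j +F (v ⊙ A₀) j                           ≡⟨ ⊙-suc x v j ⟨
      ((x ∷ v) ⊙ A) (suc j)                                    ∎
      where
      x-xw′ : X (0F ∷ (v -V (x ·V w′)))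
      x-xw′ = subst (λ z → X (z ∷ (v -V (x ·V w′))))
        (trans (cong (x +F_) (trans (-1*x _) (cong -F_ (*F-identityʳ x)))) (x-x≡0 x))
        (sub-− {X = X} sub xv (scale x _ xw′))
    from′ : ∀ {v} → Mem (true ∷ C₀) A v → X v
    from′ {x ∷ v} m = subst X (cong₂ _∷_ (trans (cong (_+F 0F) (*F-identityʳ x)) (+F-identityʳ x))
        (vec-ext (λ j → trans (+V-at (x ·V w′) (v -V (x ·V w′)) j) (trans (cong (_+F lookup (v -V (x ·V w′)) j) (·V-at x w′ j)) (restore x v j)))))
      (add _ _ (scale x _ xw′) (from m₀))
      where
      m₀ : Mem C₀ A₀ (v -V (x ·V w′))
      m₀ j j∉ = +F-cancelˡ (x *F lookup w′ j) _ _ (begin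
        x *F lookup w′ j +F lookup (v -V (x ·V w′)) j   ≡⟨ restore x v j ⟩
        lookup v j                                      ≡⟨ m (suc j) j∉ ⟩
        ((x ∷ v) ⊙ A) (suc j)                           ≡⟨ ⊙-suc x v j ⟩
        x *F lookup w′ j +F (v ⊙ A₀) j                  ≡⟨ cong (x *F lookup w′ j +F_) (reduce-⊙ x v j) ⟨
        x *F lookup w′ j +F ((v -V (x ·V w′)) ⊙ A₀) j   ∎)

-- Dimension and cardinality

module Spaces {q : ℕ} (𝔽 : FieldOn q) where

  open Field 𝔽

  basisV : ∀ {n} → Vec Bool n → Mat n → Fin n → Vec F n
  basisV C A i = extend C A (tabulate (δ i))

  basisV-∈ : ∀ {n} (C : Vec Bool n) (A : Mat n) i j → j ∈ₛ C → lookup (basisV C A i) j ≡ δ i j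
  basisV-∈ C A i j j∈ = trans (extend-∈ C A (tabulate (δ i)) j j∈) (lookup∘tabulate (δ i) j)

  basisV-∉ : ∀ {n} (C : Vec Bool n) (A : Mat n) i j → ¬ (j ∈ₛ C) → lookup (basisV C A i) j ≡ ent A i j
  basisV-∉ C A i j j∉ = trans (extend-∉ C A (tabulate (δ i)) j j∉) (trans
    (∑-single i (λ k k≢i → trans (cong (_*F ent A k j) (trans (lookup∘tabulate (δ i) k) (δ-≢ i k (k≢i ∘ sym)))) (zeroˡ _)))
    (trans (cong (_*F ent A i j) (trans (lookup∘tabulate (δ i) i) (δ-refl i))) (*F-identityˡ _)))

  -- The vector `basisV C A i` is zero before `i` and `1F` at `i`. If `i` were not in `D`,
  -- membership in `Mem D B` would express its coordinate at `i` through coordinates before `i`, so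
  -- it would be `0F`.
  pivots-⊆ : ∀ {n} (C D : Vec Bool n) A B → Reduced C A → Reduced D B →
             (∀ v → Mem C A v → Mem D B v) → C ⊆ D
  pivots-⊆ C D A B rA rB h i i∈ with i ∈ₛ? D
  ... | yes i∈D = i∈D
  ... | no i∉D = ⊥-elim (0≢1 (begin
    0F                          ≡⟨ ∑-zero (λ k → ¬nonzero (no-term k)) ⟨
    (basisV C A i ⊙ B) i        ≡⟨ h (basisV C A i) (extend-mem C A rA (tabulate (δ i))) i i∉D ⟨
    lookup (basisV C A i) i     ≡⟨ trans (basisV-∈ C A i i i∈) (δ-refl i) ⟩
    1F                          ∎))
    where
    no-term : ∀ k → ¬ Nonzero (lookup (basisV C A i) k *F ent B k i)
    no-term k ne with k ∈ₛ? C
    ... | yes k∈ = *-nonzeroˡ ne (trans (basisV-∈ C A i k k∈)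
          (δ-≢ i k (λ { refl → ℕ.<-irrefl refl (proj₂ (proj₂ (rB k i (*-nonzeroʳ ne)))) })))
    ... | no k∉ = ℕ.<-asym (proj₂ (proj₂ (rB k i (*-nonzeroʳ ne))))
          (proj₂ (proj₂ (rA i k (λ eq → *-nonzeroˡ ne (trans (basisV-∉ C A i k k∉) eq)))))

  -- Once the pivots agree, row `i` is read off the only vector of the space that coincides with
  -- `δ i` on them.
  rref-unique : ∀ {n} (C D : Vec Bool n) A B → Reduced C A → Reduced D B →
                (∀ v → Mem C A v → Mem D B v) → (∀ v → Mem D B v → Mem C A v) → C ≡ D × A ≡ B
  rref-unique C D A B rA rB to from with ⊆-antisym {C = C} {D} (pivots-⊆ C D A B rA rB to) (pivots-⊆ D C B A rB rA from)
  ... | refl = refl , mat-ext at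
    where
    at : ∀ i j → ent A i j ≡ ent B i j
    at i j with j ∈ₛ? C
    ... | yes j∈ = trans (¬nonzero (λ ne → proj₁ (proj₂ (rA i j ne)) j∈)) (sym (¬nonzero (λ ne → proj₁ (proj₂ (rB i j ne)) j∈)))
    ... | no j∉ = begin
      ent A i j                  ≡⟨ basisV-∉ C A i j j∉ ⟨
      lookup (basisV C A i) j    ≡⟨ cong (λ v → lookup v j) (mem-determined C B rB (basisV C A i) (basisV C B i) (to (basisV C A i) (extend-mem C A rA (tabulate (δ i)))) (extend-mem C B rB (tabulate (δ i)))
                                      (λ k k∈ → trans (basisV-∈ C A i k k∈) (sym (basisV-∈ C B i k k∈)))) ⟩
      lookup (basisV C B i) j    ≡⟨ basisV-∉ C B i j j∉ ⟩
      ent B i j                  ∎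

  Supp : ∀ {n} → Vec Bool n → Vec F n → Set
  Supp C x = ∀ j → Nonzero (lookup x j) → j ∈ₛ C

  card-Supp : ∀ {n} (C : Vec Bool n) → Card (Supp C) (q ^ size C)
  card-Supp C = subst (Card _) (∏-size C) (card-Vec _ (λ i x → nonzero? x →-dec (i ∈ₛ? C)) c)
    where
    c : ∀ i → Card (λ x → Nonzero x → i ∈ₛ C) (if lookup C i then q else 1)
    c i with lookup C i
    ... | true = card-⇔ (λ _ _ → refl) (λ _ → tt) (card-Fin q)
    ... | false = card-⇔ (λ { refl ne → ⊥-elim (ne refl) }) (λ h → ¬nonzero (λ ne → false⇒∉ refl (h ne))) (card-singleton 0F)
    ∏-size : ∀ {n} (C : Vec Bool n) → ∏ n (λ i → if lookup C i then q else 1) ≡ q ^ size C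
    ∏-size [] = refl
    ∏-size (true ∷ C) = cong (q ℕ.*_) (∏-size C)
    ∏-size (false ∷ C) = trans (ℕ.*-identityˡ _) (∏-size C)

  card-mem : ∀ {n} (C : Vec Bool n) {A} → Reduced C A → Card (Mem C A) (q ^ size C)
  card-mem C {A} r = card-map (extend C A) (λ {x} _ → extend-mem C A r x)
    (λ {v} m → restrict v , restrict-supp v , mem-determined C A r v (extend C A (restrict v)) m (extend-mem C A r (restrict v))
      (λ i i∈ → sym (trans (extend-∈ C A (restrict v) i i∈) (restrict-∈ v i i∈))))
    (λ {x} {y} sx sy eq → vec-ext (λ i → at x y sx sy eq i))
    (card-Supp C)
    where
    restrict : Vec F _ → Vec F _
    restrict v = tabulate (λ j → if lookup C j then lookup v j else 0F)
    restrict-∈ : ∀ v i → i ∈ₛ C → lookup (restrict v) i ≡ lookup v i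
    restrict-∈ v i i∈ = trans (lookup∘tabulate _ i) (cong (λ b → if b then lookup v i else 0F) i∈)
    restrict-supp : ∀ v → Supp C (restrict v)
    restrict-supp v j ne with j ∈ₛ? C
    ... | yes j∈ = j∈
    ... | no j∉ = ⊥-elim (ne (trans (lookup∘tabulate _ j) (cong (λ b → if b then lookup v j else 0F) (∉⇒false j∉))))
    at : ∀ x y → Supp C x → Supp C y → extend C A x ≡ extend C A y → ∀ i → lookup x i ≡ lookup y i
    at x y sx sy eq i with i ∈ₛ? C
    ... | yes i∈ = trans (sym (extend-∈ C A x i i∈)) (trans (cong (λ v → lookup v i) eq) (extend-∈ C A y i i∈))
    ... | no i∉ = trans (¬nonzero (λ ne → i∉ (sx i ne))) (sym (¬nonzero (λ ne → i∉ (sy i ne))))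

  linComb-⊙ : ∀ {m n} (c : Vec F m) (b : Vec (Vec F n) m) j → lookup (linComb c b) j ≡ (c ⊙ b) j
  linComb-⊙ [] [] j = 0V-at j
  linComb-⊙ (c ∷ cs) (b ∷ bs) j = trans (+V-at (c ·V b) (linComb cs bs) j) (cong₂ _+F_ (·V-at c b j) (linComb-⊙ cs bs j))

  linComb-∈ : ∀ {m n} {X : Vec F n → Set} → Sub X → (c : Vec F m) (b : Vec (Vec F n) m) → (∀ i → X (lookup b i)) → X (linComb c b)
  linComb-∈ (x0 , _) [] [] h = x0
  linComb-∈ {X = X} sub@(_ , add , scale) (c ∷ cs) (b ∷ bs) h =
    add _ _ (scale c b (h zero)) (linComb-∈ {X = X} sub cs bs (h ∘ suc))

  linComb-0∷ : ∀ {m n} (c : Vec F m) (b : Vec (Vec F n) m) → linComb c (Vec.map (0F ∷_) b) ≡ 0F ∷ linComb c b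
  linComb-0∷ [] [] = refl
  linComb-0∷ (c ∷ cs) (b ∷ bs) = trans (cong ((c ·V (0F ∷ b)) +V_) (linComb-0∷ cs bs))
    (cong (_∷ ((c ·V b) +V linComb cs bs)) (trans (+F-identityʳ _) (zeroʳ c)))

  -- The elimination of `rref-exists` without reduction: a vector beginning with `1F`, if there is
  -- one, joins a basis of those beginning with `0F`.
  dim-exists : ∀ {n} {X : Vec F n → Set} → Decidable X → Sub X → ∃[ m ] HasDim X m
  dim-exists {zero} X? sub = 0 , [] , (λ ()) , (λ { [] _ → refl }) , (λ { [] _ → [] , refl })
  dim-exists {suc n} {X} X? sub@(x0 , add , scale)
    with dim-exists {n} {λ v → X (0F ∷ v)} (λ v → X? (0F ∷ v))
           (x0 , (λ u v xu xv → subst (λ z → X (z ∷ (u +V v))) (+F-identityˡ 0F) (add _ _ xu xv)) ,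
            (λ a v xv → subst (λ z → X (z ∷ (a ·V v))) (zeroʳ a) (scale a _ xv)))
       | anyVec? (λ w → X? (1F ∷ w))
  ... | m , b , b∈ , indep , span | no no-pivot =
    m , Vec.map (0F ∷_) b , (λ i → subst X (sym (lookup-map i (0F ∷_) b)) (b∈ i)) ,
    (λ c eq → indep c (cong Vec.tail (trans (sym (linComb-0∷ c b)) eq))) , span′
    where
    span′ : ∀ u → X u → ∃[ c ] (u ≡ linComb c (Vec.map (0F ∷_) b))
    span′ (x ∷ v) xv with ¬nonzero {x} (λ ne → no-pivot (inv x ·V v , subst (λ z → X (z ∷ (inv x ·V v))) (inv-*ˡ ne) (scale (inv x) _ xv)))
    ... | refl = let c , eq = span v xv in c , trans (cong (0F ∷_) eq) (sym (linComb-0∷ c b))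
  ... | m , b , b∈ , indep , span | yes (w , xw) =
    suc m , (1F ∷ w) ∷ Vec.map (0F ∷_) b , b∈′ , indep′ , span′
    where
    b∈′ : ∀ i → X (lookup ((1F ∷ w) ∷ Vec.map (0F ∷_) b) i)
    b∈′ zero = xw
    b∈′ (suc i) = subst X (sym (lookup-map i (0F ∷_) b)) (b∈ i)
    comb : ∀ x c → linComb (x ∷ c) ((1F ∷ w) ∷ Vec.map (0F ∷_) b) ≡ x ∷ ((x ·V w) +V linComb c b)
    comb x c = trans (cong ((x ·V (1F ∷ w)) +V_) (linComb-0∷ c b))
      (cong (_∷ ((x ·V w) +V linComb c b)) (trans (+F-identityʳ _) (*F-identityʳ x)))
    indep′ : LinIndep ((1F ∷ w) ∷ Vec.map (0F ∷_) b)
    indep′ (x ∷ c) eq with trans (sym (comb x c)) eq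
    ... | eq′ with ∷-injective eq′
    ...   | refl , eq″ = cong (0F ∷_) (indep c (trans (vec-ext (λ j → sym (trans (+V-at (0F ·V w) (linComb c b) j)
             (trans (cong (_+F lookup (linComb c b) j) (trans (·V-at 0F w j) (zeroˡ _))) (+F-identityˡ _))))) eq″))
    span′ : ∀ u → X u → ∃[ c ] (u ≡ linComb c ((1F ∷ w) ∷ Vec.map (0F ∷_) b))
    span′ (x ∷ v) xv = let c , eq = span (v -V (x ·V w)) x-xw in
      x ∷ c , sym (trans (comb x c) (cong (x ∷_) (vec-ext (λ j → trans (+V-at (x ·V w) (linComb c b) j)
        (trans (cong₂ (λ a e → a +F lookup e j) (·V-at x w j) (sym eq))
        (trans (cong (x *F lookup w j +F_) (trans (-V-at v (x ·V w) j) (cong (λ z → lookup v j -F z) (·V-at x w j))))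
          (y+[x-y]≡x (lookup v j) (x *F lookup w j))))))))
      where
      x-xw : X (0F ∷ (v -V (x ·V w)))
      x-xw = subst (λ z → X (z ∷ (v -V (x ·V w))))
        (trans (cong (x +F_) (trans (-1*x _) (cong -F_ (*F-identityʳ x)))) (x-x≡0 x))
        (sub-− {X = X} sub xv (scale x _ xw))

  _≟V_ : ∀ {n} (u v : Vec F n) → Dec (u ≡ v)
  _≟V_ = ≡-dec Fin._≟_

  card-allVec : ∀ m → Card {Vec F m} (λ _ → ⊤) (q ^ m)
  card-allVec m = card-⇔ (λ _ → tt) (λ _ j _ → lookup-replicate j true)
    (subst (λ k → Card (Supp (full m)) (q ^ k)) (size-full m) (card-Supp (full m)))
    where
    size-full : ∀ m → size (full m) ≡ m
    size-full zero = refl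
    size-full (suc m) = cong suc (size-full m)

  dim⇒card : ∀ {n} {X : Vec F n → Set} {m} → Sub X → HasDim X m → Card X (q ^ m)
  dim⇒card {X = X} {m} sub (b , b∈ , indep , span) = card-map (λ c → linComb c b)
    (λ {c} _ → linComb-∈ {X = X} sub c b b∈)
    (λ {u} xu → let c , eq = span u xu in c , tt , eq)
    (λ {c} {c′} _ _ eq → vec-ext (λ i → x∙y⁻¹≈ε⇒x≈y _ _ (begin
      lookup c i -F lookup c′ i  ≡⟨ -V-at c c′ i ⟨
      lookup (c -V c′) i         ≡⟨ cong (λ v → lookup v i) (indep (c -V c′) (vec-ext (λ j → begin
        lookup (linComb (c -V c′) b) j      ≡⟨ linComb-⊙ (c -V c′) b j ⟩
        ((c -V c′) ⊙ b) j                   ≡⟨ −-⊙ b c c′ j ⟩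
        (c ⊙ b) j -F (c′ ⊙ b) j             ≡⟨ cong (λ z → z -F (c′ ⊙ b) j) (trans (sym (linComb-⊙ c b j)) (trans (cong (λ v → lookup v j) eq) (linComb-⊙ c′ b j))) ⟩
        (c′ ⊙ b) j -F (c′ ⊙ b) j            ≡⟨ x-x≡0 _ ⟩
        0F                                  ≡⟨ 0V-at j ⟨
        lookup zeroV j                      ∎))) ⟩
      lookup (replicate m 0F) i  ≡⟨ lookup-replicate i 0F ⟩
      0F                         ∎)))
    (card-allVec m)

  ^-injective : ∀ {m k} → q ^ m ≡ q ^ k → m ≡ k
  ^-injective {m} {k} eq with ℕ.<-cmp m k
  ... | tri< lt _ _ = ⊥-elim (ℕ.<⇒≢ (ℕ.^-monoʳ-< q 1<q lt) eq)
  ... | tri≈ _ e _ = e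
  ... | tri> _ _ gt = ⊥-elim (ℕ.<⇒≢ (ℕ.^-monoʳ-< q 1<q gt) (sym eq))

  -- Some basis exists, and the cardinality reveals its length; no exchange argument is involved.
  card⇒dim : ∀ {n} {X : Vec F n → Set} {m} → Sub X → Card X (q ^ m) → HasDim X m
  card⇒dim {X = X} sub c = let k , h = dim-exists {X = X} (card-dec _≟V_ c) sub in
    subst (HasDim X) (^-injective (card-unique (dim⇒card {X = X} sub h) c)) h

-- Krylov sums

module Krylov {q : ℕ} (𝔽 : FieldOn q) {n : ℕ} (d : Vec (Fin q) n) where

  open Field 𝔽
  open Spaces 𝔽

  Δ : Vec F n → Vec F n
  Δ = diagApply d

  Δ-at : ∀ v i → lookup (Δ v) i ≡ lookup d i *F lookup v i
  Δ-at v i = lookup-zipWith _*F_ i d v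

  Δ-zero : Δ zeroV ≡ zeroV
  Δ-zero = vec-ext (λ i → trans (Δ-at zeroV i) (trans (cong (lookup d i *F_) (0V-at i)) (trans (zeroʳ _) (sym (0V-at i)))))

  Δ-+ : ∀ u v → Δ (u +V v) ≡ Δ u +V Δ v
  Δ-+ u v = vec-ext (λ i → begin
    lookup (Δ (u +V v)) i                                      ≡⟨ Δ-at (u +V v) i ⟩
    lookup d i *F lookup (u +V v) i                            ≡⟨ cong (lookup d i *F_) (+V-at u v i) ⟩
    lookup d i *F (lookup u i +F lookup v i)                   ≡⟨ distribˡ _ _ _ ⟩
    lookup d i *F lookup u i +F lookup d i *F lookup v i       ≡⟨ cong₂ _+F_ (Δ-at u i) (Δ-at v i) ⟨
    lookup (Δ u) i +F lookup (Δ v) i                           ≡⟨ +V-at (Δ u) (Δ v) i ⟨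
    lookup (Δ u +V Δ v) i                                      ∎)

  Δ-· : ∀ a v → Δ (a ·V v) ≡ a ·V Δ v
  Δ-· a v = vec-ext (λ i → begin
    lookup (Δ (a ·V v)) i                  ≡⟨ trans (Δ-at (a ·V v) i) (cong (lookup d i *F_) (·V-at a v i)) ⟩
    lookup d i *F (a *F lookup v i)        ≡⟨ solve 3 (λ x a v → x :* (a :* v) := a :* (x :* v)) refl (lookup d i) a (lookup v i) ⟩
    a *F (lookup d i *F lookup v i)        ≡⟨ cong (a *F_) (Δ-at v i) ⟨
    a *F lookup (Δ v) i                    ≡⟨ ·V-at a (Δ v) i ⟨
    lookup (a ·V Δ v) i                    ∎)

  +V-assoc : ∀ (u v w : Vec F n) → (u +V v) +V w ≡ u +V (v +V w)
  +V-assoc = zipWith-assoc +F-assoc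

  +V-comm : ∀ (u v : Vec F n) → u +V v ≡ v +V u
  +V-comm = zipWith-comm +F-comm

  +V-identityˡ : ∀ (u : Vec F n) → zeroV +V u ≡ u
  +V-identityˡ = zipWith-identityˡ +F-identityˡ

  +V-identityʳ : ∀ (u : Vec F n) → u +V zeroV ≡ u
  +V-identityʳ = zipWith-identityʳ +F-identityʳ

  +V-interchange : ∀ (u v x y : Vec F n) → (u +V v) +V (x +V y) ≡ (u +V x) +V (v +V y)
  +V-interchange u v x y = begin
    (u +V v) +V (x +V y)   ≡⟨ +V-assoc u v (x +V y) ⟩
    u +V (v +V (x +V y))   ≡⟨ cong (u +V_) (+V-assoc v x y) ⟨
    u +V ((v +V x) +V y)   ≡⟨ cong (λ z → u +V (z +V y)) (+V-comm v x) ⟩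
    u +V ((x +V v) +V y)   ≡⟨ cong (u +V_) (+V-assoc x v y) ⟩
    u +V (x +V (v +V y))   ≡⟨ +V-assoc u x (v +V y) ⟨
    (u +V x) +V (v +V y)   ∎

  −V-+V : ∀ (u v : Vec F n) → (u -V v) +V v ≡ u
  −V-+V u v = trans (+V-comm (u -V v) v) (vec-ext (λ i → trans (+V-at v (u -V v) i)
    (trans (cong (lookup v i +F_) (-V-at u v i)) (y+[x-y]≡x (lookup u i) (lookup v i)))))

  ·V-+V : ∀ a (u v : Vec F n) → a ·V (u +V v) ≡ (a ·V u) +V (a ·V v)
  ·V-+V a u v = vec-ext (λ i → begin
    lookup (a ·V (u +V v)) i                 ≡⟨ trans (·V-at a (u +V v) i) (cong (a *F_) (+V-at u v i)) ⟩
    a *F (lookup u i +F lookup v i)          ≡⟨ distribˡ _ _ _ ⟩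
    a *F lookup u i +F a *F lookup v i       ≡⟨ cong₂ _+F_ (·V-at a u i) (·V-at a v i) ⟨
    lookup (a ·V u) i +F lookup (a ·V v) i   ≡⟨ +V-at (a ·V u) (a ·V v) i ⟨
    lookup ((a ·V u) +V (a ·V v)) i          ∎)

  ·V-zero : ∀ a → a ·V zeroV {n} ≡ zeroV
  ·V-zero a = vec-ext (λ i → trans (·V-at a zeroV i) (trans (cong (a *F_) (0V-at i)) (trans (zeroʳ a) (sym (0V-at i)))))

  InW : (Vec F n → Bool) → Vec F n → Set
  InW W v = W v ≡ true

  K : (Vec F n → Bool) → ℕ → Vec F n → Set
  K = KrylovSum d

  krylovVec : ∀ {j} → Vec (Vec F n) j → Vec F n
  krylovVec ws = sumV (Vec.map (λ i → diagPow d (toℕ i) (lookup ws i)) (Vec.allFin _))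

  sumV-Δ : ∀ {j} (f : Fin j → Vec F n) → sumV (tabulate (Δ ∘ f)) ≡ Δ (sumV (tabulate f))
  sumV-Δ {zero} f = sym Δ-zero
  sumV-Δ {suc j} f = trans (cong (Δ (f zero) +V_) (sumV-Δ (f ∘ suc))) (sym (Δ-+ (f zero) (sumV (tabulate (f ∘ suc)))))

  -- Horner's rule for the powers of Δ. It gives K_{j+1}(W) = W + Δ K_j(W), the form in which Krylov
  -- sums are used from here on.
  krylovVec-∷ : ∀ {j} w (ws : Vec (Vec F n) j) → krylovVec (w ∷ ws) ≡ w +V Δ (krylovVec ws)
  krylovVec-∷ {j} w ws = cong (w +V_) (begin
    sumV (Vec.map (λ i → diagPow d (toℕ i) (lookup (w ∷ ws) i)) (tabulate suc))  ≡⟨ cong sumV (tabulate-∘ (λ i → diagPow d (toℕ i) (lookup (w ∷ ws) i)) Fin.suc) ⟨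
    sumV (tabulate (λ i → Δ (diagPow d (toℕ i) (lookup ws i))))                ≡⟨ sumV-Δ (λ i → diagPow d (toℕ i) (lookup ws i)) ⟩
    Δ (sumV (tabulate (λ i → diagPow d (toℕ i) (lookup ws i))))                ≡⟨ cong (Δ ∘ sumV) (tabulate-∘ (λ i → diagPow d (toℕ i) (lookup ws i)) id) ⟩
    Δ (krylovVec ws)                                                           ∎)

  K-zero : ∀ {W v} → K W 0 v → v ≡ zeroV
  K-zero ([] , _ , eq) = eq

  K-suc⁻ : ∀ {W j v} → K W (suc j) v → ∃[ w ] ∃[ u ] (InW W w × K W j u × v ≡ w +V Δ u)
  K-suc⁻ (w ∷ ws , h , eq) = w , krylovVec ws , h zero , (ws , h ∘ suc , refl) , trans eq (krylovVec-∷ w ws)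

  K-suc⁺ : ∀ {W j w u} → InW W w → K W j u → K W (suc j) (w +V Δ u)
  K-suc⁺ {w = w} hw (ws , h , eq) = w ∷ ws , (λ { zero → hw ; (suc i) → h i }) ,
    trans (cong (λ z → w +V Δ z) eq) (sym (krylovVec-∷ w ws))

  K-zero⁺ : ∀ {W} → K W 0 zeroV
  K-zero⁺ = [] , (λ ()) , refl

  K-sub : ∀ {W} → Sub (InW W) → ∀ j → Sub (K W j)
  K-sub {W} sub zero = K-zero⁺ {W} ,
    (λ u v ku kv → subst (K W 0) (sym (trans (cong₂ _+V_ (K-zero {W} ku) (K-zero {W} kv)) (+V-identityˡ zeroV))) (K-zero⁺ {W})) ,
    (λ a v kv → subst (K W 0) (sym (trans (cong (a ·V_) (K-zero {W} kv)) (·V-zero a))) (K-zero⁺ {W}))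
  K-sub {W} sub@(w0 , add , scale) (suc j) with K-sub {W} sub j
  ... | k0 , kadd , kscale =
    subst (K W (suc j)) (trans (cong (zeroV +V_) Δ-zero) (+V-identityˡ zeroV)) (K-suc⁺ {W} w0 k0) ,
    (λ u v ku kv → let w₁ , u₁ , hw₁ , hu₁ , eq₁ = K-suc⁻ {W} ku
                       w₂ , u₂ , hw₂ , hu₂ , eq₂ = K-suc⁻ {W} kv in
      subst (K W (suc j)) (sym (trans (cong₂ _+V_ eq₁ eq₂) (trans (+V-interchange w₁ (Δ u₁) w₂ (Δ u₂)) (cong ((w₁ +V w₂) +V_) (sym (Δ-+ u₁ u₂))))))
        (K-suc⁺ {W} (add w₁ w₂ hw₁ hw₂) (kadd u₁ u₂ hu₁ hu₂))) ,
    (λ a v kv → let w₁ , u₁ , hw₁ , hu₁ , eq₁ = K-suc⁻ {W} kv in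
      subst (K W (suc j)) (sym (trans (cong (a ·V_) eq₁) (trans (·V-+V a w₁ (Δ u₁)) (cong ((a ·V w₁) +V_) (sym (Δ-· a u₁))))))
        (K-suc⁺ {W} (scale a w₁ hw₁) (kscale a u₁ hu₁)))

  K-one⁺ : ∀ {W v} → InW W v → K W 1 v
  K-one⁺ {W} {v} h = subst (K W 1) (trans (cong (v +V_) Δ-zero) (+V-identityʳ v)) (K-suc⁺ {W} h (K-zero⁺ {W}))

  K-one⁻ : ∀ {W v} → K W 1 v → InW W v
  K-one⁻ {W} k with K-suc⁻ {W} k
  ... | w , u , hw , hu , refl with K-zero {W} hu
  ... | refl = subst (InW W) (sym (trans (cong (w +V_) Δ-zero) (+V-identityʳ w))) hw

  Vanishes : Vec Bool n → Vec F n → Set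
  Vanishes C v = ∀ i → i ∈ₛ C → lookup v i ≡ 0F

  Profile : (Vec F n → Bool) → List ℕ → Set
  Profile W μ = HasPartialProfile d W μ

  -- A diagonal matrix maps every coordinate subspace into itself.
  K-vanishes : ∀ {U C} → (∀ {u} → InW U u → Vanishes C u) → ∀ j {u} → K U j u → Vanishes C u
  K-vanishes {U} {C} h zero k i i∈ = trans (cong (λ v → lookup v i) (K-zero {U} k)) (0V-at i)
  K-vanishes {U} {C} h (suc j) k i i∈ with K-suc⁻ {U} k
  ... | w , u , hw , hu , refl = trans (+V-at w (Δ u) i) (trans (cong₂ _+F_ (h hw i i∈)
    (trans (Δ-at u i) (trans (cong (lookup d i *F_) (K-vanishes {U} {C} h j hu i i∈)) (zeroʳ _)))) (+F-identityˡ 0F))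

  -- Passing from W to a complement U of W in W + ΔW shifts the Krylov sums:
  -- K_{j+1}(W) = W ⊕ K_j(U).
  module Shift (W U : Vec F n → Bool) (subW : Sub (InW W)) (subU : Sub (InW U)) (C : Vec Bool n)
    (U-vanishes : ∀ {u} → InW U u → Vanishes C u)
    (W-meets : ∀ {w} → InW W w → Vanishes C w → w ≡ zeroV)
    (split : ∀ {w} → InW W w → ∃[ w′ ] ∃[ u ] (InW W w′ × InW U u × Δ w ≡ w′ +V u))
    (cover : ∀ {u} → InW U u → ∃[ w ] ∃[ w′ ] (InW W w × InW W w′ × u +V w′ ≡ Δ w)) where

    shift⁻ : ∀ j {v} → K W (suc j) v → ∃[ w ] ∃[ u ] (InW W w × K U j u × v ≡ w +V u)
    shift⁻ zero {v} k = v , zeroV , K-one⁻ {W} k , K-zero⁺ {U} , sym (+V-identityʳ v)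
    shift⁻ (suc j) k with K-suc⁻ {W} k
    ... | w , v₁ , hw , k₁ , refl with shift⁻ j k₁
    ... | w₁ , u₁ , hw₁ , hu₁ , refl with split hw₁
    ... | w₂ , u₂ , hw₂ , hu₂ , eq = w +V w₂ , u₂ +V Δ u₁ , proj₁ (proj₂ subW) w w₂ hw hw₂ , K-suc⁺ {U} hu₂ hu₁ , (begin
      w +V Δ (w₁ +V u₁)            ≡⟨ cong (w +V_) (Δ-+ w₁ u₁) ⟩
      w +V (Δ w₁ +V Δ u₁)          ≡⟨ cong (λ z → w +V (z +V Δ u₁)) eq ⟩
      w +V ((w₂ +V u₂) +V Δ u₁)    ≡⟨ cong (w +V_) (+V-assoc w₂ u₂ (Δ u₁)) ⟩
      w +V (w₂ +V (u₂ +V Δ u₁))    ≡⟨ +V-assoc w w₂ (u₂ +V Δ u₁) ⟨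
      (w +V w₂) +V (u₂ +V Δ u₁)    ∎)

    -- By `cover` a leading term `u₀` of `U` is `Δ w₁ -V w₂`; then `w₂` is absorbed by `w`, and `w₁`
    -- joins `u₁` under Δ.
    shift⁺ : ∀ j {w u} → InW W w → K U j u → K W (suc j) (w +V u)
    shift⁺ zero {w} {u} hw ku = subst (K W 1) (sym (trans (cong (w +V_) (K-zero {U} ku)) (+V-identityʳ w))) (K-one⁺ {W} hw)
    shift⁺ (suc j) {w} hw ku with K-suc⁻ {U} ku
    ... | u₀ , u₁ , hu₀ , hu₁ , refl with cover hu₀
    ... | w₁ , w₂ , hw₁ , hw₂ , eq = subst (K W (suc (suc j))) (begin
      (w -V w₂) +V Δ (w₁ +V u₁)             ≡⟨ cong ((w -V w₂) +V_) (Δ-+ w₁ u₁) ⟩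
      (w -V w₂) +V (Δ w₁ +V Δ u₁)           ≡⟨ cong (λ z → (w -V w₂) +V (z +V Δ u₁)) (trans (sym eq) (+V-comm u₀ w₂)) ⟩
      (w -V w₂) +V ((w₂ +V u₀) +V Δ u₁)     ≡⟨ cong ((w -V w₂) +V_) (+V-assoc w₂ u₀ (Δ u₁)) ⟩
      (w -V w₂) +V (w₂ +V (u₀ +V Δ u₁))     ≡⟨ +V-assoc (w -V w₂) w₂ (u₀ +V Δ u₁) ⟨
      ((w -V w₂) +V w₂) +V (u₀ +V Δ u₁)     ≡⟨ cong (_+V (u₀ +V Δ u₁)) (−V-+V w w₂) ⟩
      w +V (u₀ +V Δ u₁)                     ∎)
      (K-suc⁺ {W} (sub-− {X = InW W} subW hw hw₂) (shift⁺ j hw₁ hu₁))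

    vanishes⇒≡ : ∀ j {w u w′ u′} → InW W w → K U j u → InW W w′ → K U j u′ → w +V u ≡ w′ +V u′ → w ≡ w′
    vanishes⇒≡ j {w} {u} {w′} {u′} hw hu hw′ hu′ eq = vec-ext (λ i → x∙y⁻¹≈ε⇒x≈y _ _
      (trans (sym (-V-at w w′ i)) (trans (cong (λ v → lookup v i) (W-meets (sub-− {X = InW W} subW hw hw′) van)) (0V-at i))))
      where
      van : Vanishes C (w -V w′)
      van i i∈ = begin
        lookup (w -V w′) i                      ≡⟨ -V-at w w′ i ⟩
        lookup w i -F lookup w′ i               ≡⟨ cong₂ _-F_ (part w u hu) (part w′ u′ hu′) ⟨
        lookup (w +V u) i -F lookup (w′ +V u′) i ≡⟨ cong (λ v → lookup (w +V u) i -F lookup v i) eq ⟨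
        lookup (w +V u) i -F lookup (w +V u) i  ≡⟨ x-x≡0 _ ⟩
        0F                                      ∎
        where
        part : ∀ x y → K U j y → lookup (x +V y) i ≡ lookup x i
        part x y hy = trans (+V-at x y i) (trans (cong (lookup x i +F_) (K-vanishes {U} {C} U-vanishes j hy i i∈)) (+F-identityʳ _))

    cancel-vanishing : ∀ {w u} → InW W w → Vanishes C u → Vanishes C (w +V u) → w +V u ≡ u
    cancel-vanishing {w} {u} hw hu hv = trans (cong (_+V u) (W-meets hw (λ i i∈ →
      trans (sym (trans (+V-at w u i) (trans (cong (lookup w i +F_) (hu i i∈)) (+F-identityʳ _)))) (hv i i∈)))) (+V-identityˡ u)

    module _ {m : ℕ} (cardW : Card (InW W) (q ^ m)) where

      card-sum : ∀ j {N} → Card (K U j) N → Card (K W (suc j)) (q ^ m ℕ.* N)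
      card-sum j c = card-⇔
        (λ { (w , hw , u , hu , refl) → shift⁺ j hw hu })
        (λ k → let w , u , hw , hu , eq = shift⁻ j k in w , hw , u , hu , eq)
        (card-× {Q = λ w v → ∃[ u ] (K U j u × v ≡ w +V u)} cardW
          (λ w hw → card-map (w +V_) (λ {u} hu → u , hu , refl) (λ q → q)
            (λ {x} {y} _ _ eq → vec-ext (λ i → +F-cancelˡ (lookup w i) _ _
              (trans (sym (+V-at w x i)) (trans (cong (λ v → lookup v i) eq) (+V-at w y i))))) c)
          (card-dec _≟V_ cardW)
          (λ { hw hw′ (u , hu , refl) (u′ , hu′ , eq) → vanishes⇒≡ j hw hu hw′ hu′ eq }))

      vanishes? : Decidable (Vanishes C)
      vanishes? v = Fin.all? (λ i → (i ∈ₛ? C) →-dec (lookup v i Fin.≟ 0F))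

      -- K_j(U) sits in K_{j+1}(W) as the vectors vanishing on `C`. Filtering therefore enumerates
      -- it, and `card-sum` yields its size after cancelling `q ^ m`.
      card-rest : ∀ j {s} → Card (K W (suc j)) (q ^ (m ℕ.+ s)) → Card (K U j) (q ^ s)
      card-rest j {s} c@(xs , e , _) = subst (Card (K U j)) N≡ cU
        where
        cU : Card (K U j) (length (filter vanishes? xs))
        cU = filter vanishes? xs , enum-⇔
          (λ { {v} (k , van) → let w , u , hw , hu , eq = shift⁻ j k in
            subst (K U j) (sym (trans eq (cancel-vanishing hw (K-vanishes {U} {C} U-vanishes j hu) (subst (Vanishes C) eq van)))) hu })
          (λ {v} k → subst (K W (suc j)) (+V-identityˡ v) (shift⁺ j (proj₁ subW) k) , K-vanishes {U} {C} U-vanishes j k)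
          (enum-filter vanishes? e) , refl
        N≡ : length (filter vanishes? xs) ≡ q ^ s
        N≡ = ℕ.*-cancelˡ-≡ _ _ (q ^ m) {{ℕ.m^n≢0 q m {{ℕ.>-nonZero (ℕ.<-trans (s≤s z≤n) 1<q)}}}}
          (trans (card-unique (card-sum j cU) c) (ℕ.^-distribˡ-+-* q m s))

      profile-shift⁺ : ∀ μ → Profile U μ → Profile W (m ∷ μ)
      profile-shift⁺ μ h (suc zero) _ _ = card⇒dim {X = K W 1} (K-sub {W} subW 1)
        (subst (λ k → Card (K W 1) (q ^ k)) (sym (ℕ.+-identityʳ m)) (card-⇔ (K-one⁺ {W}) (K-one⁻ {W}) cardW))
      profile-shift⁺ μ h (suc (suc j)) _ (s≤s j≤) = card⇒dim {X = K W (suc (suc j))} (K-sub {W} subW (suc (suc j)))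
        (subst (Card (K W (suc (suc j)))) (sym (ℕ.^-distribˡ-+-* q m (sum (take (suc j) μ))))
          (card-sum (suc j) (dim⇒card {X = K U (suc j)} (K-sub {U} subU (suc j)) (h (suc j) (s≤s z≤n) j≤))))

      profile-shift⁻ : ∀ μ → Profile W (m ∷ μ) → Profile U μ
      profile-shift⁻ μ h (suc j) 1≤ j≤ = card⇒dim {X = K U (suc j)} (K-sub {U} subU (suc j))
        (card-rest (suc j) (dim⇒card {X = K W (suc (suc j))} (K-sub {W} subW (suc (suc j))) (h (suc (suc j)) (s≤s z≤n) (s≤s j≤))))

-- Counting echelon matrices and staircase matrices of full rank

elems-filter : ∀ {n} (p : ℕ → Bool) (C D : Vec Bool n) →
               (∀ i → i ∈ₛ D → i ∈ₛ C × p (suc (toℕ i)) ≡ true) →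
               (∀ i → i ∈ₛ C → p (suc (toℕ i)) ≡ true → i ∈ₛ D) →
               elems D ≡ filterB p (elems C)
elems-filter p C D to from = sorted-ext (elems-sorted D) (filterB-AllPairs p (elems-sorted C))
  (λ z∈ → let i , i∈ , eq = ∈-elems⁻ D z∈
              a , b = to i i∈ in
    subst (_∈ filterB p (elems C)) (sym eq) (∈-filterB⁺ p (∈-elems⁺ C i a) b))
  (λ z∈ → let a , b = ∈-filterB⁻ p (elems C) z∈
              i , i∈ , eq = ∈-elems⁻ C a in
    subst (_∈ elems D) (sym eq) (∈-elems⁺ D i (from i i∈ (subst (λ z → p z ≡ true) eq b))))

length-filterB : ∀ {A : Set} (p : A → Bool) xs → length (filterB p xs) ≡ count p xs
length-filterB p [] = refl
length-filterB p (x ∷ xs) with p x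
... | true = cong suc (length-filterB p xs)
... | false = length-filterB p xs

size-filter : ∀ {n} (p : ℕ → Bool) (C D : Vec Bool n) →
              (∀ i → i ∈ₛ D → i ∈ₛ C × p (suc (toℕ i)) ≡ true) →
              (∀ i → i ∈ₛ C → p (suc (toℕ i)) ≡ true → i ∈ₛ D) →
              size D ≡ count p (elems C)
size-filter p C D to from = trans (sym (length-elemsFrom 0 D))
  (trans (cong length (elems-filter p C D to from)) (length-filterB p (elems C)))

size-empty : ∀ {n} (D : Vec Bool n) → (∀ i → ¬ (i ∈ₛ D)) → size D ≡ 0
size-empty [] h = refl
size-empty (true ∷ D) h = ⊥-elim (h zero refl)
size-empty (false ∷ D) h = size-empty D (h ∘ suc)

size-insert : ∀ {n} (D E : Vec Bool n) k → k ∈ₛ E → ¬ (k ∈ₛ D) → (∀ j → j ≢ k → lookup D j ≡ lookup E j) →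
              size E ≡ suc (size D)
size-insert (true ∷ D) (true ∷ E) zero k∈ k∉ h = ⊥-elim (k∉ refl)
size-insert (false ∷ D) (true ∷ E) zero k∈ k∉ h = cong (λ G → suc (size G)) (vec-ext {u = E} {D} (λ j → sym (h (suc j) (λ ()))))
size-insert (b ∷ D) (c ∷ E) (suc k) k∈ k∉ h with h zero (λ ())
... | refl = trans (cong ((if b then 1 else 0) ℕ.+_) (size-insert D E k k∈ k∉ (λ j ne → h (suc j) (ne ∘ Fin.suc-injective))))
                   (ℕ.+-suc (if b then 1 else 0) (size D))

below : ∀ {n} → ℕ → Vec Bool n → Vec Bool n
below k D = tabulate (λ j → lookup D j ∧ (toℕ j <ᵇ k))

below⁺ : ∀ {n} k (D : Vec Bool n) j → j ∈ₛ D → toℕ j < k → j ∈ₛ below k D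
below⁺ k D j j∈ lt = trans (lookup∘tabulate _ j) (∧-intro j∈ (<ᵇ-complete lt))

below⁻ : ∀ {n} k (D : Vec Bool n) j → j ∈ₛ below k D → j ∈ₛ D × toℕ j < k
below⁻ k D j h = let a , b = ∧-true (trans (sym (lookup∘tabulate _ j)) h) in a , <ᵇ-sound _ _ b

-- Entries are numbered from 1, so coordinates below `k` are entries below `suc k`.
size-below : ∀ {n} k (C : Vec Bool n) → size (below k C) ≡ count (_<ᵇ suc k) (elems C)
size-below k C = size-filter (_<ᵇ suc k) C (below k C)
  (λ i i∈ → let a , b = below⁻ k C i i∈ in a , <ᵇ-complete b)
  (λ i i∈ h → below⁺ k C i i∈ (<ᵇ-sound (toℕ i) k h))

module Counts {q : ℕ} (𝔽 : FieldOn q) {n : ℕ} where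

  open Field 𝔽
  open Spaces 𝔽

  supp? : ∀ (C : Vec Bool n) → Decidable (Supp C)
  supp? C v = Fin.all? (λ j → nonzero? (lookup v j) →-dec (j ∈ₛ? C))

  -- The positions where row `i` of a matrix in `RREF S C` may be nonzero; the rows are chosen
  -- independently.
  rowSet : Vec Bool n → Vec Bool n → Fin n → Vec Bool n
  rowSet S C i = tabulate (λ j → lookup C i ∧ (lookup (S ─ C) j ∧ (toℕ i <ᵇ toℕ j)))

  rowSet⁺ : ∀ S C i j → i ∈ₛ C → j ∈ₛ S ─ C → i Fin.< j → j ∈ₛ rowSet S C i
  rowSet⁺ S C i j i∈ j∈ lt = trans (lookup∘tabulate _ j) (∧-intro i∈ (∧-intro j∈ (<ᵇ-complete lt)))

  rowSet⁻ : ∀ S C i j → j ∈ₛ rowSet S C i → i ∈ₛ C × j ∈ₛ S ─ C × i Fin.< j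
  rowSet⁻ S C i j h = let a , b = ∧-true (trans (sym (lookup∘tabulate _ j)) h)
                          c , e = ∧-true b in a , c , <ᵇ-sound _ _ e

  card-RREF : ∀ (S C : Vec Bool n) → Card (RREF S C) (q ^ β (elems C) (elems (S ─ C)))
  card-RREF S C = card-⇔
    (λ h i j ne → rowSet⁻ S C i j (h i j ne))
    (λ r i j ne → let a , b , c = r i j ne in rowSet⁺ S C i j a b c)
    (subst (Card _) (trans (∏-cong n (λ i → cong (q ^_) (size-rowSet i))) (∏-elems 0 C))
      (card-Vec n (λ i → supp? (rowSet S C i)) (λ i → card-Supp (rowSet S C i))))
    where
    f : ℕ → ℕ
    f c = count (λ c′ → c <ᵇ c′) (elems (S ─ C))
    size-rowSet : ∀ i → size (rowSet S C i) ≡ (if lookup C i then f (suc (toℕ i)) else 0)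
    size-rowSet i with i ∈ₛ? C
    ... | yes i∈ = trans
      (size-filter (suc (toℕ i) <ᵇ_) (S ─ C) (rowSet S C i)
        (λ j h → let _ , b , c = rowSet⁻ S C i j h in b , <ᵇ-complete (s≤s c))
        (λ j j∈ h → rowSet⁺ S C i j i∈ j∈ (<ᵇ-sound (toℕ i) (toℕ j) h)))
      (cong (λ b → if b then f (suc (toℕ i)) else 0) (sym i∈))
    ... | no i∉ = trans (size-empty (rowSet S C i) (λ j h → i∉ (proj₁ (rowSet⁻ S C i j h))))
      (cong (λ b → if b then f (suc (toℕ i)) else 0) (sym (∉⇒false i∉)))
    -- Off `C` the exponent is 0, so the product over all coordinates collapses to a sum of
    -- exponents over the elements of `C`, which is `β`. The offset `k` serves the induction on
    -- suffixes.
    ∏-elems : ∀ {m} k (C : Vec Bool m) →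
              ∏ m (λ i → q ^ (if lookup C i then f (suc (k ℕ.+ toℕ i)) else 0)) ≡ q ^ sum (map f (elemsFrom k C))
    ∏-tail : ∀ {m} k (C : Vec Bool m) →
              ∏ m (λ i → q ^ (if lookup C i then f (suc (k ℕ.+ suc (toℕ i))) else 0)) ≡ q ^ sum (map f (elemsFrom (suc k) C))
    ∏-tail {m} k C = trans (∏-cong m (λ i → cong (λ e → q ^ (if lookup C i then f (suc e) else 0)) (ℕ.+-suc k (toℕ i)))) (∏-elems (suc k) C)
    ∏-elems k [] = refl
    ∏-elems k (true ∷ C) = trans (cong₂ ℕ._*_ (cong (λ e → q ^ f (suc e)) (ℕ.+-identityʳ k)) (∏-tail k C))
      (sym (ℕ.^-distribˡ-+-* q (f (suc k)) _))
    ∏-elems k (false ∷ C) = trans (ℕ.*-identityˡ _) (∏-tail k C)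

  -- N is the transpose of the C × D matrix of coordinates of the rows of
  -- comm A in the reduced echelon basis, indexed by D, of their span.
  Stair : Vec Bool n → Vec Bool n → Mat n → Set
  Stair C D N = (∀ j i → Nonzero (ent N j i) → i ∈ₛ C × j ∈ₛ D × i Fin.< j)
              × (∀ y → Supp D y → linComb y N ≡ zeroV {n} → y ≡ zeroV {n})

  RowSpan : Vec Bool n → Mat n → Vec F n → Set
  RowSpan D N v = ∃[ y ] (Supp D y × v ≡ linComb y N)

  lookup-≔-same : ∀ {A : Set} (u : Vec A n) k x → lookup (u [ k ]≔ x) k ≡ x
  lookup-≔-same u k x = lookup∘updateAt k u

  lookup-≔-other : ∀ {A : Set} (u : Vec A n) k x j → j ≢ k → lookup (u [ k ]≔ x) j ≡ lookup u j
  lookup-≔-other u k x j ne = lookup∘updateAt′ j k ne u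

  linComb-≔ : ∀ (y : Vec F n) (N : Mat n) k (v : Vec F n) j →
              lookup (linComb y (N [ k ]≔ v)) j ≡ lookup (linComb (y [ k ]≔ 0F) N) j +F lookup y k *F lookup v j
  linComb-≔ y N k v j = begin
    lookup (linComb y (N [ k ]≔ v)) j          ≡⟨ linComb-⊙ y (N [ k ]≔ v) j ⟩
    ∑ (λ i → lookup y i *F ent (N [ k ]≔ v) i j) ≡⟨ ∑-cong term ⟩
    ∑ (λ i → lookup (y [ k ]≔ 0F) i *F ent N i j +F δ k i *F (lookup y k *F lookup v j))
      ≡⟨ ∑-distrib-+ (λ i → lookup (y [ k ]≔ 0F) i *F ent N i j) (λ i → δ k i *F (lookup y k *F lookup v j)) ⟩
    ((y [ k ]≔ 0F) ⊙ N) j +F ∑ (λ i → δ k i *F (lookup y k *F lookup v j))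
      ≡⟨ cong₂ _+F_ (sym (linComb-⊙ (y [ k ]≔ 0F) N j))
           (trans (∑-single k (λ i ne → trans (cong (_*F (lookup y k *F lookup v j)) (δ-≢ k i (ne ∘ sym))) (zeroˡ _)))
                  (trans (cong (_*F (lookup y k *F lookup v j)) (δ-refl k)) (*F-identityˡ _))) ⟩
    lookup (linComb (y [ k ]≔ 0F) N) j +F lookup y k *F lookup v j ∎
    where
    term : ∀ i → lookup y i *F ent (N [ k ]≔ v) i j
               ≡ lookup (y [ k ]≔ 0F) i *F ent N i j +F δ k i *F (lookup y k *F lookup v j)
    term i with i Fin.≟ k
    ... | yes refl = begin
      lookup y i *F ent (N [ i ]≔ v) i j         ≡⟨ cong (λ r → lookup y i *F lookup r j) (lookup-≔-same N i v) ⟩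
      lookup y i *F lookup v j                   ≡⟨ trans (cong (_*F (lookup y i *F lookup v j)) (δ-refl i)) (*F-identityˡ _) ⟨
      δ i i *F (lookup y i *F lookup v j)        ≡⟨ trans (cong (_+F (δ i i *F (lookup y i *F lookup v j)))
                                                      (trans (cong (_*F ent N i j) (lookup-≔-same y i 0F)) (zeroˡ _))) (+F-identityˡ _) ⟨
      lookup (y [ i ]≔ 0F) i *F ent N i j +F δ i i *F (lookup y i *F lookup v j) ∎
    ... | no ne = begin
      lookup y i *F ent (N [ k ]≔ v) i j         ≡⟨ cong₂ (λ a r → a *F lookup r j) (sym (lookup-≔-other y k 0F i ne)) (lookup-≔-other N k v i ne) ⟩
      lookup (y [ k ]≔ 0F) i *F ent N i j        ≡⟨ +F-identityʳ _ ⟨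
      lookup (y [ k ]≔ 0F) i *F ent N i j +F 0F  ≡⟨ cong (lookup (y [ k ]≔ 0F) i *F ent N i j +F_)
                                                    (trans (cong (_*F (lookup y k *F lookup v j)) (δ-≢ k i (ne ∘ sym))) (zeroˡ _)) ⟨
      lookup (y [ k ]≔ 0F) i *F ent N i j +F δ k i *F (lookup y k *F lookup v j) ∎

  supp-at : ∀ (D : Vec Bool n) y → Supp D y → ∀ j → ¬ (j ∈ₛ D) → lookup y j ≡ 0F
  supp-at D y s j j∉ = ¬nonzero (λ ne → j∉ (s j ne))

  ≔-id : ∀ (y : Vec F n) k {x} → lookup y k ≡ x → y [ k ]≔ x ≡ y
  ≔-id y k {x} eq = vec-ext at
    where
    at : ∀ j → lookup (y [ k ]≔ x) j ≡ lookup y j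
    at j with j Fin.≟ k
    ... | yes refl = trans (lookup-≔-same y j x) (sym eq)
    ... | no ne = lookup-≔-other y k x j ne

  ≔-≔ : ∀ {A : Set} (y : Vec A n) k x z → lookup y k ≡ z → (y [ k ]≔ x) [ k ]≔ z ≡ y
  ≔-≔ y k x z eq = vec-ext at
    where
    at : ∀ j → lookup ((y [ k ]≔ x) [ k ]≔ z) j ≡ lookup y j
    at j with j Fin.≟ k
    ... | yes refl = trans (lookup-≔-same (y [ j ]≔ x) j z) (sym eq)
    ... | no ne = trans (lookup-≔-other (y [ k ]≔ x) k z j ne) (lookup-≔-other y k x j ne)

  -- `E` is `D` with `k` adjoined as its last element, and `Ck` is the part of `C` before `k`. Row
  -- `k` may be any vector supported on `Ck` outside the span of the earlier rows; that span lies in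
  -- `Supp Ck` since `D` comes before `k`, whence the difference of powers.
  module StairStep (C Ck D E : Vec Bool n) (k : Fin n)
    (Ck⁺ : ∀ i → i ∈ₛ C → i Fin.< k → i ∈ₛ Ck) (Ck⁻ : ∀ i → i ∈ₛ Ck → i ∈ₛ C × i Fin.< k)
    (D<k : ∀ j → j ∈ₛ D → j Fin.< k) (D⊆E : D ⊆ E) (k∈E : k ∈ₛ E) (E⊆D∪k : ∀ j → j ∈ₛ E → j ≢ k → j ∈ₛ D) where

    k∉D : ¬ (k ∈ₛ D)
    k∉D k∈ = ℕ.<-irrefl refl (D<k k k∈)

    card-RowSpan : ∀ {N} → Stair C D N → Card (RowSpan D N) (q ^ size D)
    card-RowSpan {N} (_ , indep) = card-map (λ y → linComb y N)
      (λ {y} s → y , s , refl) (λ q → q) inj (card-Supp D)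
      where
      inj : ∀ {c c′} → Supp D c → Supp D c′ → linComb c N ≡ linComb c′ N → c ≡ c′
      inj {c} {c′} s s′ eq = vec-ext (λ i → x∙y⁻¹≈ε⇒x≈y _ _
        (trans (sym (-V-at c c′ i)) (trans (cong (λ v → lookup v i) (indep (c -V c′) s-s′ zero-comb)) (0V-at i))))
        where
        s-s′ : Supp D (c -V c′)
        s-s′ j ne with j ∈ₛ? D
        ... | yes j∈ = j∈
        ... | no j∉ = ⊥-elim (ne (trans (-V-at c c′ j) (trans (cong₂ _-F_ (supp-at D c s j j∉) (supp-at D c′ s′ j j∉)) (x-x≡0 0F))))
        zero-comb : linComb (c -V c′) N ≡ zeroV
        zero-comb = vec-ext (λ j → begin
          lookup (linComb (c -V c′) N) j      ≡⟨ trans (linComb-⊙ (c -V c′) N j) (−-⊙ N c c′ j) ⟩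
          (c ⊙ N) j -F (c′ ⊙ N) j             ≡⟨ cong (λ z → z -F (c′ ⊙ N) j) (trans (sym (linComb-⊙ c N j)) (trans (cong (λ v → lookup v j) eq) (linComb-⊙ c′ N j))) ⟩
          (c′ ⊙ N) j -F (c′ ⊙ N) j            ≡⟨ x-x≡0 _ ⟩
          0F                                  ≡⟨ 0V-at j ⟨
          lookup zeroV j                      ∎)

    RowSpan⊆Supp : ∀ {N v} → Stair C D N → RowSpan D N v → Supp Ck v
    RowSpan⊆Supp {N} (tri , _) (y , s , refl) i ne =
      let j , ne′ = ∑-nonzero (λ eq → ne (trans (linComb-⊙ y N i) eq))
          a , b , c = tri j i (*-nonzeroʳ ne′) in
      Ck⁺ i a (ℕ.<-trans c (D<k j b))

    New : Mat n → Mat n → Set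
    New N N′ = ∃[ v ] ((Supp Ck v × ¬ RowSpan D N v) × N′ ≡ N [ k ]≔ v)

    card-New : ∀ N → Stair C D N → Card (New N) (q ^ size Ck ℕ.∸ q ^ size D)
    card-New N st = card-map (λ v → N [ k ]≔ v) (λ {v} h → v , h , refl) (λ q → q)
      (λ {v} {v′} _ _ eq → trans (sym (lookup-≔-same N k v)) (trans (cong (λ M → lookup M k) eq) (lookup-≔-same N k v′)))
      (card-∖ (card-dec _≟V_ (card-RowSpan st)) (RowSpan⊆Supp {N} st) (card-Supp Ck) (card-RowSpan st))

    stair-row-zero : ∀ {N} → Stair C D N → lookup N k ≡ zeroV
    stair-row-zero (tri , _) = vec-ext (λ i → trans (¬nonzero (λ ne → k∉D (proj₁ (proj₂ (tri k i ne))))) (sym (0V-at i)))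

    stair⁺ : ∀ {N N′} → Stair C D N → New N N′ → Stair C E N′
    stair⁺ {N} st@(tri , indep) (v , (sv , v∉) , refl) = tri′ , indep′
      where
      tri′ : ∀ j i → Nonzero (ent (N [ k ]≔ v) j i) → i ∈ₛ C × j ∈ₛ E × i Fin.< j
      tri′ j i ne with j Fin.≟ k
      ... | yes refl = let a , b = Ck⁻ i (sv i (λ eq → ne (trans (cong (λ r → lookup r i) (lookup-≔-same N j v)) eq))) in a , k∈E , b
      ... | no j≢k = let a , b , c = tri j i (λ eq → ne (trans (cong (λ r → lookup r i) (lookup-≔-other N k v j j≢k)) eq)) in
                     a , D⊆E j b , c
      indep′ : ∀ y → Supp E y → linComb y (N [ k ]≔ v) ≡ zeroV → y ≡ zeroV
      indep′ y sy eq = by-cases (nonzero? (lookup y k))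
        where
        y₀ = y [ k ]≔ 0F
        y₀-supp : Supp D y₀
        y₀-supp j ne with j Fin.≟ k
        ... | yes refl = ⊥-elim (ne (lookup-≔-same y j 0F))
        ... | no j≢k = E⊆D∪k j (sy j (λ e → ne (trans (lookup-≔-other y k 0F j j≢k) e))) j≢k
        rel : ∀ j → lookup (linComb y₀ N) j +F lookup y k *F lookup v j ≡ 0F
        rel j = trans (sym (linComb-≔ y N k v j)) (trans (cong (λ u → lookup u j) eq) (0V-at j))
        by-cases : Dec (Nonzero (lookup y k)) → y ≡ zeroV
        by-cases (no ¬ne) = trans (sym (≔-id y k (¬nonzero ¬ne))) (indep y₀ y₀-supp (vec-ext (λ j →
          trans (sym (+F-identityʳ _)) (trans (cong (lookup (linComb y₀ N) j +F_) (sym (trans (cong (_*F lookup v j) (¬nonzero ¬ne)) (zeroˡ _))))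
          (trans (rel j) (sym (0V-at j)))))))
        -- A relation with a nonzero coefficient at `k` can be solved for `v`, which would put `v`
        -- into the span of the earlier rows.
        by-cases (yes ne) = ⊥-elim (v∉ (c ·V y₀ , c-supp , vec-ext (λ j → sym (begin
          lookup (linComb (c ·V y₀) N) j   ≡⟨ trans (linComb-⊙ (c ·V y₀) N j) (trans (·-⊙ N c y₀ j) (cong (c *F_) (sym (linComb-⊙ y₀ N j)))) ⟩
          c *F a j                         ≡⟨ +F-identityʳ _ ⟨
          c *F a j +F 0F                   ≡⟨ cong (c *F a j +F_) (trans (sym (distribʳ (b j) c y⁻¹)) (trans (cong (_*F b j) (-‿inverseˡ y⁻¹)) (zeroˡ _))) ⟨
          c *F a j +F (c *F b j +F y⁻¹ *F b j) ≡⟨ +F-assoc _ _ _ ⟨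
          c *F a j +F c *F b j +F y⁻¹ *F b j   ≡⟨ cong (_+F y⁻¹ *F b j) (trans (sym (distribˡ c (a j) (b j))) (trans (cong (c *F_) (rel j)) (zeroʳ c))) ⟩
          0F +F y⁻¹ *F b j                 ≡⟨ +F-identityˡ _ ⟩
          y⁻¹ *F (lookup y k *F lookup v j) ≡⟨ *F-assoc _ _ _ ⟨
          y⁻¹ *F lookup y k *F lookup v j  ≡⟨ trans (cong (_*F lookup v j) (inv-*ˡ ne)) (*F-identityˡ _) ⟩
          lookup v j                       ∎))))
          where
          y⁻¹ = inv (lookup y k)
          c = -F_ y⁻¹
          a : Fin n → F
          a j = lookup (linComb y₀ N) j
          b : Fin n → F
          b j = lookup y k *F lookup v j
          c-supp : Supp D (c ·V y₀)
          c-supp j ne′ = y₀-supp j (*-nonzeroʳ (λ e → ne′ (trans (·V-at c y₀ j) e)))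

    stair⁻ : ∀ {N′} → Stair C E N′ → ∃[ N ] (Stair C D N × New N N′)
    stair⁻ {N′} (tri′ , indep′) = N , (tri , indep) , v , (sv , v∉) , sym restore
      where
      v = lookup N′ k
      N = N′ [ k ]≔ zeroV
      restore : N [ k ]≔ v ≡ N′
      restore = ≔-≔ N′ k zeroV v refl
      tri : ∀ j i → Nonzero (ent N j i) → i ∈ₛ C × j ∈ₛ D × i Fin.< j
      tri j i ne with j Fin.≟ k
      ... | yes refl = ⊥-elim (ne (trans (cong (λ r → lookup r i) (lookup-≔-same N′ j zeroV)) (0V-at i)))
      ... | no j≢k = let a , b , c = tri′ j i (λ eq → ne (trans (cong (λ r → lookup r i) (lookup-≔-other N′ k zeroV j j≢k)) eq)) in
                     a , E⊆D∪k j b j≢k , c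
      sv : Supp Ck v
      sv i ne = let a , _ , c = tri′ k i ne in Ck⁺ i a c
      y-clear : ∀ y → Supp D y → y [ k ]≔ 0F ≡ y
      y-clear y s = ≔-id y k (supp-at D y s k k∉D)
      comb : ∀ y j → lookup (linComb y N′) j ≡ lookup (linComb (y [ k ]≔ 0F) N) j +F lookup y k *F lookup v j
      comb y j = trans (cong (λ M → lookup (linComb y M) j) (sym restore)) (linComb-≔ y N k v j)
      indep : ∀ y → Supp D y → linComb y N ≡ zeroV → y ≡ zeroV
      indep y s eq = indep′ y (λ j ne → D⊆E j (s j ne)) (vec-ext (λ j → begin
        lookup (linComb y N′) j                                              ≡⟨ comb y j ⟩
        lookup (linComb (y [ k ]≔ 0F) N) j +F lookup y k *F lookup v j       ≡⟨ cong₂ (λ u a → lookup (linComb u N) j +F a *F lookup v j) (y-clear y s) (supp-at D y s k k∉D) ⟩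
        lookup (linComb y N) j +F 0F *F lookup v j                           ≡⟨ trans (cong (lookup (linComb y N) j +F_) (zeroˡ _)) (+F-identityʳ _) ⟩
        lookup (linComb y N) j                                               ≡⟨ cong (λ u → lookup u j) eq ⟩
        lookup zeroV j                                                       ∎))
      v∉ : ¬ RowSpan D N v
      v∉ (y , s , v≡) = 0≢1 (sym (begin
        1F            ≡⟨ +F-identityʳ 1F ⟨
        1F +F 0F      ≡⟨ cong (1F +F_) -1≡0 ⟨
        1F -F 1F      ≡⟨ x-x≡0 1F ⟩
        0F            ∎))
        where
        -- If `v` were the combination of the earlier rows with coefficients `y`, this would be a
        -- relation among the rows of `N′`.
        z = y [ k ]≔ -1F
        z-supp : Supp E z
        z-supp j ne with j Fin.≟ k
        ... | yes refl = k∈E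
        ... | no j≢k = D⊆E j (s j (λ e → ne (trans (lookup-≔-other y k -1F j j≢k) e)))
        -1≡0 : -1F ≡ 0F
        -1≡0 = trans (sym (lookup-≔-same y k -1F)) (trans (cong (λ u → lookup u k) (indep′ z z-supp (vec-ext (λ j → begin
          lookup (linComb z N′) j                                          ≡⟨ comb z j ⟩
          lookup (linComb (z [ k ]≔ 0F) N) j +F lookup z k *F lookup v j
            ≡⟨ cong₂ (λ u a → lookup (linComb u N) j +F a *F lookup v j) (≔-≔ y k -1F 0F (supp-at D y s k k∉D)) (lookup-≔-same y k -1F) ⟩
          lookup (linComb y N) j +F -1F *F lookup v j                      ≡⟨ cong₂ (λ u a → lookup u j +F a) (sym v≡) (-1*x _) ⟩
          lookup v j -F lookup v j                                         ≡⟨ x-x≡0 _ ⟩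
          0F                                                               ≡⟨ 0V-at j ⟨
          lookup zeroV j                                                   ∎)))) (0V-at k))

    card-step : ∀ {N} → Card (Stair C D) N → Card (Stair C E) (N ℕ.* (q ^ size Ck ℕ.∸ q ^ size D))
    card-step c = card-⇔ (λ { (N , st , new) → stair⁺ st new }) (λ st → stair⁻ st)
      (card-× {Q = New} c card-New (card-dec (≡-dec _≟V_) c)
        -- Row `k` of the smaller matrix is zero, so clearing that row recovers the smaller matrix
        -- from the larger.
        (λ { {N₁} {N₂} st₁ st₂ (v₁ , _ , refl) (v₂ , _ , eq) →
          trans (sym (≔-≔ N₁ k v₁ zeroV (stair-row-zero st₁)))
                (trans (cong (_[ k ]≔ zeroV) eq) (≔-≔ N₂ k v₂ zeroV (stair-row-zero st₂))) }))

  card-Stair : ∀ (C D : Vec Bool n) → Card (Stair C D) (stairs q (λ x → count (_<ᵇ x) (elems C)) 0 (elems D))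
  card-Stair C D = subst (Card (Stair C D)) start
    (go D 0 refl (λ j j′ eq → cong (lookup D) (Fin.toℕ-injective eq)) (card-⇔ zero-stair stair-zero (card-singleton {A = Mat n} (replicate n zeroV))))
    where
    a : ℕ → ℕ
    a x = count (_<ᵇ x) (elems C)
    none : ∀ j → ¬ (j ∈ₛ below 0 D)
    none j h with () ← proj₂ (below⁻ 0 D j h)
    ent-zero : ∀ j i → ent (replicate n (zeroV {n})) j i ≡ 0F
    ent-zero j i = trans (cong (λ r → lookup r i) (lookup-replicate j zeroV)) (0V-at i)
    zero-stair : ∀ {N} → N ≡ replicate n zeroV → Stair C (below 0 D) N
    zero-stair refl = (λ j i ne → ⊥-elim (ne (ent-zero j i))) ,
      (λ y s _ → vec-ext (λ j → trans (supp-at (below 0 D) y s j (none j)) (sym (0V-at j))))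
    stair-zero : ∀ {N} → Stair C (below 0 D) N → N ≡ replicate n zeroV
    stair-zero (tri , _) = mat-ext (λ j i → trans (¬nonzero (λ ne → none j (proj₁ (proj₂ (tri j i ne))))) (sym (ent-zero j i)))
    start : 1 ℕ.* stairs q a (size (below 0 D)) (elems D) ≡ stairs q a 0 (elems D)
    start = trans (ℕ.*-identityˡ _) (cong (λ i → stairs q a i (elems D)) (size-empty (below 0 D) none))
    -- A scan from left to right: the coordinates below `k` have been treated, `E` is the remaining
    -- suffix of `D`, and `N` counts the matrices for the treated part. An element of `D` costs one
    -- `StairStep`, any other coordinate changes nothing.
    go : ∀ {l} (E : Vec Bool l) k → k ℕ.+ l ≡ n →
         (∀ (j : Fin n) (j′ : Fin l) → toℕ j ≡ k ℕ.+ toℕ j′ → lookup D j ≡ lookup E j′) →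
         ∀ {N} → Card (Stair C (below k D)) N → Card (Stair C D) (N ℕ.* stairs q a (size (below k D)) (elemsFrom k E))
    go [] k k≡n h {N} c = subst (Card (Stair C D)) (sym (ℕ.*-identityʳ N)) (subst (λ E → Card (Stair C E) N) below-all c)
      where
      below-all : below k D ≡ D
      below-all = ⊆-antisym (λ j j∈ → proj₁ (below⁻ k D j j∈))
        (λ j j∈ → below⁺ k D j j∈ (ℕ.≤-trans (Fin.toℕ<n j) (ℕ.≤-reflexive (trans (sym k≡n) (ℕ.+-identityʳ k)))))
    go {suc l} (b ∷ E) k k+l≡n h {N} c = by-head b refl
      where
      k<n : k < n
      k<n = ℕ.≤-trans (s≤s (ℕ.m≤m+n k l)) (ℕ.≤-reflexive (trans (sym (ℕ.+-suc k l)) k+l≡n))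
      kF = Fin.fromℕ< k<n
      toℕ-kF : toℕ kF ≡ k
      toℕ-kF = Fin.toℕ-fromℕ< k<n
      D-k : lookup D kF ≡ b
      D-k = h kF zero (trans toℕ-kF (sym (ℕ.+-identityʳ k)))
      h′ : ∀ (j : Fin n) (j′ : Fin l) → toℕ j ≡ suc k ℕ.+ toℕ j′ → lookup D j ≡ lookup E j′
      h′ j j′ eq = h j (suc j′) (trans eq (sym (ℕ.+-suc k (toℕ j′))))
      <suc : ∀ (j : Fin n) → toℕ j < suc k → j ≢ kF → toℕ j < k
      <suc j (s≤s j≤k) ne = ℕ.≤∧≢⇒< j≤k (λ eq → ne (Fin.toℕ-injective (trans eq (sym toℕ-kF))))
      by-head : ∀ b′ → b ≡ b′ → Card (Stair C D) (N ℕ.* stairs q a (size (below k D)) (elemsFrom k (b ∷ E)))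
      by-head false refl = subst (λ i → Card (Stair C D) (N ℕ.* stairs q a (size i) (elemsFrom (suc k) E))) (sym same)
        (go E (suc k) (trans (sym (ℕ.+-suc k l)) k+l≡n) h′ (subst (λ G → Card (Stair C G) N) same c))
        where
        same : below k D ≡ below (suc k) D
        same = ⊆-antisym
          (λ j j∈ → let x , y = below⁻ k D j j∈ in below⁺ (suc k) D j x (ℕ.m≤n⇒m≤1+n y))
          (λ j j∈ → let x , y = below⁻ (suc k) D j j∈ in
            below⁺ k D j x (<suc j y (λ { refl → false⇒∉ D-k x })))
      by-head true refl = subst (Card (Stair C D))
        (trans (cong (λ z → N ℕ.* (q ^ size (below k C) ℕ.∸ q ^ size (below k D)) ℕ.* stairs q a z (elemsFrom (suc k) E)) size-suc)
        (trans (ℕ.*-assoc N _ _)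
          (cong (λ z → N ℕ.* ((q ^ z ℕ.∸ q ^ size (below k D)) ℕ.* stairs q a (suc (size (below k D))) (elemsFrom (suc k) E))) (size-below k C))))
        (go E (suc k) (trans (sym (ℕ.+-suc k l)) k+l≡n) h′ (Step.card-step c))
        where
        k∈ : kF ∈ₛ below (suc k) D
        k∈ = below⁺ (suc k) D kF D-k (s≤s (ℕ.≤-reflexive toℕ-kF))
        k∉ : ¬ (kF ∈ₛ below k D)
        k∉ k∈′ = ℕ.<-irrefl toℕ-kF (proj₂ (below⁻ k D kF k∈′))
        up : below k D ⊆ below (suc k) D
        up j j∈ = let x , y = below⁻ k D j j∈ in below⁺ (suc k) D j x (ℕ.m≤n⇒m≤1+n y)
        down : ∀ j → j ∈ₛ below (suc k) D → j ≢ kF → j ∈ₛ below k D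
        down j j∈ ne = let x , y = below⁻ (suc k) D j j∈ in below⁺ k D j x (<suc j y ne)
        size-suc : size (below (suc k) D) ≡ suc (size (below k D))
        size-suc = size-insert (below k D) (below (suc k) D) kF k∈ k∉ (λ j ne → bool-ext (up j) (λ j∈ → down j j∈ ne))
        belowC⁺ : ∀ i → i ∈ₛ C → i Fin.< kF → i ∈ₛ below k C
        belowC⁺ i i∈ lt = below⁺ k C i i∈ (subst (toℕ i <_) toℕ-kF lt)
        belowC⁻ : ∀ i → i ∈ₛ below k C → i ∈ₛ C × i Fin.< kF
        belowC⁻ i i∈ = let x , y = below⁻ k C i i∈ in x , subst (toℕ i <_) (sym toℕ-kF) y
        below-D : ∀ j → j ∈ₛ below k D → j Fin.< kF
        below-D j j∈ = subst (toℕ j <_) (sym toℕ-kF) (proj₂ (below⁻ k D j j∈))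
        module Step = StairStep C (below k C) (below k D) (below (suc k) D) kF belowC⁺ belowC⁻ below-D up k∈ down

-- Counting subspaces by partial profile

module Main {q : ℕ} (𝔽 : FieldOn q) {n : ℕ} (d : Vec (Fin q) n)
            (distinct : ∀ i j → lookup d i ≡ lookup d j → i ≡ j) where

  open Field 𝔽
  open Spaces 𝔽
  open Krylov 𝔽 d
  open Counts 𝔽 {n}

  does-true⁻ : ∀ {P : Set} (P? : Dec P) → does P? ≡ true → P
  does-true⁻ (yes p) _ = p

  memB : Vec Bool n → Mat n → Vec F n → Bool
  memB C A v = does (mem? C A v)

  memB⁻ : ∀ C A v → memB C A v ≡ true → Mem C A v
  memB⁻ C A v = does-true⁻ (mem? C A v)

  memB⁺ : ∀ C A v → Mem C A v → memB C A v ≡ true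
  memB⁺ C A v = dec-true (mem? C A v)

  memB-sub : ∀ C A → Sub (InW (memB C A))
  memB-sub C A = let z , a , s = mem-sub C A in
    memB⁺ C A zeroV z ,
    (λ u v hu hv → memB⁺ C A (u +V v) (a u v (memB⁻ C A u hu) (memB⁻ C A v hv))) ,
    (λ c v hv → memB⁺ C A (c ·V v) (s c v (memB⁻ C A v hv)))

  card-memB : ∀ C A → Reduced C A → Card (InW (memB C A)) (q ^ size C)
  card-memB C A r = card-⇔ (λ {v} → memB⁺ C A v) (λ {v} → memB⁻ C A v) (card-mem C {A} r)

  RowSp : Mat n → Vec F n → Set
  RowSp B v = ∃[ x ] (v ≡ linComb x B)

  rowSp? : ∀ B → Decidable (RowSp B)
  rowSp? B v = anyVec? (λ x → v ≟V linComb x B)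

  rowSp-sub : ∀ B → Sub (RowSp B)
  rowSp-sub B =
    (zeroV , vec-ext (λ j → trans (0V-at j) (sym (trans (linComb-⊙ zeroV B j) (0-⊙ B j))))) ,
    (λ { u v (x , refl) (y , refl) → x +V y , vec-ext (λ j →
      trans (+V-at (linComb x B) (linComb y B) j) (trans (cong₂ _+F_ (linComb-⊙ x B j) (linComb-⊙ y B j))
        (sym (trans (linComb-⊙ (x +V y) B j) (+-⊙ B x y j))))) }) ,
    (λ { a v (x , refl) → a ·V x , vec-ext (λ j →
      trans (·V-at a (linComb x B) j) (trans (cong (a *F_) (linComb-⊙ x B j))
        (sym (trans (linComb-⊙ (a ·V x) B j) (·-⊙ B a x j))))) })

  unit : Fin n → Vec F n
  unit i = tabulate (δ i)

  unit-⊙ : ∀ (B : Mat n) i j → (unit i ⊙ B) j ≡ ent B i j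
  unit-⊙ B i j = trans
    (∑-single i (λ k ne → trans (cong (_*F ent B k j) (trans (lookup∘tabulate (δ i) k) (δ-≢ i k (ne ∘ sym)))) (zeroˡ _)))
    (trans (cong (_*F ent B i j) (trans (lookup∘tabulate (δ i) i) (δ-refl i))) (*F-identityˡ _))

  row-∈ : ∀ (B : Mat n) i → RowSp B (lookup B i)
  row-∈ B i = unit i , vec-ext (λ j → sym (trans (linComb-⊙ (unit i) B j) (unit-⊙ B i j)))

  gap : Fin n → Fin n → F
  gap i j = lookup d j -F lookup d i

  gap-nonzero : ∀ {i j} → i Fin.< j → Nonzero (gap i j)
  gap-nonzero {i} {j} lt eq = ℕ.<-irrefl (cong toℕ (sym (distinct j i (x∙y⁻¹≈ε⇒x≈y _ _ eq)))) lt

  -- Modulo Mem C A, the vector Δ (e i + A i) is row i of comm A.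
  comm : Mat n → Mat n
  comm A = mk (λ i j → gap i j *F ent A i j)

  uncomm : Mat n → Mat n
  uncomm B = mk (λ i j → inv (gap i j) *F ent B i j)

  StrictlyUpper : Mat n → Set
  StrictlyUpper B = ∀ i j → Nonzero (ent B i j) → i Fin.< j

  -- A nonzero entry lies above the diagonal, where the gap is invertible because the entries of `d`
  -- are distinct; at a zero entry both sides vanish.
  comm-uncomm : ∀ B → StrictlyUpper B → comm (uncomm B) ≡ B
  comm-uncomm B up = mat-ext at
    where
    at : ∀ i j → ent (comm (uncomm B)) i j ≡ ent B i j
    at i j = trans (ent-mk _ i j) (trans (cong (gap i j *F_) (ent-mk _ i j)) (go (nonzero? (ent B i j))))
      where
      go : Dec (Nonzero (ent B i j)) → gap i j *F (inv (gap i j) *F ent B i j) ≡ ent B i j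
      go (yes ne) = trans (sym (*F-assoc _ _ _)) (trans (cong (_*F ent B i j) (inv-*ʳ (gap-nonzero (up i j ne)))) (*F-identityˡ _))
      go (no ¬ne) = trans (cong (λ z → gap i j *F (inv (gap i j) *F z)) (¬nonzero ¬ne))
        (trans (cong (gap i j *F_) (zeroʳ _)) (trans (zeroʳ _) (sym (¬nonzero ¬ne))))

  uncomm-comm : ∀ A → StrictlyUpper A → uncomm (comm A) ≡ A
  uncomm-comm A up = mat-ext at
    where
    at : ∀ i j → ent (uncomm (comm A)) i j ≡ ent A i j
    at i j = trans (ent-mk _ i j) (trans (cong (inv (gap i j) *F_) (ent-mk _ i j)) (go (nonzero? (ent A i j))))
      where
      go : Dec (Nonzero (ent A i j)) → inv (gap i j) *F (gap i j *F ent A i j) ≡ ent A i j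
      go (yes ne) = trans (sym (*F-assoc _ _ _)) (trans (cong (_*F ent A i j) (inv-*ˡ (gap-nonzero (up i j ne)))) (*F-identityˡ _))
      go (no ¬ne) = trans (cong (λ z → inv (gap i j) *F (gap i j *F z)) (¬nonzero ¬ne))
        (trans (cong (inv (gap i j) *F_) (zeroʳ _)) (trans (zeroʳ _) (sym (¬nonzero ¬ne))))

  comm-nonzero : ∀ A i j → Nonzero (ent (comm A) i j) → Nonzero (ent A i j)
  comm-nonzero A i j ne = *-nonzeroʳ (λ eq → ne (trans (ent-mk _ i j) eq))

  uncomm-nonzero : ∀ B i j → Nonzero (ent (uncomm B) i j) → Nonzero (ent B i j)
  uncomm-nonzero B i j ne = *-nonzeroʳ (λ eq → ne (trans (ent-mk _ i j) eq))

  module _ (S C : Vec Bool n) (A : Mat n) (r : RREF S C A) where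

    red : Reduced C A
    red = RREF⇒Reduced S C {A} r

    rowSp-supp : ∀ {v} → RowSp (comm A) v → Supp (S ─ C) v
    rowSp-supp (x , refl) j ne =
      let i , ne′ = ∑-nonzero (λ eq → ne (trans (linComb-⊙ x (comm A) j) eq)) in
      proj₁ (proj₂ (r i j (comm-nonzero A i j (*-nonzeroʳ ne′))))

    -- Off the pivots, write `d j` as `d i` plus the gap in each term: the first part gives the
    -- member of the space with the pivot coordinates of `Δ w`, the second a combination of the rows
    -- of `comm A`. At the pivots the second part is zero.
    Δ-splits : ∀ {w} → Mem C A w → Δ w ≡ extend C A (Δ w) +V linComb w (comm A)
    Δ-splits {w} mw = vec-ext at
      where
      B = comm A
      term : ∀ i j → lookup d j *F (lookup w i *F ent A i j)
                     ≡ lookup (Δ w) i *F ent A i j +F lookup w i *F ent B i j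
      term i j = begin
        lookup d j *F (lookup w i *F ent A i j)
          ≡⟨ cong (_*F (lookup w i *F ent A i j)) (y+[x-y]≡x (lookup d j) (lookup d i)) ⟨
        (lookup d i +F gap i j) *F (lookup w i *F ent A i j)
          ≡⟨ solve 4 (λ x g w a → (x :+ g) :* (w :* a) := x :* w :* a :+ w :* (g :* a)) refl (lookup d i) (gap i j) (lookup w i) (ent A i j) ⟩
        lookup d i *F lookup w i *F ent A i j +F lookup w i *F (gap i j *F ent A i j)
          ≡⟨ cong₂ (λ a b → a *F ent A i j +F lookup w i *F b) (Δ-at w i) (ent-mk _ i j) ⟨
        lookup (Δ w) i *F ent A i j +F lookup w i *F ent B i j ∎
      at : ∀ j → lookup (Δ w) j ≡ lookup (extend C A (Δ w) +V linComb w B) j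
      at j with j ∈ₛ? C
      ... | yes j∈ = sym (trans (+V-at (extend C A (Δ w)) (linComb w B) j)
        (trans (cong₂ _+F_ (extend-∈ C A (Δ w) j j∈)
          (¬nonzero (λ ne → proj₂ (∈-─⁻ S C j (rowSp-supp (w , refl) j ne)) j∈))) (+F-identityʳ _)))
      ... | no j∉ = begin
        lookup (Δ w) j                                        ≡⟨ Δ-at w j ⟩
        lookup d j *F lookup w j                              ≡⟨ cong (lookup d j *F_) (mw j j∉) ⟩
        lookup d j *F (w ⊙ A) j                               ≡⟨ *-distribˡ-sum (lookup d j) (λ i → lookup w i *F ent A i j) ⟩
        ∑ (λ i → lookup d j *F (lookup w i *F ent A i j))     ≡⟨ ∑-cong (λ i → term i j) ⟩
        ∑ (λ i → lookup (Δ w) i *F ent A i j +F lookup w i *F ent B i j)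
          ≡⟨ ∑-distrib-+ (λ i → lookup (Δ w) i *F ent A i j) (λ i → lookup w i *F ent B i j) ⟩
        (Δ w ⊙ A) j +F (w ⊙ B) j                              ≡⟨ cong₂ _+F_ (extend-∉ C A (Δ w) j j∉) (linComb-⊙ w B j) ⟨
        lookup (extend C A (Δ w)) j +F lookup (linComb w B) j ≡⟨ +V-at (extend C A (Δ w)) (linComb w B) j ⟨
        lookup (extend C A (Δ w) +V linComb w B) j            ∎

    -- `U` is any Boolean form of the row space of `comm A`; both `memB D A′` and the decision by
    -- `rowSp?` are put in its place later.
    module WithU (U : Vec F n → Bool) (U⁻ : ∀ v → InW U v → RowSp (comm A) v) (U⁺ : ∀ v → RowSp (comm A) v → InW U v) where

      private
        W = memB C A
        B = comm A
        U-sub : Sub (InW U)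
        U-sub = let z , a , s = rowSp-sub B in
          U⁺ zeroV z , (λ u v hu hv → U⁺ (u +V v) (a u v (U⁻ u hu) (U⁻ v hv))) , (λ c v hv → U⁺ (c ·V v) (s c v (U⁻ v hv)))
        U-vanishes : ∀ {u} → InW U u → Vanishes C u
        U-vanishes {u} hu i i∈ = ¬nonzero (λ ne → proj₂ (∈-─⁻ S C i (rowSp-supp (U⁻ u hu) i ne)) i∈)
        W-meets : ∀ {w} → InW W w → Vanishes C w → w ≡ zeroV
        W-meets {w} hw van = mem-determined C A red w zeroV (memB⁻ C A w hw) (proj₁ (mem-sub C A))
          (λ i i∈ → trans (van i i∈) (sym (0V-at i)))
        W-extend : ∀ x → InW W (extend C A x)
        W-extend x = memB⁺ C A (extend C A x) (extend-mem C A red x)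
        split : ∀ {w} → InW W w → ∃[ w′ ] ∃[ u ] (InW W w′ × InW U u × Δ w ≡ w′ +V u)
        split {w} hw = extend C A (Δ w) , linComb w B , W-extend (Δ w) , U⁺ _ (w , refl) , Δ-splits (memB⁻ C A w hw)
        -- The rows outside `C` are zero, so the coefficient vector may be replaced by a member of
        -- `W`, to which `Δ-splits` applies.
        comb-extend : ∀ x → linComb x B ≡ linComb (extend C A x) B
        comb-extend x = vec-ext (λ j → trans (linComb-⊙ x B j)
          (trans (sym (⊙-agree C B (λ i k ne → proj₁ (r i k (comm-nonzero A i k ne))) (extend C A x) x (extend-∈ C A x) j))
            (sym (linComb-⊙ (extend C A x) B j))))
        cover : ∀ {u} → InW U u → ∃[ w ] ∃[ w′ ] (InW W w × InW W w′ × u +V w′ ≡ Δ w)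
        cover {u} hu with U⁻ u hu
        ... | x , refl = w , extend C A (Δ w) , W-extend x , W-extend (Δ w) ,
          trans (cong (_+V extend C A (Δ w)) (comb-extend x))
            (trans (+V-comm (linComb w B) (extend C A (Δ w))) (sym (Δ-splits (extend-mem C A red x))))
          where
          w = extend C A x
        module Sh = Shift W U (memB-sub C A) U-sub C U-vanishes W-meets split cover

      profile⁺ : ∀ μ → Profile U μ → Profile W (size C ∷ μ)
      profile⁺ = Sh.profile-shift⁺ (card-memB C A red)

      profile⁻ : ∀ μ → Profile W (size C ∷ μ) → Profile U μ
      profile⁻ = Sh.profile-shift⁻ (card-memB C A red)

  size-profile : ∀ C A → Reduced C A → ∀ m μ → Profile (memB C A) (m ∷ μ) → size C ≡ m
  size-profile C A r m μ p = ^-injective (card-unique (card-memB C A r)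
    (subst (λ k → Card (InW (memB C A)) (q ^ k)) (ℕ.+-identityʳ m)
      (card-⇔ (K-one⁻ {memB C A}) (K-one⁺ {memB C A})
        (dim⇒card {X = K (memB C A) 1} (K-sub {memB C A} (memB-sub C A) 1) (p 1 (s≤s z≤n) (s≤s z≤n))))))

  Good : Vec Bool n → Vec Bool n → List ℕ → Mat n → Set
  Good S C μ A = RREF S C A × Profile (memB C A) (size C ∷ μ)

  transpose : Mat n → Mat n
  transpose N = mk (λ i j → ent N j i)

  -- For `Stair C D N`, row `i` is the member of `Mem D A` with coordinates `ent N j i` at `j` in
  -- `D`: there the sum vanishes, since reduced `A` has zero columns at its pivots, and off `D` the
  -- first term vanishes.
  fill : Mat n → Mat n → Mat n
  fill A N = mk (λ i j → ent N j i +F ∑ (λ k → ent N k i *F ent A k j))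

  build : Mat n → Mat n → Mat n
  build A N = uncomm (fill A N)

  module _ (C D : Vec Bool n) (N : Mat n) (st : Stair C D N) where

    private
      T = transpose N

    -- Row rank equals column rank. The pivots `E` of the row space of the transpose `T` lie in `D`;
    -- at an `f` in `D` outside `E`, column `f` of `T` would be a combination of the columns at `E`,
    -- which the independence in `Stair` excludes.
    stair-surjective : ∀ y → ∃[ x ] (∀ j → j ∈ₛ D → (x ⊙ T) j ≡ lookup y j)
    stair-surjective y with rref-exists {X = RowSp T} (rowSp? T) (rowSp-sub T)
    ... | E , A , red , to , from =
      let x , eq = from {extend E A y} (extend-mem E A red y) in
      x , λ j j∈ → trans (sym (linComb-⊙ x T j)) (trans (cong (λ v → lookup v j) (sym eq)) (extend-∈ E A y j (D⊆E j j∈)))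
      where
      T-supp : ∀ {v} → RowSp T v → Supp D v
      T-supp (x , refl) j ne = let i , ne′ = ∑-nonzero (λ eq → ne (trans (linComb-⊙ x T j) eq)) in
        proj₁ (proj₂ (proj₁ st j i (λ eq → *-nonzeroʳ ne′ (trans (ent-mk _ i j) eq))))
      E⊆D : E ⊆ D
      E⊆D i i∈ = T-supp (from {basisV E A i} (extend-mem E A red (unit i))) i
        (λ eq → 0≢1 (trans (sym eq) (trans (basisV-∈ E A i i i∈) (δ-refl i))))
      D⊆E : D ⊆ E
      D⊆E f f∈D with f ∈ₛ? E
      ... | yes f∈E = f∈E
      ... | no f∉E = ⊥-elim (0≢1 (trans (sym (trans (cong (λ v → lookup v f) z≡0) (0V-at f))) z-f))
        where
        z : Vec F n
        -- The coefficients of that relation: column `f` minus its expression through the pivot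
        -- columns.
        z = tabulate (λ k → δ f k -F ent A k f)
        z-at : ∀ k → lookup z k ≡ δ f k -F ent A k f
        z-at k = lookup∘tabulate _ k
        A-f : ¬ (Nonzero (ent A f f))
        A-f ne = ℕ.<-irrefl refl (proj₂ (proj₂ (red f f ne)))
        z-f : lookup z f ≡ 1F
        z-f = trans (z-at f) (trans (cong₂ _-F_ (δ-refl f) (¬nonzero A-f)) (trans (cong (1F +F_) -0#≈0#) (+F-identityʳ 1F)))
        z-supp : Supp D z
        z-supp k ne with k Fin.≟ f | nonzero? (ent A k f)
        ... | yes refl | _ = f∈D
        ... | no k≢f | yes ne′ = E⊆D k (proj₁ (red k f ne′))
        ... | no k≢f | no ¬ne′ = ⊥-elim (ne (trans (z-at k) (trans (cong₂ _-F_ (δ-≢ f k (k≢f ∘ sym)) (¬nonzero ¬ne′)) (x-x≡0 0F))))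
        z≡0 : z ≡ zeroV
        z≡0 = proj₂ st z z-supp (vec-ext (λ i → begin
          lookup (linComb z N) i                                            ≡⟨ linComb-⊙ z N i ⟩
          ∑ (λ k → lookup z k *F ent N k i)
            ≡⟨ ∑-cong (λ k → trans (cong₂ _*F_ (z-at k) (sym (ent-mk _ i k)))
                 (trans (distribʳ (ent T i k) (δ f k) (-F_ (ent A k f)))
                   (cong (δ f k *F ent T i k +F_) (trans (sym (-‿distribˡ-* _ _)) (trans (cong -F_ (*F-comm (ent A k f) (ent T i k))) (sym (-1*x _))))))) ⟩
          ∑ (λ k → δ f k *F ent T i k +F -1F *F (ent T i k *F ent A k f))
            ≡⟨ ∑-distrib-+ (λ k → δ f k *F ent T i k) (λ k → -1F *F (ent T i k *F ent A k f)) ⟩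
          ∑ (λ k → δ f k *F ent T i k) +F ∑ (λ k → -1F *F (ent T i k *F ent A k f))
            ≡⟨ cong₂ _+F_
                 (trans (∑-single f (λ k ne → trans (cong (_*F ent T i k) (δ-≢ f k (ne ∘ sym))) (zeroˡ _)))
                        (trans (cong (_*F ent T i f) (δ-refl f)) (*F-identityˡ _)))
                 (trans (sym (*-distribˡ-sum -1F (λ k → ent T i k *F ent A k f))) (-1*x _)) ⟩
          ent T i f -F (lookup T i ⊙ A) f                                  ≡⟨ cong (λ s → s -F (lookup T i ⊙ A) f) (to (row-∈ T i) f f∉E) ⟩
          (lookup T i ⊙ A) f -F (lookup T i ⊙ A) f                         ≡⟨ x-x≡0 _ ⟩
          0F                                                                ≡⟨ 0V-at i ⟨
          lookup zeroV i                                                    ∎))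

    module _ (A : Mat n) (red : Reduced D A) where

      private
        B = fill A N

      fill-row : ∀ x j → (x ⊙ B) j ≡ (x ⊙ T) j +F (tabulate (x ⊙ T) ⊙ A) j
      fill-row x j = begin
        ∑ (λ i → lookup x i *F ent B i j)
          ≡⟨ ∑-cong (λ i → trans (cong (lookup x i *F_) (ent-mk _ i j)) (distribˡ (lookup x i) (ent N j i) _)) ⟩
        ∑ (λ i → lookup x i *F ent N j i +F lookup x i *F ∑ (λ k → ent N k i *F ent A k j))
          ≡⟨ ∑-distrib-+ (λ i → lookup x i *F ent N j i) (λ i → lookup x i *F ∑ (λ k → ent N k i *F ent A k j)) ⟩
        ∑ (λ i → lookup x i *F ent N j i) +F ∑ (λ i → lookup x i *F ∑ (λ k → ent N k i *F ent A k j))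
          ≡⟨ cong₂ _+F_ (∑-cong (λ i → cong (lookup x i *F_) (sym (ent-mk _ i j)))) swap ⟩
        (x ⊙ T) j +F (tabulate (x ⊙ T) ⊙ A) j ∎
        where
        swap : ∑ (λ i → lookup x i *F ∑ (λ k → ent N k i *F ent A k j)) ≡ (tabulate (x ⊙ T) ⊙ A) j
        swap = begin
          ∑ (λ i → lookup x i *F ∑ (λ k → ent N k i *F ent A k j))
            ≡⟨ ∑-cong (λ i → *-distribˡ-sum (lookup x i) (λ k → ent N k i *F ent A k j)) ⟩
          ∑ (λ i → ∑ (λ k → lookup x i *F (ent N k i *F ent A k j)))
            ≡⟨ ∑-comm (λ i k → lookup x i *F (ent N k i *F ent A k j)) ⟩
          ∑ (λ k → ∑ (λ i → lookup x i *F (ent N k i *F ent A k j)))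
            ≡⟨ ∑-cong (λ k → trans (∑-cong (λ i → trans (sym (*F-assoc _ _ _)) (cong (λ z → lookup x i *F z *F ent A k j) (sym (ent-mk _ i k)))))
                 (trans (sym (*-distribʳ-sum (ent A k j) (λ i → lookup x i *F ent T i k))) (cong (_*F ent A k j) (sym (lookup∘tabulate (x ⊙ T) k))))) ⟩
          (tabulate (x ⊙ T) ⊙ A) j ∎

      fill-comb : ∀ x → linComb x B ≡ extend D A (tabulate (x ⊙ T))
      fill-comb x = vec-ext (λ j → trans (linComb-⊙ x B j) (trans (fill-row x j) (at j)))
        where
        G = tabulate (x ⊙ T)
        at : ∀ j → (x ⊙ T) j +F (G ⊙ A) j ≡ lookup (extend D A G) j
        at j with j ∈ₛ? D
        ... | yes j∈ = trans (cong₂ _+F_ (sym (lookup∘tabulate (x ⊙ T) j))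
            (∑-zero (λ k → trans (cong (lookup G k *F_) (¬nonzero (λ ne → proj₁ (proj₂ (red k j ne)) j∈))) (zeroʳ _))))
          (trans (+F-identityʳ _) (sym (extend-∈ D A G j j∈)))
        ... | no j∉ = trans (cong (_+F (G ⊙ A) j)
            (∑-zero (λ i → trans (cong (lookup x i *F_) (¬nonzero (λ ne → j∉ (proj₁ (proj₂ (proj₁ st j i (λ eq → ne (trans (ent-mk _ i j) eq)))))))) (zeroʳ _))))
          (trans (+F-identityˡ _) (sym (extend-∉ D A G j j∉)))

      fill-span⁻ : ∀ v → RowSp B v → Mem D A v
      fill-span⁻ v (x , eq) = subst (Mem D A) (sym (trans eq (fill-comb x))) (extend-mem D A red (tabulate (x ⊙ T)))

      fill-span⁺ : ∀ v → Mem D A v → RowSp B v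
      fill-span⁺ v mv = let x , h = stair-surjective v in
        x , trans (mem-determined D A red v (extend D A (tabulate (x ⊙ T))) mv (extend-mem D A red (tabulate (x ⊙ T)))
          (λ i i∈ → sym (trans (extend-∈ D A (tabulate (x ⊙ T)) i i∈) (trans (lookup∘tabulate (x ⊙ T) i) (h i i∈)))))
          (sym (fill-comb x))

      fill-∈ : ∀ i j → j ∈ₛ D → ent B i j ≡ ent N j i
      fill-∈ i j j∈ = trans (ent-mk _ i j) (trans (cong (ent N j i +F_)
        (∑-zero (λ k → trans (cong (ent N k i *F_) (¬nonzero (λ ne → proj₁ (proj₂ (red k j ne)) j∈))) (zeroʳ _)))) (+F-identityʳ _))

      -- An entry that does not come from `N` itself comes from a chain `i < k < j` with `k` in `D`;
      -- hence the matrix is strictly upper triangular and `comm` can be undone.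
      fill-nonzero : ∀ i j → Nonzero (ent B i j) → i ∈ₛ C × i Fin.< j × (j ∈ₛ D ⊎ (∃[ k ] Nonzero (ent A k j)))
      fill-nonzero i j ne with nonzero? (ent N j i)
      ... | yes ne′ = let a , b , c = proj₁ st j i ne′ in a , c , inj₁ b
      ... | no ¬ne′ =
        let k , ne′ = ∑-nonzero (λ eq → ne (trans (ent-mk _ i j) (trans (cong₂ _+F_ (¬nonzero ¬ne′) eq) (+F-identityˡ 0F))))
            a , b , c = proj₁ st k i (*-nonzeroˡ ne′)
            ne″ = *-nonzeroʳ ne′ in
        a , ℕ.<-trans c (proj₂ (proj₂ (red k j ne″))) , inj₂ (k , ne″)

      fill-upper : StrictlyUpper B
      fill-upper i j ne = proj₁ (proj₂ (fill-nonzero i j ne))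

      comm-build : comm (build A N) ≡ B
      comm-build = comm-uncomm B fill-upper

  -- Applying `comm` to `build A N` gives `fill A N`, whose columns at `D` are the rows of `N`; the
  -- other rows of `N` are zero.
  stair-determined : ∀ C D A → Reduced D A → ∀ {N N′} → Stair C D N → Stair C D N′ → build A N ≡ build A N′ → N ≡ N′
  stair-determined C D A red {N} {N′} st st′ eq = mat-ext at
    where
    B≡ : fill A N ≡ fill A N′
    B≡ = trans (sym (comm-build C D N st A red)) (trans (cong comm eq) (comm-build C D N′ st′ A red))
    at : ∀ j i → ent N j i ≡ ent N′ j i
    at j i with j ∈ₛ? D
    ... | yes j∈ = trans (sym (fill-∈ C D N st A red i j j∈)) (trans (cong (λ M → ent M i j) B≡) (fill-∈ C D N′ st′ A red i j j∈))
    ... | no j∉ = trans (¬nonzero (λ ne → j∉ (proj₁ (proj₂ (proj₁ st j i ne))))) (sym (¬nonzero (λ ne → j∉ (proj₁ (proj₂ (proj₁ st′ j i ne))))))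

  Built : Vec Bool n → Vec Bool n → Mat n → Mat n → Set
  Built C D A′ A = ∃[ N ] (Stair C D N × A ≡ build A′ N)

  built-span : ∀ C D A′ {A} → Reduced D A′ → Built C D A′ A →
               (∀ v → RowSp (comm A) v → Mem D A′ v) × (∀ v → Mem D A′ v → RowSp (comm A) v)
  built-span C D A′ red (N , st , refl) =
    (λ v → fill-span⁻ C D N st A′ red v ∘ subst (λ B → RowSp B v) (comm-build C D N st A′ red)) ,
    (λ v → subst (λ B → RowSp B v) (sym (comm-build C D N st A′ red)) ∘ fill-span⁺ C D N st A′ red v)

  built-good : ∀ S C D m μ A′ {A} → IsSub (S ─ C) m D → Good (S ─ C) D μ A′ → Built C D A′ A → Good S C (m ∷ μ) A
  built-good S C D m μ A′ {A} (D⊆ , |D|) (r′ , p′) b@(N , st , refl) =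
    r , WithU.profile⁺ S C A r (memB D A′)
      (λ v h → proj₂ (built-span C D A′ red′ b) v (memB⁻ D A′ v h))
      (λ v h → memB⁺ D A′ v (proj₁ (built-span C D A′ red′ b) v h))
      (m ∷ μ) (subst (λ k → Profile (memB D A′) (k ∷ μ)) |D| p′)
    where
    red′ = RREF⇒Reduced (S ─ C) D {A′} r′
    r : RREF S C A
    r i j ne with fill-nonzero C D N st A′ red′ i j (uncomm-nonzero (fill A′ N) i j ne)
    ... | i∈ , lt , inj₁ j∈ = i∈ , D⊆ j j∈ , lt
    ... | i∈ , lt , inj₂ (k , ne′) = i∈ , proj₁ (∈-─⁻ (S ─ C) D j (proj₁ (proj₂ (r′ k j ne′)))) , lt

  -- `D` and `A′` are the echelon form of the row space of `comm A`, and `N` consists of the columns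
  -- of `comm A` at `D`. The size of `D` is the first entry of the profile of that row space.
  good-built : ∀ S C m μ {A} → Good S C (m ∷ μ) A →
               ∃[ D ] (IsSub (S ─ C) m D × ∃[ A′ ] (Good (S ─ C) D μ A′ × Built C D A′ A))
  good-built S C m μ {A} (r , p) with rref-exists {X = RowSp (comm A)} (rowSp? (comm A)) (rowSp-sub (comm A))
  ... | D , A′ , red′ , to , from = D , (D⊆ , |D|) , A′ , (r′ , subst (λ k → Profile (memB D A′) (k ∷ μ)) (sym |D|) p′) , N , st , A≡
    where
    B = comm A
    basis-supp : ∀ i → i ∈ₛ D → Supp (S ─ C) (basisV D A′ i)
    basis-supp i i∈ = rowSp-supp S C A r (from {basisV D A′ i} (extend-mem D A′ red′ (unit i)))
    D⊆ : D ⊆ S ─ C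
    D⊆ i i∈ = basis-supp i i∈ i (λ eq → 0≢1 (trans (sym eq) (trans (basisV-∈ D A′ i i i∈) (δ-refl i))))
    r′ : RREF (S ─ C) D A′
    r′ i j ne = let i∈ , j∉ , lt = red′ i j ne in
      i∈ , ∈-─⁺ (S ─ C) D j (basis-supp i i∈ j (λ eq → ne (trans (sym (basisV-∉ D A′ i j j∉)) eq))) j∉ , lt
    p′ : Profile (memB D A′) (m ∷ μ)
    p′ = WithU.profile⁻ S C A r (memB D A′) (λ v h → from (memB⁻ D A′ v h)) (λ v h → memB⁺ D A′ v (to h)) (m ∷ μ) p
    |D| : size D ≡ m
    |D| = size-profile D A′ red′ m μ p′
    N : Mat n
    N = mk (λ j i → if lookup D j then ent B i j else 0F)
    N-∈ : ∀ j i → j ∈ₛ D → ent N j i ≡ ent B i j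
    N-∈ j i j∈ = trans (ent-mk _ j i) (cong (λ b → if b then ent B i j else 0F) j∈)
    N-∉ : ∀ j i → ¬ (j ∈ₛ D) → ent N j i ≡ 0F
    N-∉ j i j∉ = trans (ent-mk _ j i) (cong (λ b → if b then ent B i j else 0F) (∉⇒false j∉))
    tri : ∀ j i → Nonzero (ent N j i) → i ∈ₛ C × j ∈ₛ D × i Fin.< j
    tri j i ne with j ∈ₛ? D
    ... | no j∉ = ⊥-elim (ne (N-∉ j i j∉))
    ... | yes j∈ = let a , _ , c = r i j (comm-nonzero A i j (λ eq → ne (trans (N-∈ j i j∈) eq))) in a , j∈ , c
    -- Pair `y` with the basis vector of the row space at `j`: this gives the coordinate of `y` at
    -- `j`. As that vector is a combination of rows of `B`, the pairing is also a combination of the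
    -- entries of `y ⊙ N`, which are zero.
    indep : ∀ y → Supp D y → linComb y N ≡ zeroV → y ≡ zeroV
    indep y s eq = vec-ext at
      where
      at : ∀ j → lookup y j ≡ lookup zeroV j
      at j with j ∈ₛ? D
      ... | no j∉ = trans (supp-at D y s j j∉) (sym (0V-at j))
      ... | yes j∈ = let x , b≡ = from {basisV D A′ j} (extend-mem D A′ red′ (unit j)) in begin
        lookup y j
          ≡⟨ trans (∑-single j (λ k ne → trans (cong (lookup y k *F_) (δ-≢ j k (ne ∘ sym))) (zeroʳ _)))
                   (trans (cong (lookup y j *F_) (δ-refl j)) (*F-identityʳ _)) ⟨
        ∑ (λ k → lookup y k *F δ j k)
          ≡⟨ ∑-cong (λ k → basis-term k) ⟩
        ∑ (λ k → lookup y k *F lookup (basisV D A′ j) k)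
          ≡⟨ ∑-cong (λ k → cong (lookup y k *F_) (trans (cong (λ v → lookup v k) b≡) (linComb-⊙ x B k))) ⟩
        ∑ (λ k → lookup y k *F ∑ (λ i → lookup x i *F ent B i k))
          ≡⟨ ∑-cong (λ k → *-distribˡ-sum (lookup y k) (λ i → lookup x i *F ent B i k)) ⟩
        ∑ (λ k → ∑ (λ i → lookup y k *F (lookup x i *F ent B i k)))
          ≡⟨ ∑-comm (λ k i → lookup y k *F (lookup x i *F ent B i k)) ⟩
        ∑ (λ i → ∑ (λ k → lookup y k *F (lookup x i *F ent B i k)))
          ≡⟨ ∑-cong (λ i → trans (∑-cong (λ k → term (lookup x i) k i)) (sym (*-distribˡ-sum (lookup x i) (λ k → lookup y k *F ent N k i)))) ⟩
        ∑ (λ i → lookup x i *F (y ⊙ N) i)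
          ≡⟨ ∑-zero (λ i → trans (cong (lookup x i *F_) (trans (sym (linComb-⊙ y N i)) (trans (cong (λ v → lookup v i) eq) (0V-at i)))) (zeroʳ _)) ⟩
        0F             ≡⟨ 0V-at j ⟨
        lookup zeroV j ∎
        where
        basis-term : ∀ k → lookup y k *F δ j k ≡ lookup y k *F lookup (basisV D A′ j) k
        basis-term k with k ∈ₛ? D
        ... | yes k∈ = cong (lookup y k *F_) (sym (basisV-∈ D A′ j k k∈))
        ... | no k∉ rewrite supp-at D y s k k∉ = trans (zeroˡ _) (sym (zeroˡ _))
        term : ∀ c k i → lookup y k *F (c *F ent B i k) ≡ c *F (lookup y k *F ent N k i)
        term c k i with k ∈ₛ? D
        ... | yes k∈ = trans (solve 3 (λ y c b → y :* (c :* b) := c :* (y :* b)) refl (lookup y k) c (ent B i k))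
          (cong (λ z → c *F (lookup y k *F z)) (sym (N-∈ k i k∈)))
        ... | no k∉ rewrite supp-at D y s k k∉ = trans (zeroˡ _) (sym (trans (cong (c *F_) (zeroˡ _)) (zeroʳ c)))
    st : Stair C D N
    st = tri , indep
    B≡ : B ≡ fill A′ N
    B≡ = mat-ext at
      where
      at : ∀ i j → ent B i j ≡ ent (fill A′ N) i j
      at i j with j ∈ₛ? D
      ... | yes j∈ = trans (sym (N-∈ j i j∈)) (sym (fill-∈ C D N st A′ red′ i j j∈))
      ... | no j∉ = begin
        ent B i j                                            ≡⟨ to (row-∈ B i) j j∉ ⟩
        ∑ (λ k → ent B i k *F ent A′ k j)                    ≡⟨ ∑-cong (λ k → term k) ⟩
        ∑ (λ k → ent N k i *F ent A′ k j)                    ≡⟨ trans (cong (_+F ∑ (λ k → ent N k i *F ent A′ k j)) (N-∉ j i j∉)) (+F-identityˡ _) ⟨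
        ent N j i +F ∑ (λ k → ent N k i *F ent A′ k j)       ≡⟨ ent-mk _ i j ⟨
        ent (fill A′ N) i j                                  ∎
        where
        term : ∀ k → ent B i k *F ent A′ k j ≡ ent N k i *F ent A′ k j
        term k with nonzero? (ent A′ k j)
        ... | yes ne = cong (_*F ent A′ k j) (sym (N-∈ k i (proj₁ (red′ k j ne))))
        ... | no ¬ne rewrite ¬nonzero ¬ne = trans (zeroʳ _) (sym (zeroʳ _))
    A≡ : A ≡ build A′ N
    A≡ = trans (sym (uncomm-comm A (λ i j ne → proj₂ (proj₂ (r i j ne))))) (cong uncomm B≡)

  built-unique : ∀ C D D′ A′ A″ {A} → Reduced D A′ → Reduced D′ A″ → Built C D A′ A → Built C D′ A″ A → D ≡ D′ × A′ ≡ A″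
  built-unique C D D′ A′ A″ red red′ b b′ = rref-unique D D′ A′ A″ red red′
    (λ v h → proj₁ (built-span C D′ A″ red′ b′) v (proj₂ (built-span C D A′ red b) v h))
    (λ v h → proj₁ (built-span C D A′ red b) v (proj₂ (built-span C D′ A″ red′ b′) v h))

  -- In the base case the condition on the row space is empty, so all of `RREF S C` counts.
  -- Otherwise `A` corresponds to `D`, `A′` and `N`; since `A` determines them, the counts multiply
  -- for fixed `D` and add up over `D`.
  card-Good : ∀ μ S C → Card (Good S C μ) (pivotCount q S C μ)
  card-Good [] S C = card-⇔ (λ {A} r → r , WithU.profile⁺ S C A r (λ v → does (rowSp? (comm A) v))
      (λ v → does-true⁻ (rowSp? (comm A) v)) (λ v → dec-true (rowSp? (comm A) v)) [] (λ { (suc j) _ () }))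
    proj₁ (card-RREF S C)
  card-Good (m ∷ μ) S C = card-⇔
    (λ { (D , isSub , A′ , g , b) → built-good S C D m μ A′ isSub g b })
    (good-built S C m μ)
    (card-Σ {Q = λ D A → ∃[ A′ ] (Good (S ─ C) D μ A′ × Built C D A′ A)} _ (subs-enum (S ─ C) m)
      (λ D _ → subst (Card _) (ℕ.*-comm (pivotCount q (S ─ C) D μ) _)
        (card-× {Q = λ A′ A → Built C D A′ A} (card-Good μ (S ─ C) D)
          (λ A′ g → card-map (build A′) (λ {N} st → N , st , refl) (λ q → q)
            (λ st st′ → stair-determined C D A′ (RREF⇒Reduced (S ─ C) D {A′} (proj₁ g)) st st′) (card-Stair C D))
          (card-dec (≡-dec _≟V_) (card-Good μ (S ─ C) D))
          (λ {A′} {A″} g g′ b b′ → proj₂ (built-unique C D D A′ A″ (RREF⇒Reduced (S ─ C) D {A′} (proj₁ g)) (RREF⇒Reduced (S ─ C) D {A″} (proj₁ g′)) b b′))))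
      (isSub? (S ─ C) m)
      (λ { {D} {D′} _ _ (A′ , g , b) (A″ , g′ , b′) →
        proj₁ (built-unique C D D′ A′ A″ (RREF⇒Reduced (S ─ C) D {A′} (proj₁ g)) (RREF⇒Reduced (S ─ C) D′ {A″} (proj₁ g′)) b b′) }))

  profile-cong : ∀ {W W′} → (∀ v → W v ≡ W′ v) → ∀ μ → Profile W μ → Profile W′ μ
  profile-cong {W} {W′} h μ p j 1≤ j≤ = let b , b∈ , indep , span = p j 1≤ j≤ in
    b , (λ i → to (b∈ i)) , indep , (λ u k → span u (from k))
    where
    to : ∀ {v} → K W j v → K W′ j v
    to (ws , w∈ , eq) = ws , (λ i → trans (sym (h _)) (w∈ i)) , eq
    from : ∀ {v} → K W′ j v → K W j v
    from (ws , w∈ , eq) = ws , (λ i → trans (h _) (w∈ i)) , eq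

  -- Codes are compared by `≡`, subspaces only pointwise. The enumeration is made among codes, and
  -- `decode` carries it over.
  Coded : ℕ → List ℕ → Vec Bool n × Mat n → Set
  Coded m μ p = ∃[ C ] (IsSub (full n) m C × ∃[ A ] (Good (full n) C μ A × p ≡ (C , A)))

  card-Coded : ∀ m μ → Card (Coded m μ) (sum (map (λ C → pivotCount q (full n) C μ) (subs (full n) m)))
  card-Coded m μ = card-Σ {Q = λ C p → ∃[ A ] (Good (full n) C μ A × p ≡ (C , A))} _ (subs-enum (full n) m)
    (λ C _ → card-map (C ,_) (λ {A} g → A , g , refl) (λ q → q) (λ { _ _ refl → refl }) (card-Good μ (full n) C))
    (isSub? (full n) m)
    (λ { _ _ (_ , _ , refl) (_ , _ , refl) → refl })

  Target : List ℕ → (Vec F n → Bool) → Set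
  Target μ W = IsSubspace W × Profile W μ

  decode : Vec Bool n × Mat n → Vec F n → Bool
  decode (C , A) = memB C A

  decode-target : ∀ m μ {p} → Coded m μ p → Target (m ∷ μ) (decode p)
  decode-target m μ (C , (_ , |C|) , A , (_ , pr) , refl) = memB-sub C A , subst (λ k → Profile (memB C A) (k ∷ μ)) |C| pr

  decode-surjective : ∀ m μ {W} → Target (m ∷ μ) W → ∃[ p ] (Coded m μ p × (∀ v → W v ≡ decode p v))
  decode-surjective m μ {W} (sub , pr) with rref-exists {X = InW W} (λ v → W v Bool.≟ true) sub
  ... | C , A , red , to , from =
    (C , A) , (C , ((λ i _ → lookup-replicate i true) , |C|) , A , (r , subst (λ k → Profile (memB C A) (k ∷ μ)) (sym |C|) pr′) , refl) , W≡
    where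
    W≡ : ∀ v → W v ≡ memB C A v
    W≡ v = bool-ext (λ h → memB⁺ C A v (to h)) (λ h → from (memB⁻ C A v h))
    pr′ = profile-cong W≡ (m ∷ μ) pr
    |C| = size-profile C A red m μ pr′
    r : RREF (full n) C A
    r i j ne = let a , b , c = red i j ne in a , ∈-─⁺ (full n) C j (lookup-replicate j true) b , c

  decode-injective : ∀ m μ {p p′} → Coded m μ p → Coded m μ p′ → (∀ v → decode p v ≡ decode p′ v) → p ≡ p′
  decode-injective m μ (C , _ , A , (r , _) , refl) (C′ , _ , A′ , (r′ , _) , refl) h =
    let eC , eA = rref-unique C C′ A A′ (RREF⇒Reduced (full n) C {A} r) (RREF⇒Reduced (full n) C′ {A′} r′)
          (λ v k → memB⁻ C′ A′ v (trans (sym (h v)) (memB⁺ C A v k)))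
          (λ v k → memB⁻ C A v (trans (h v) (memB⁺ C′ A′ v k))) in
    cong₂ _,_ eC eA

  count-profile : ∀ m μ → CountIs (Target (m ∷ μ)) (sum (map (λ C → pivotCount q (full n) C μ) (subs (full n) m)))
  count-profile m μ with card-Coded m μ
  ... | ps , e , len = map decode ps ,
    All.tabulate (λ W∈ → let p , p∈ , eq = ∈-map⁻ decode W∈ in subst (Target (m ∷ μ)) (sym eq) (decode-target m μ (sound e p∈))) ,
    (λ W t → let p , c , eq = decode-surjective m μ t in lose (∈-map⁺ decode (complete e c)) eq) ,
    distinct-decode ps (sound e) (unique e) ,
    trans (length-map decode ps) len
    where
    distinct-decode : ∀ ps → (∀ {p} → p ∈ ps → Coded m μ p) → AllPairs _≢_ ps →
                      AllPairs (λ W W′ → ¬ (∀ v → W v ≡ W′ v)) (map decode ps)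
    distinct-decode [] h [] = []
    distinct-decode (p ∷ ps) h (p∉ ∷ u) =
      All.tabulate (λ W∈ → let p′ , p′∈ , eq = ∈-map⁻ decode W∈ in
        λ same → All.lookup p∉ p′∈ (decode-injective m μ (h (here refl)) (h (there p′∈))
          (λ v → trans (same v) (cong (λ W → W v) eq))))
      ∷ distinct-decode ps (h ∘ there) u

theorem4p21 : (q : ℕ) → IsPrimePower q → (𝔽 : FieldOn q) → (n : ℕ)
    → (d : Vec (Fin q) n) → (∀ i j → lookup d i ≡ lookup d j → i ≡ j)
    → (μ : List ℕ) → IsPartition μ → μ ≢ []
    → LinAlg.CountIs 𝔽 n
    (λ W → LinAlg.IsSubspace 𝔽 n W × LinAlg.HasPartialProfile 𝔽 n d W μ)
    (piFormula q n μ)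
theorem4p21 q _ 𝔽 n d distinct [] _ μ≢[] = ⊥-elim (μ≢[] refl)
-- `Fin 0` has no element to be `0F`. For `suc p` the `q ∸ 1` of the formula is `p` by computation.
theorem4p21 zero _ 𝔽 n d distinct (m ∷ μ) _ _ with () ← FieldOn.0F 𝔽
theorem4p21 (suc p) _ 𝔽 n d distinct (m ∷ μ) part _ =
  subst (LinAlg.CountIs 𝔽 n _) (sum-pivotCount p n m μ part) (Main.count-profile 𝔽 d distinct m μ)
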